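{- Let $F(n)$ be the maximum size of a Sidon subset of $[n]$ containing no solution with $x_1,\dots,x_5$ pairwise distinct to the equation $x_1+x_2+x_3+x_4=4x_5$. Then $F(n)=o(\sqrt n)$ and $F(n)\ge n^{1/2-o(1)}$ as $n\to\infty$.
   Context: $[n]=\{1,\dots,n\}$. A Sidon set is a set of integers with no nontrivial solution to $x_1+x_2=x_3+x_4$, where a solution is trivial if $(x_1,x_2)=(x_3,x_4)$ or $(x_1,x_2)=(x_4,x_3)$. -}

module Defs where

open import Data.Nat using (ℕ; zero; suc; _+_; _*_; _^_; _≤_)
open import Data.List using (List; length)
open import Data.List.Membership.Propositional using (_∈_)
open import Data.List.Relation.Unary.All using (All)
open import Data.List.Relation.Unary.Unique.Propositional using (Unique)
open import Data.Product using (_×_; Σ)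
open import Data.Sum using (_⊎_)
open import Relation.Binary.PropositionalEquality using (_≡_; _≢_)

-- A finite set of integers, represented as a duplicate-free list of naturals.
-- A ⊆ [n] = {1,…,n}.
InRange : ℕ → List ℕ → Set
InRange n A = All (λ x → 1 ≤ x × x ≤ n) A

Sidon : List ℕ → Set
Sidon A = ∀ {x₁ x₂ x₃ x₄} → x₁ ∈ A → x₂ ∈ A → x₃ ∈ A → x₄ ∈ A →
  x₁ + x₂ ≡ x₃ + x₄ → (x₁ ≡ x₃ × x₂ ≡ x₄) ⊎ (x₁ ≡ x₄ × x₂ ≡ x₃)

Distinct5 : ℕ → ℕ → ℕ → ℕ → ℕ → Set
Distinct5 a b c d e =
  a ≢ b × a ≢ c × a ≢ d × a ≢ e × b ≢ c × b ≢ d × b ≢ e ×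
  c ≢ d × c ≢ e × d ≢ e

NoDistinctSolution : List ℕ → Set
NoDistinctSolution A = ∀ {x₁ x₂ x₃ x₄ x₅} →
  x₁ ∈ A → x₂ ∈ A → x₃ ∈ A → x₄ ∈ A → x₅ ∈ A →
  Distinct5 x₁ x₂ x₃ x₄ x₅ → x₁ + x₂ + x₃ + x₄ ≢ 4 * x₅

Good : ℕ → List ℕ → Set
Good n A = Unique A × InRange n A × Sidon A × NoDistinctSolution A

IsF : ℕ → ℕ → Set
IsF n m = Σ (List ℕ) (λ A → Good n A × length A ≡ m) ×
          (∀ A → Good n A → length A ≤ m)

{-# OPTIONS --safe #-}
-- Upper bound.  Let A ⊆ [n] be Sidon with |A| = a and n ≤ C a².  On N = 5n vertices join u to
-- u + x, and u + 4x back to u, for x ∈ A.  Solutions of the equation are closed walks of length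
-- five; the N a / 5 trivial ones x₁ = … = x₅ are edge-disjoint, while a degenerate solution is
-- determined by two of its entries up to two choices, so there are O(N a²) closed walks if A has
-- no distinct solution.  The Sidon property bounds the codegrees, hence the L² norm of the edge
-- density averaged over the cells of any partition into at most a cells.  An energy increment
-- argument therefore yields a partition and a refinement with nearly the same energy, the finer
-- one approximating the graph in cut norm with a precision depending on the coarser one.  Some
-- trivial walk survives the deletion of all edges in small, sparse or irregular pairs of coarse
-- cells, and the five cells it visits contain ≫ a⁵ closed walks: two-step walks are nearly unique
-- and degrees are at most a, so cut-norm approximation suffices for counting.  Thus a is bounded.
--
-- Lower bound.  Take vectors in {0,…,d-1}^r on a sphere, read in base 4d: the mean of four of
-- them is a fifth only if all agree (Behrend).  Map such x to 4p x + (x² mod p) + 1, where p is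
-- a prime slightly above (4d)^r (Erdős–Turán).
module Submission where

open import Defs
open import Data.Nat
open import Data.Nat.Properties
open import Data.Nat.Combinatorics using (nC1≡n; nCk+nC[k+1]≡[n+1]C[k+1]; k>n⇒nCk≡0) renaming (_C_ to _choose_)
open import Data.Nat.Divisibility
open import Data.Nat.DivMod using (_%_; _/_; m%n<n; m≡m%n+[m/n]*n)
open import Data.Nat.Induction using (<-rec)
open import Data.Nat.ListAction using (product)
open import Data.Nat.Primality
open import Data.Nat.Primality.Factorisation using (factorise)
open import Data.Nat.Tactic.RingSolver using (solve-∀)
open import Data.Fin as Fin using (Fin; toℕ; fromℕ<)
open import Data.Fin.Properties using (toℕ-injective; toℕ<n; toℕ-fromℕ<)
open import Data.List using (List; []; _∷_; _++_; map; filter; length; lookup; cartesianProduct; allFin; downFrom)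
open import Data.List.Properties using (length-++; length-map; length-tabulate; length-downFrom)
open import Data.List.Membership.Propositional using (_∈_)
open import Data.List.Membership.Propositional.Properties
  using (∈-cartesianProduct⁺; ∈-allFin; ∈-downFrom⁺; ∈-lookup; ∈-map⁻; ∈-filter⁻)
open import Data.List.Relation.Unary.All as All using (All; []; _∷_)
open import Data.List.Relation.Unary.AllPairs using ([]; _∷_)
open import Data.List.Relation.Unary.Any using (here; there)
open import Data.List.Relation.Unary.Unique.Propositional using (Unique)
open import Data.List.Relation.Unary.Unique.Propositional.Properties using (allFin⁺; cartesianProduct⁺; map⁺; filter⁺)
import Data.List.Relation.Unary.All.Properties as AllProperties
open import Data.Vec using (Vec; []; _∷_)
open import Data.Product using (_×_; Σ; ∃; _,_; proj₁; proj₂; map₂; uncurry)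
open import Data.Product.Properties using (≡-dec)
open import Data.Sum as Sum using (_⊎_; inj₁; inj₂)
open import Data.Empty using (⊥; ⊥-elim)
open import Function using (id; _∘_)
open import Relation.Nullary using (Dec; yes; no; ¬_)
open import Relation.Nullary.Decidable using (_×-dec_; decidable-stable)
open import Relation.Binary using (DecidableEquality)
open import Relation.Binary.PropositionalEquality

-- Finite sums

-- The graph is sparse: when `N` is of order a² its density a / N tends to 0, so regularity for
-- dense graphs gives nothing. What replaces boundedness of the density is the codegree bound:
-- normalised by a², the energy of every partition into at most `a` cells is O(1), and energy
-- increments still terminate. Closed walks have to be bounded from below only, so the cut condition
-- is one-sided: on every rectangle the averaged model exceeds the graph by at most a small error.
-- All arithmetic stays in ℕ. Averages are multiplied by a common multiple `L` of the cell sizes,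
-- and inequalities are cross-multiplied. The goal of the upper bound is a decidable inequality, so
-- the regularity argument may be run as a derivation of ⊥. In the lower bound the prime may exceed
-- (4d)^r by a factor up to 2^r, since for large d this is only a small power of n. Such a prime
-- comes from comparing a central binomial coefficient with a common multiple of smooth numbers.

∑ : {A : Set} → List A → (A → ℕ) → ℕ
∑ []       f = 0
∑ (x ∷ xs) f = f x + ∑ xs f

module _ {A : Set} where

  ∑-cong : ∀ (xs : List A) {f g : A → ℕ} → (∀ x → f x ≡ g x) → ∑ xs f ≡ ∑ xs g
  ∑-cong []       eq = refl
  ∑-cong (x ∷ xs) eq = cong₂ _+_ (eq x) (∑-cong xs eq)

  ∑-mono : ∀ (xs : List A) {f g : A → ℕ} → (∀ x → f x ≤ g x) → ∑ xs f ≤ ∑ xs g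
  ∑-mono []       le = z≤n
  ∑-mono (x ∷ xs) le = +-mono-≤ (le x) (∑-mono xs le)

  ∑-+ : ∀ (xs : List A) (f g : A → ℕ) → ∑ xs (λ x → f x + g x) ≡ ∑ xs f + ∑ xs g
  ∑-+ []       f g = refl
  ∑-+ (x ∷ xs) f g = trans (cong (f x + g x +_) (∑-+ xs f g)) (eq (f x) (g x) (∑ xs f) (∑ xs g))
    where
    eq : ∀ a b c d → a + b + (c + d) ≡ a + c + (b + d)
    eq = solve-∀

  ∑-*ˡ : ∀ (xs : List A) c (f : A → ℕ) → ∑ xs (λ x → c * f x) ≡ c * ∑ xs f
  ∑-*ˡ []       c f = sym (*-zeroʳ c)
  ∑-*ˡ (x ∷ xs) c f = trans (cong (c * f x +_) (∑-*ˡ xs c f)) (sym (*-distribˡ-+ c (f x) (∑ xs f)))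

  ∑-*ʳ : ∀ (xs : List A) (f : A → ℕ) c → ∑ xs (λ x → f x * c) ≡ ∑ xs f * c
  ∑-*ʳ []       f c = refl
  ∑-*ʳ (x ∷ xs) f c = trans (cong (f x * c +_) (∑-*ʳ xs f c)) (sym (*-distribʳ-+ c (f x) (∑ xs f)))

  ∑-const : ∀ (xs : List A) c → ∑ xs (λ _ → c) ≡ length xs * c
  ∑-const []       c = refl
  ∑-const (x ∷ xs) c = cong (c +_) (∑-const xs c)

  ∑-zero : ∀ (xs : List A) → ∑ xs (λ _ → 0) ≡ 0
  ∑-zero xs = trans (∑-const xs 0) (*-zeroʳ (length xs))

  ∑-≤-const : ∀ (xs : List A) {f : A → ℕ} {c} → (∀ x → f x ≤ c) → ∑ xs f ≤ length xs * c
  ∑-≤-const xs {c = c} le = ≤-trans (∑-mono xs le) (≤-reflexive (∑-const xs c))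

  ∑-++ : ∀ (xs ys : List A) (f : A → ℕ) → ∑ (xs ++ ys) f ≡ ∑ xs f + ∑ ys f
  ∑-++ []       ys f = refl
  ∑-++ (x ∷ xs) ys f = trans (cong (f x +_) (∑-++ xs ys f)) (sym (+-assoc (f x) _ _))

  ∑-∈ : ∀ {xs : List A} {x} (f : A → ℕ) → x ∈ xs → f x ≤ ∑ xs f
  ∑-∈ f (here refl) = m≤m+n _ _
  ∑-∈ f (there x∈)  = ≤-trans (∑-∈ f x∈) (m≤n+m _ _)

  ∑-zero-or-witness : ∀ (xs : List A) (f : A → ℕ) → ∑ xs f ≡ 0 ⊎ ∃ λ x → 1 ≤ f x
  ∑-zero-or-witness []       f = inj₁ refl
  ∑-zero-or-witness (x ∷ xs) f with f x in eq
  ... | suc m = inj₂ (x , subst (1 ≤_) (sym eq) (s≤s z≤n))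
  ... | zero  = ∑-zero-or-witness xs f

∑-map : ∀ {A B : Set} (φ : A → B) xs (f : B → ℕ) → ∑ (map φ xs) f ≡ ∑ xs (f ∘ φ)
∑-map φ []       f = refl
∑-map φ (x ∷ xs) f = cong (f (φ x) +_) (∑-map φ xs f)

∑-swap : ∀ {A B : Set} (xs : List A) (ys : List B) (f : A → B → ℕ) →
         ∑ xs (λ x → ∑ ys (f x)) ≡ ∑ ys (λ y → ∑ xs (λ x → f x y))
∑-swap []       ys f = sym (∑-zero ys)
∑-swap (x ∷ xs) ys f = trans (cong (∑ ys (f x) +_) (∑-swap xs ys f)) (sym (∑-+ ys (f x) _))

∑-product : ∀ {A B : Set} (xs : List A) (ys : List B) (f : A × B → ℕ) →
            ∑ (cartesianProduct xs ys) f ≡ ∑ xs (λ x → ∑ ys (λ y → f (x , y)))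
∑-product []       ys f = refl
∑-product (x ∷ xs) ys f = trans (∑-++ (map (x ,_) ys) _ f)
  (cong₂ _+_ (∑-map (x ,_) ys f) (∑-product xs ys f))

length-cartesianProduct : ∀ {A B : Set} (xs : List A) (ys : List B) →
                          length (cartesianProduct xs ys) ≡ length xs * length ys
length-cartesianProduct []       ys = refl
length-cartesianProduct (x ∷ xs) ys = trans (length-++ (map (x ,_) ys))
  (cong₂ _+_ (length-map (x ,_) ys) (length-cartesianProduct xs ys))

∑∑-* : ∀ {A B : Set} (xs : List A) (ys : List B) (f : A → ℕ) (g : B → ℕ) →
       ∑ xs (λ x → ∑ ys (λ y → f x * g y)) ≡ ∑ xs f * ∑ ys g
∑∑-* xs ys f g = trans (∑-cong xs (λ x → ∑-*ˡ ys (f x) g)) (∑-*ʳ xs f (∑ ys g))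

-- Polarisation without signs, thanks to the absolute difference. Keeping the defect exact serves
-- both the Pythagorean identity for energies and the rigidity of means on a sphere.
square-split : ∀ a b → a * a + b * b ≡ 2 * (a * b) + ∣ a - b ∣ * ∣ a - b ∣
square-split zero    b       = refl
square-split (suc a) zero    = trans (+-identityʳ (suc a * suc a))
  (cong (λ z → 2 * z + suc a * suc a) (sym (*-zeroʳ (suc a))))
square-split (suc a) (suc b) = trans (eq₁ a b) (trans (cong (_+ 2 * (a + b + 1)) (square-split a b))
  (eq₂ a b (∣ a - b ∣ * ∣ a - b ∣)))
  where
  eq₁ : ∀ a b → suc a * suc a + suc b * suc b ≡ a * a + b * b + 2 * (a + b + 1)
  eq₁ = solve-∀
  eq₂ : ∀ a b d → 2 * (a * b) + d + 2 * (a + b + 1) ≡ 2 * (suc a * suc b) + d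
  eq₂ = solve-∀

2ab≤a²+b² : ∀ a b → 2 * (a * b) ≤ a * a + b * b
2ab≤a²+b² a b = ≤-trans (m≤m+n _ _) (≤-reflexive (sym (square-split a b)))

-- Doubled, both sides are sums over pairs (x, y), compared termwise by `2ab≤a²+b²` for `u x * v y`
-- and `v x * u y`.
cauchy-schwarz : ∀ {A : Set} (xs : List A) (u v : A → ℕ) →
  ∑ xs (λ x → u x * v x) * ∑ xs (λ x → u x * v x) ≤ ∑ xs (λ x → u x * u x) * ∑ xs (λ x → v x * v x)
cauchy-schwarz xs u v = *-cancelˡ-≤ 2 (begin
  2 * (S * S)
    ≡⟨ cong (2 *_) (sym (∑∑-* xs xs uv uv)) ⟩
  2 * ∑ xs (λ x → ∑ xs (λ y → uv x * uv y))
    ≡⟨ sym (∑-*ˡ xs 2 _) ⟩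
  ∑ xs (λ x → 2 * ∑ xs (λ y → uv x * uv y))
    ≡⟨ ∑-cong xs (λ x → sym (∑-*ˡ xs 2 _)) ⟩
  ∑ xs (λ x → ∑ xs (λ y → 2 * (uv x * uv y)))
    ≤⟨ ∑-mono xs (λ x → ∑-mono xs (λ y → step (u x) (v x) (u y) (v y))) ⟩
  ∑ xs (λ x → ∑ xs (λ y → uu x * vv y + vv x * uu y))
    ≡⟨ ∑-cong xs (λ x → ∑-+ xs _ _) ⟩
  ∑ xs (λ x → ∑ xs (λ y → uu x * vv y) + ∑ xs (λ y → vv x * uu y))
    ≡⟨ ∑-+ xs _ _ ⟩
  ∑ xs (λ x → ∑ xs (λ y → uu x * vv y)) + ∑ xs (λ x → ∑ xs (λ y → vv x * uu y))
    ≡⟨ cong₂ _+_ (∑∑-* xs xs uu vv) (∑∑-* xs xs vv uu) ⟩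
  ∑ xs uu * ∑ xs vv + ∑ xs vv * ∑ xs uu
    ≡⟨ eq (∑ xs uu) (∑ xs vv) ⟩
  2 * (∑ xs uu * ∑ xs vv) ∎)
  where
  open ≤-Reasoning
  uv uu vv : _ → ℕ
  uv x = u x * v x
  uu x = u x * u x
  vv x = v x * v x
  S = ∑ xs uv
  eq : ∀ a b → a * b + b * a ≡ 2 * (a * b)
  eq = solve-∀
  eq₁ : ∀ a b c d → 2 * ((a * b) * (c * d)) ≡ 2 * ((a * d) * (b * c))
  eq₁ = solve-∀
  eq₂ : ∀ a b c d → (a * d) * (a * d) + (b * c) * (b * c) ≡ (a * a) * (d * d) + (b * b) * (c * c)
  eq₂ = solve-∀
  step : ∀ a b c d → 2 * ((a * b) * (c * d)) ≤ (a * a) * (d * d) + (b * b) * (c * c)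
  step a b c d = ≤-trans (≤-reflexive (eq₁ a b c d))
    (≤-trans (2ab≤a²+b² (a * d) (b * c)) (≤-reflexive (eq₂ a b c d)))

^-distribʳ-* : ∀ m n k → (m * n) ^ k ≡ m ^ k * n ^ k
^-distribʳ-* m n zero    = refl
^-distribʳ-* m n (suc k) = trans (cong (m * n *_) (^-distribʳ-* m n k)) (eq m n (m ^ k) (n ^ k))
  where
  eq : ∀ a b x y → a * b * (x * y) ≡ a * x * (b * y)
  eq = solve-∀

1≤*⇒1≤ˡ : ∀ x y → 1 ≤ x * y → 1 ≤ x
1≤*⇒1≤ˡ (suc x) y _ = s≤s z≤n

1≤*⇒1≤ʳ : ∀ x y → 1 ≤ x * y → 1 ≤ y
1≤*⇒1≤ʳ x y le = 1≤*⇒1≤ˡ y x (≤-trans le (≤-reflexive (*-comm x y)))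

-- Indicators

𝟙 : {P : Set} → Dec P → ℕ
𝟙 (yes _) = 1
𝟙 (no _)  = 0

module _ {P : Set} where

  𝟙-yes : (d : Dec P) → P → 𝟙 d ≡ 1
  𝟙-yes (yes _) p = refl
  𝟙-yes (no ¬p) p = ⊥-elim (¬p p)

  𝟙-no : (d : Dec P) → ¬ P → 𝟙 d ≡ 0
  𝟙-no (yes p) ¬p = ⊥-elim (¬p p)
  𝟙-no (no _)  ¬p = refl

  𝟙≤1 : (d : Dec P) → 𝟙 d ≤ 1
  𝟙≤1 (yes _) = ≤-refl
  𝟙≤1 (no _)  = z≤n

  𝟙-pos : (d : Dec P) → 1 ≤ 𝟙 d → P
  𝟙-pos (yes p) _ = p

  𝟙-*-≤ : (d : Dec P) {x y : ℕ} → (P → x ≤ y) → 𝟙 d * x ≤ 𝟙 d * y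
  𝟙-*-≤ (yes p) h = *-monoʳ-≤ 1 (h p)
  𝟙-*-≤ (no _)  h = z≤n

  𝟙-*-≡ : (d : Dec P) {x y : ℕ} → (P → x ≡ y) → 𝟙 d * x ≡ 𝟙 d * y
  𝟙-*-≡ (yes p) h = cong (1 *_) (h p)
  𝟙-*-≡ (no _)  h = refl

  𝟙-*≤ : (d : Dec P) (x : ℕ) → 𝟙 d * x ≤ x
  𝟙-*≤ (yes _) x = ≤-reflexive (*-identityˡ x)
  𝟙-*≤ (no _)  x = z≤n

𝟙-⇔ : ∀ {P Q : Set} (d : Dec P) (e : Dec Q) → (P → Q) → (Q → P) → 𝟙 d ≡ 𝟙 e
𝟙-⇔ (yes p) e f g = sym (𝟙-yes e (f p))
𝟙-⇔ (no ¬p) e f g = sym (𝟙-no e (¬p ∘ g))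

𝟙-mono : ∀ {P Q : Set} (d : Dec P) (e : Dec Q) → (P → Q) → 𝟙 d ≤ 𝟙 e
𝟙-mono (yes p) e f = ≤-reflexive (sym (𝟙-yes e (f p)))
𝟙-mono (no _)  e f = z≤n

𝟙-× : ∀ {P Q R : Set} (d : Dec P) (e : Dec Q) (c : Dec R) → (P → Q → R) → (R → P) → (R → Q) →
      𝟙 c ≡ 𝟙 d * 𝟙 e
𝟙-× (yes p) (yes q) c f g h = 𝟙-yes c (f p q)
𝟙-× (yes p) (no ¬q) c f g h = 𝟙-no c (¬q ∘ h)
𝟙-× (no ¬p) e       c f g h = 𝟙-no c (¬p ∘ g)

-- Conditional expectations

record Partition (Z : Set) : Set₁ where
  field
    {Colour} : Set
    _≟ᶜ_     : DecidableEquality Colour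
    colour   : Z → Colour

  _~_ : Z → Z → Set
  z ~ z′ = colour z ≡ colour z′

  _~?_ : ∀ z z′ → Dec (z ~ z′)
  z ~? z′ = colour z ≟ᶜ colour z′

  same : Z → Z → ℕ
  same z z′ = 𝟙 (z ~? z′)

  Measurable : (Z → ℕ) → Set
  Measurable g = ∀ {z z′} → z ~ z′ → g z ≡ g z′

  same-sym : ∀ z z′ → same z z′ ≡ same z′ z
  same-sym z z′ = 𝟙-⇔ (z ~? z′) (z′ ~? z) sym sym

open Partition

infixr 7 _⊠_

_⊠_ : ∀ {X Y} → Partition X → Partition Y → Partition (X × Y)
P ⊠ Q = record
  { _≟ᶜ_   = ≡-dec (_≟ᶜ_ P) (_≟ᶜ_ Q)
  ; colour = λ z → colour P (proj₁ z) , colour Q (proj₂ z)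
  }

same-⊠ : ∀ {X Y} (P : Partition X) (Q : Partition Y) x y x′ y′ →
         same (P ⊠ Q) (x , y) (x′ , y′) ≡ same P x x′ * same Q y y′
same-⊠ P Q x y x′ y′ = 𝟙-× (_~?_ P x x′) (_~?_ Q y y′) (_~?_ (P ⊠ Q) (x , y) (x′ , y′))
  (cong₂ _,_) (cong proj₁) (cong proj₂)

_Refines_ : ∀ {Z} → Partition Z → Partition Z → Set
P Refines Q = ∀ {z z′} → _~_ P z z′ → _~_ Q z z′

-- L is a common multiple of all possible cell sizes, so that L times a conditional
-- expectation is a natural number.
module Averaging {Z : Set} (zs : List Z) (complete : ∀ z → z ∈ zs)
                 (L : ℕ) (multiple : ∀ c → 1 ≤ c → c ≤ length zs → c ∣ L) where

  size : Partition Z → Z → ℕ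
  size P z = ∑ zs (same P z)

  size-pos : ∀ P z → 1 ≤ size P z
  size-pos P z = ≤-trans (≤-reflexive (sym (𝟙-yes (_~?_ P z z) refl))) (∑-∈ (same P z) (complete z))

  size≤ : ∀ P z → size P z ≤ length zs
  size≤ P z = ≤-trans (∑-≤-const zs (λ z′ → 𝟙≤1 (_~?_ P z z′))) (≤-reflexive (*-identityʳ _))

  size-measurable : ∀ P → Measurable P (size P)
  size-measurable P {z} {z′} eq = ∑-cong zs λ w →
    𝟙-⇔ (_~?_ P z w) (_~?_ P z′ w) (trans (sym eq)) (trans eq)

  -- The quotient of `L` by the cell size, so that every cell has total weight `L`.
  weight : Partition Z → Z → ℕ
  weight P z = _∣_.quotient (multiple (size P z) (size-pos P z) (size≤ P z))

  weight*size : ∀ P z → weight P z * size P z ≡ L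
  weight*size P z = sym (_∣_.equality (multiple (size P z) (size-pos P z) (size≤ P z)))

  weight-unique : ∀ P z w → w * size P z ≡ L → weight P z ≡ w
  weight-unique P z w eq = *-cancelʳ-≡ _ _ (size P z) {{>-nonZero (size-pos P z)}}
    (trans (weight*size P z) (sym eq))

  weight-measurable : ∀ P → Measurable P (weight P)
  weight-measurable P {z} {z′} eq = weight-unique P z _
    (trans (cong (weight P z′ *_) (size-measurable P eq)) (weight*size P z′))

  cellSum : Partition Z → (Z → ℕ) → Z → ℕ
  cellSum P f z = ∑ zs (λ z′ → same P z z′ * f z′)

  avg : Partition Z → (Z → ℕ) → Z → ℕ
  avg P f z = weight P z * cellSum P f z

  cellSum-measurable : ∀ P f → Measurable P (cellSum P f)
  cellSum-measurable P f {z} {z′} eq = ∑-cong zs λ w →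
    cong (_* f w) (𝟙-⇔ (_~?_ P z w) (_~?_ P z′ w) (trans (sym eq)) (trans eq))

  avg-measurable : ∀ P f → Measurable P (avg P f)
  avg-measurable P f eq = cong₂ _*_ (weight-measurable P eq) (cellSum-measurable P f eq)

  -- Averaging is self-adjoint and fixes measurable functions up to the factor `L`: once the sums
  -- are exchanged, `weight` and `g` may be evaluated at z′ instead of z, and the inner sum becomes
  -- the cell size.
  ∑-avg : ∀ P f {g} → Measurable P g → ∑ zs (λ z → avg P f z * g z) ≡ L * ∑ zs (λ z → f z * g z)
  ∑-avg P f {g} meas = begin
    ∑ zs (λ z → weight P z * cellSum P f z * g z)
      ≡⟨ ∑-cong zs (λ z → trans (eq₁ (weight P z) (cellSum P f z) (g z)) (sym (∑-*ʳ zs _ _))) ⟩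
    ∑ zs (λ z → ∑ zs (λ z′ → same P z z′ * f z′ * (weight P z * g z)))
      ≡⟨ ∑-swap zs zs _ ⟩
    ∑ zs (λ z′ → ∑ zs (λ z → same P z z′ * f z′ * (weight P z * g z)))
      ≡⟨ ∑-cong zs (λ z′ → trans (∑-cong zs (λ z → pt z z′)) (∑-*ˡ zs (weight P z′ * (f z′ * g z′)) _)) ⟩
    ∑ zs (λ z′ → weight P z′ * (f z′ * g z′) * size P z′)
      ≡⟨ ∑-cong zs (λ z′ → trans (eq₂ (weight P z′) (f z′ * g z′) (size P z′))
                                 (cong (_* (f z′ * g z′)) (weight*size P z′))) ⟩
    ∑ zs (λ z′ → L * (f z′ * g z′))
      ≡⟨ ∑-*ˡ zs L _ ⟩
    L * ∑ zs (λ z′ → f z′ * g z′) ∎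
    where
    open ≡-Reasoning
    eq₁ : ∀ w c g → w * c * g ≡ c * (w * g)
    eq₁ = solve-∀
    eq₂ : ∀ w c g → w * c * g ≡ (w * g) * c
    eq₂ = solve-∀
    eq₃ : ∀ s f w g → s * f * (w * g) ≡ s * (w * (f * g))
    eq₃ = solve-∀
    eq₄ : ∀ s w x → s * (w * x) ≡ w * x * s
    eq₄ = solve-∀
    pt : ∀ z z′ → same P z z′ * f z′ * (weight P z * g z) ≡ weight P z′ * (f z′ * g z′) * same P z′ z
    pt z z′ = begin
      same P z z′ * f z′ * (weight P z * g z)
        ≡⟨ eq₃ (same P z z′) (f z′) (weight P z) (g z) ⟩
      same P z z′ * (weight P z * (f z′ * g z))
        ≡⟨ 𝟙-*-≡ (_~?_ P z z′) (λ e → cong₂ (λ w h → w * (f z′ * h)) (weight-measurable P e) (meas e)) ⟩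
      same P z z′ * (weight P z′ * (f z′ * g z′))
        ≡⟨ eq₄ (same P z z′) (weight P z′) (f z′ * g z′) ⟩
      weight P z′ * (f z′ * g z′) * same P z z′
        ≡⟨ cong (weight P z′ * (f z′ * g z′) *_) (same-sym P z z′) ⟩
      weight P z′ * (f z′ * g z′) * same P z′ z ∎

  ∑-avg-total : ∀ P f → ∑ zs (avg P f) ≡ L * ∑ zs f
  ∑-avg-total P f = trans (∑-cong zs (λ z → sym (*-identityʳ _)))
    (trans (∑-avg P f {λ _ → 1} (λ _ → refl)) (cong (L *_) (∑-cong zs (λ z → *-identityʳ _))))

  energy : Partition Z → (Z → ℕ) → ℕ
  energy P f = ∑ zs (λ z → avg P f z * avg P f z)

  energy-alt : ∀ P f → energy P f ≡ L * ∑ zs (λ z → f z * avg P f z)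
  energy-alt P f = ∑-avg P f (avg-measurable P f)

  deviation : Partition Z → Partition Z → (Z → ℕ) → Z → ℕ
  deviation P Q f z = ∣ avg P f z - avg Q f z ∣

  -- The coarse average is measurable for the finer partition, so `∑-avg` turns the cross term into
  -- the coarse energy.
  energy-pythagoras : ∀ P Q f → P Refines Q →
    energy P f ≡ energy Q f + ∑ zs (λ z → deviation P Q f z * deviation P Q f z)
  energy-pythagoras P Q f ref = +-cancelʳ-≡ (energy Q f) _ _ (begin
    energy P f + energy Q f
      ≡⟨ sym (∑-+ zs _ _) ⟩
    ∑ zs (λ z → avg P f z * avg P f z + avg Q f z * avg Q f z)
      ≡⟨ ∑-cong zs (λ z → square-split (avg P f z) (avg Q f z)) ⟩
    ∑ zs (λ z → 2 * (avg P f z * avg Q f z) + deviation P Q f z * deviation P Q f z)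
      ≡⟨ ∑-+ zs _ _ ⟩
    ∑ zs (λ z → 2 * (avg P f z * avg Q f z)) + V
      ≡⟨ cong (_+ V) (∑-*ˡ zs 2 _) ⟩
    2 * ∑ zs (λ z → avg P f z * avg Q f z) + V
      ≡⟨ cong (λ e → 2 * e + V) (trans (∑-avg P f (avg-measurable Q f ∘ ref)) (sym (energy-alt Q f))) ⟩
    2 * energy Q f + V
      ≡⟨ eq (energy Q f) V ⟩
    energy Q f + V + energy Q f ∎)
    where
    open ≡-Reasoning
    V = ∑ zs (λ z → deviation P Q f z * deviation P Q f z)
    eq : ∀ e v → 2 * e + v ≡ e + v + e
    eq = solve-∀

  energy-mono : ∀ P Q f → P Refines Q → energy Q f ≤ energy P f
  energy-mono P Q f ref = ≤-trans (m≤m+n _ _) (≤-reflexive (sym (energy-pythagoras P Q f ref)))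

  -- The indicator g witnesses that avg Q f is not yet a good model of f; making g measurable
  -- is paid for by energy.
  energy-increment : ∀ P Q f {g} → P Refines Q → Measurable P g → (∀ z → g z ≤ 1) → ∀ κ →
    L * ∑ zs (λ z → f z * g z) + κ ≤ ∑ zs (λ z → avg Q f z * g z) →
    length zs * energy Q f + κ * κ ≤ length zs * energy P f
  energy-increment P Q f {g} ref meas g≤1 κ gap = begin
    n * energy Q f + κ * κ
      ≤⟨ +-monoʳ-≤ (n * energy Q f) (*-mono-≤ κ≤ κ≤) ⟩
    n * energy Q f + ∑ zs (λ z → dev z * g z) * ∑ zs (λ z → dev z * g z)
      ≤⟨ +-monoʳ-≤ (n * energy Q f) (cauchy-schwarz zs dev g) ⟩
    n * energy Q f + V * ∑ zs (λ z → g z * g z)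
      ≤⟨ +-monoʳ-≤ (n * energy Q f) (*-monoʳ-≤ V (≤-trans (∑-≤-const zs (λ z → *-mono-≤ (g≤1 z) (g≤1 z)))
          (≤-reflexive (*-identityʳ n)))) ⟩
    n * energy Q f + V * n
      ≡⟨ eq n (energy Q f) V ⟩
    n * (energy Q f + V)
      ≡⟨ cong (n *_) (sym (energy-pythagoras P Q f ref)) ⟩
    n * energy P f ∎
    where
    open ≤-Reasoning
    n = length zs
    dev = deviation P Q f
    V = ∑ zs (λ z → dev z * dev z)
    eq : ∀ n e v → n * e + v * n ≡ n * (e + v)
    eq = solve-∀
    pt : ∀ z → avg Q f z * g z ≤ avg P f z * g z + dev z * g z
    pt z = ≤-trans (*-monoˡ-≤ (g z) (m≤n+∣n-m∣ (avg Q f z) (avg P f z)))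
                   (≤-reflexive (*-distribʳ-+ (g z) (avg P f z) (dev z)))
    κ≤ : κ ≤ ∑ zs (λ z → dev z * g z)
    κ≤ = +-cancelˡ-≤ (L * ∑ zs (λ z → f z * g z)) _ _ (begin
      L * ∑ zs (λ z → f z * g z) + κ
        ≤⟨ gap ⟩
      ∑ zs (λ z → avg Q f z * g z)
        ≤⟨ ∑-mono zs pt ⟩
      ∑ zs (λ z → avg P f z * g z + dev z * g z)
        ≡⟨ ∑-+ zs _ _ ⟩
      ∑ zs (λ z → avg P f z * g z) + ∑ zs (λ z → dev z * g z)
        ≡⟨ cong (_+ ∑ zs (λ z → dev z * g z)) (∑-avg P f meas) ⟩
      L * ∑ zs (λ z → f z * g z) + ∑ zs (λ z → dev z * g z) ∎)

-- Partitions of the vertex set and regularity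

double-injective : ∀ p p′ {s s′} → s ≤ 1 → s′ ≤ 1 → 2 * p + s ≡ 2 * p′ + s′ → p ≡ p′ × s ≡ s′
double-injective zero zero s≤1 s′≤1 eq = refl , eq
double-injective zero (suc p′) {s} {s′} s≤1 s′≤1 eq = ⊥-elim (<⇒≱ (s≤s s≤1) (≤-trans
  (≤-trans (m≤m+n 2 _) (≤-reflexive (eq₁ p′ s′))) (≤-reflexive (sym eq))))
  where
  eq₁ : ∀ p s → 2 + (2 * p + s) ≡ 2 * suc p + s
  eq₁ = solve-∀
double-injective (suc p) zero s≤1 s′≤1 eq with double-injective zero (suc p) s′≤1 s≤1 (sym eq)
... | () , _
double-injective (suc p) (suc p′) {s} {s′} s≤1 s′≤1 eq
  with double-injective p p′ s≤1 s′≤1 (+-cancelˡ-≡ 2 _ _ (trans (eq₁ p s) (trans eq (sym (eq₁ p′ s′)))))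
  where
  eq₁ : ∀ p s → 2 + (2 * p + s) ≡ 2 * suc p + s
  eq₁ = solve-∀
... | eq₁ , eq₂ = cong suc eq₁ , eq₂

-- Number of colours used by the iterated regularisation: every violation of the cut condition
-- splits the cells by two vertex sets, hence the factor 4.
module Growth (B : ℕ) (q need : ℕ → ℕ) where

  -- A violation at precision q raises q² times the energy by one unit, and the energy never exceeds
  -- `B` units; q² B + 1 violations are therefore impossible.
  steps : ℕ → ℕ
  steps M = q M * q M * B + 1

  nextSize : ℕ → ℕ
  nextSize M = M * 4 ^ steps M

  -- How large `a` must be for r rounds. All demands are added up, so each of them, and the bound on
  -- the number of cells in every round, follows from a single inequality.
  required : ℕ → ℕ → ℕ
  required zero    M = M
  required (suc r) M = need M + nextSize M + required r (nextSize M)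

-- Level sets and the arithmetic of the counting argument

layer-cake : ∀ U u → ∑ (downFrom U) (λ t → 𝟙 (t <? u)) ≡ U ⊓ u
layer-cake zero    u = refl
layer-cake (suc U) u with U <? u | layer-cake U u
... | yes U<u | ih = trans (cong suc (trans ih (m≤n⇒m⊓n≡m (<⇒≤ U<u)))) (sym (m≤n⇒m⊓n≡m U<u))
... | no  U≮u | ih = trans ih (trans (m≥n⇒m⊓n≡n (≮⇒≥ U≮u)) (sym (m≥n⇒m⊓n≡n (m≤n⇒m≤1+n (≮⇒≥ U≮u)))))

-- Composes edge replacements: T₀ counts walks in the graph, T those with some edges taken from the
-- model, T′ those with one more. Each replacement costs a factor s / a, and earlier errors are
-- scaled along.
chain-step : ∀ a A q s S Err {T₀ T T′ E} → A * (q * T) ≤ S * (q * T₀) + Err → a * q * T′ ≤ s * (q * T + E) →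
             (a * A) * (q * T′) ≤ (s * S) * (q * T₀) + (s * Err + s * A * E)
chain-step a A q s S Err {T₀} {T} {T′} {E} h₁ h₂ = begin
  (a * A) * (q * T′)                              ≡⟨ eq₁ a A q T′ ⟩
  A * (a * q * T′)                                ≤⟨ *-monoʳ-≤ A h₂ ⟩
  A * (s * (q * T + E))                           ≡⟨ eq₂ A s (q * T) E ⟩
  s * (A * (q * T)) + s * A * E                   ≤⟨ +-monoˡ-≤ (s * A * E) (*-monoʳ-≤ s h₁) ⟩
  s * (S * (q * T₀) + Err) + s * A * E            ≡⟨ eq₃ s S (q * T₀) Err (s * A * E) ⟩
  (s * S) * (q * T₀) + (s * Err + s * A * E)      ∎
  where
  open ≤-Reasoning
  eq₁ : ∀ a A q t → (a * A) * (q * t) ≡ A * (a * q * t)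
  eq₁ = solve-∀
  eq₂ : ∀ A s x e → A * (s * (x + e)) ≡ s * (A * x) + s * A * e
  eq₂ = solve-∀
  eq₃ : ∀ s S x e y → s * (S * x + e) + y ≡ (s * S) * x + (s * e + y)
  eq₃ = solve-∀

-- The left side is what five uses of `chain-step` accumulate, one summand per replaced edge. After
-- `N ≤ C * (a * a)` the summands have the same order, and 9 = 4 + 2 + 1 + 1 + 1: the 4 and the 2
-- come from the bound 2 on two-step walks.
chain-error : ∀ a N c C → 1 ≤ c → 1 ≤ C → N ≤ C * (a * a) → let s = c * N in
  s * (s * (s * (s * (s * 0
    + s * 1 * (N * (2 * 2 * (a * N))))
    + s * (a ^ 1) * (N * (1 * (a * 2) * (a * N))))
    + s * (a ^ 2) * (N * (1 * (a * (a * 1)) * (a * N))))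
    + s * (a ^ 3) * (N * (N * 1 * 1 * (a * 1) * (a * N))))
    + s * (a ^ 4) * (N * (N * 1 * (N * 1 * 1) * 1 * (a * N)))
  ≤ 9 * (c ^ 5 * (C * C) * (a ^ 5 * N ^ 5))
chain-error a N c C 1≤c 1≤C N≤ = begin
  _
    ≡⟨ eq₁ a N c ⟩
  a * (N * N * N * N * N) * (4 * (c⁵ * (N * N)) + (2 * (c⁴ * (a * a * N)) + (c * c * c + c * c + c) * (a * a * (a * a))))
    ≤⟨ *-monoʳ-≤ (a * (N * N * N * N * N)) (+-mono-≤ t₁ (+-mono-≤ t₂ t₃)) ⟩
  a * (N * N * N * N * N) * (4 * X + (2 * X + 3 * X))
    ≡⟨ eq₂ a N c C ⟩
  9 * (c ^ 5 * (C * C) * (a ^ 5 * N ^ 5)) ∎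
  where
  open ≤-Reasoning
  c⁵ = c * c * c * c * c
  c⁴ = c * c * c * c
  X = c⁵ * (C * C) * (a * a * (a * a))
  eq₁ : ∀ a N c → let s = c * N in
    s * (s * (s * (s * (s * 0
    + s * 1 * (N * (2 * 2 * (a * N))))
    + s * (a * 1) * (N * (1 * (a * 2) * (a * N))))
    + s * (a * (a * 1)) * (N * (1 * (a * (a * 1)) * (a * N))))
    + s * (a * (a * (a * 1))) * (N * (N * 1 * 1 * (a * 1) * (a * N))))
    + s * (a * (a * (a * (a * 1)))) * (N * (N * 1 * (N * 1 * 1) * 1 * (a * N)))
    ≡ a * (N * N * N * N * N) * (4 * (c * c * c * c * c * (N * N)) + (2 * (c * c * c * c * (a * a * N)) + (c * c * c + c * c + c) * (a * a * (a * a))))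
  eq₁ = solve-∀
  eq₂ : ∀ a N c C → a * (N * N * N * N * N) * (4 * (c * c * c * c * c * (C * C) * (a * a * (a * a)))
     + (2 * (c * c * c * c * c * (C * C) * (a * a * (a * a))) + 3 * (c * c * c * c * c * (C * C) * (a * a * (a * a)))))
     ≡ 9 * ((c * (c * (c * (c * (c * 1))))) * (C * C) * ((a * (a * (a * (a * (a * 1))))) * (N * (N * (N * (N * (N * 1)))))))
  eq₂ = solve-∀
  eq₃ : ∀ c C b → c * ((C * b) * (C * b)) ≡ c * (C * C) * (b * b)
  eq₃ = solve-∀
  eq₄ : ∀ c C b → c * (b * (C * b)) ≡ c * C * (b * b)
  eq₄ = solve-∀
  grow : ∀ x → x ≤ x * c
  grow x = m≤m*n x c {{>-nonZero 1≤c}}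
  C≤CC : C ≤ C * C
  C≤CC = m≤m*n C C {{>-nonZero 1≤C}}
  c≤c² : c ≤ c * c
  c≤c² = grow c
  c²≤c³ : c * c ≤ c * c * c
  c²≤c³ = grow (c * c)
  c³≤c⁵ : c * c * c ≤ c⁵
  c³≤c⁵ = ≤-trans (grow (c * c * c)) (grow c⁴)
  t₁ : 4 * (c⁵ * (N * N)) ≤ 4 * X
  t₁ = *-monoʳ-≤ 4 (≤-trans (*-monoʳ-≤ c⁵ (*-mono-≤ N≤ N≤)) (≤-reflexive (eq₃ c⁵ C (a * a))))
  t₂ : 2 * (c⁴ * (a * a * N)) ≤ 2 * X
  t₂ = *-monoʳ-≤ 2 (≤-trans (*-mono-≤ (grow c⁴) (*-monoʳ-≤ (a * a) N≤))
    (≤-trans (≤-reflexive (eq₄ c⁵ C (a * a))) (*-monoˡ-≤ (a * a * (a * a)) (*-monoʳ-≤ c⁵ C≤CC))))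
  t₃ : (c * c * c + c * c + c) * (a * a * (a * a)) ≤ 3 * X
  t₃ = ≤-trans (*-monoˡ-≤ (a * a * (a * a)) (≤-trans
      (+-mono-≤ (+-mono-≤ c³≤c⁵ (≤-trans c²≤c³ c³≤c⁵)) (≤-trans c≤c² (≤-trans c²≤c³ c³≤c⁵)))
      (≤-trans (≤-reflexive (eq₅ c⁵)) (*-monoʳ-≤ 3 (m≤m*n c⁵ (C * C) {{>-nonZero (≤-trans 1≤C C≤CC)}})))))
    (≤-reflexive (*-assoc 3 (c⁵ * (C * C)) (a * a * (a * a))))
    where
    eq₅ : ∀ x → x + x + x ≡ 3 * x
    eq₅ = solve-∀

-- With q = 2 Q the error, multiplied by `2 * M⁵`, is exactly `Q * n⁵ * A`, half of the main term;
-- the other half survives.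
count-from-model : ∀ A n⁵ M⁵ c⁵ D T₀ T₅ → 1 ≤ n⁵ → 1 ≤ M⁵ → 1 ≤ c⁵ → 1 ≤ D →
  let q = 2 * (18 * (M⁵ * (c⁵ * D))) in
  A * (q * T₅) ≤ c⁵ * n⁵ * (q * T₀) + 9 * (c⁵ * D * (A * n⁵)) → n⁵ ≤ 2 * (M⁵ * T₅) → A ≤ 4 * (M⁵ * (c⁵ * T₀))
count-from-model A n⁵ M⁵ c⁵ D T₀ T₅ 1≤n 1≤M 1≤c 1≤D h₁ h₂ =
  *-cancelˡ-≤ (Q * n⁵) {{m*n≢0 Q n⁵ {{>-nonZero 1≤Q}} {{>-nonZero 1≤n}}}} (+-cancelʳ-≤ (Q * n⁵ * A) _ _ (begin
    Q * n⁵ * A + Q * n⁵ * A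
      ≡⟨ eq₁ Q n⁵ A ⟩
    A * (2 * Q) * n⁵
      ≤⟨ *-monoʳ-≤ (A * (2 * Q)) h₂ ⟩
    A * (2 * Q) * (2 * (M⁵ * T₅))
      ≡⟨ eq₂ A (2 * Q) M⁵ T₅ ⟩
    2 * M⁵ * (A * (2 * Q * T₅))
      ≤⟨ *-monoʳ-≤ (2 * M⁵) h₁ ⟩
    2 * M⁵ * (c⁵ * n⁵ * (2 * Q * T₀) + 9 * (c⁵ * D * (A * n⁵)))
      ≡⟨ eq₃ Q M⁵ c⁵ n⁵ T₀ D A ⟩
    Q * n⁵ * (4 * (M⁵ * (c⁵ * T₀))) + Q * n⁵ * A ∎))
  where
  open ≤-Reasoning
  Q = 18 * (M⁵ * (c⁵ * D))
  1≤Q : 1 ≤ Q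
  1≤Q = *-mono-≤ {1} {18} (s≤s z≤n) (*-mono-≤ 1≤M (*-mono-≤ 1≤c 1≤D))
  eq₁ : ∀ Q n A → Q * n * A + Q * n * A ≡ A * (2 * Q) * n
  eq₁ = solve-∀
  eq₂ : ∀ A Q M T → A * Q * (2 * (M * T)) ≡ 2 * M * (A * (Q * T))
  eq₂ = solve-∀
  eq₃ : ∀ Q M c n T D A → 2 * M * (c * n * (2 * Q * T) + 9 * (c * D * (A * n)))
        ≡ Q * n * (4 * (M * (c * T))) + 18 * (M * (c * D)) * n * A
  eq₃ = solve-∀

-- Sums with at most one nonzero term

∑-all-zero : ∀ {A : Set} {xs : List A} {f : A → ℕ} → All (λ x → f x ≡ 0) xs → ∑ xs f ≡ 0
∑-all-zero []         = refl
∑-all-zero (eq ∷ eqs) = cong₂ _+_ eq (∑-all-zero eqs)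

∑-at-most-one : ∀ {A : Set} {xs : List A} (f : A → ℕ) → Unique xs → (∀ x → f x ≤ 1) →
                (∀ x y → 1 ≤ f x → 1 ≤ f y → x ≡ y) → ∑ xs f ≤ 1
∑-at-most-one f []              f≤1 inj = z≤n
∑-at-most-one {xs = x ∷ xs} f (x∉ ∷ unique) f≤1 inj with f x in eq
... | zero  = ∑-at-most-one f unique f≤1 inj
... | suc m = ≤-trans (≤-reflexive (cong (suc m +_) (∑-all-zero (vanish x∉))))
                      (≤-trans (≤-reflexive (trans (+-identityʳ (suc m)) (sym eq))) (f≤1 x))
  where
  vanish : ∀ {ys} → All (λ y → ¬ x ≡ y) ys → All (λ y → f y ≡ 0) ys
  vanish []            = []
  vanish (_∷_ {y} x≢y x∉) with f y in eqy
  ... | zero  = eqy ∷ vanish x∉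
  ... | suc _ = ⊥-elim (x≢y (inj x y (subst (1 ≤_) (sym eq) (s≤s z≤n)) (subst (1 ≤_) (sym eqy) (s≤s z≤n))))

∑-𝟙≤1 : ∀ {A : Set} (_≟ᴬ_ : DecidableEquality A) {xs : List A} → Unique xs → ∀ x → ∑ xs (λ y → 𝟙 (x ≟ᴬ y)) ≤ 1
∑-𝟙≤1 _≟ᴬ_ unique x = ∑-at-most-one _ unique (λ y → 𝟙≤1 (x ≟ᴬ y))
  (λ y z p q → trans (sym (𝟙-pos (x ≟ᴬ y) p)) (𝟙-pos (x ≟ᴬ z) q))

∑-δ : ∀ {A : Set} (_≟ᴬ_ : DecidableEquality A) {xs : List A} {x} → Unique xs → x ∈ xs → ∀ (k : A → ℕ) →
      ∑ xs (λ y → 𝟙 (x ≟ᴬ y) * k y) ≡ k x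
∑-δ _≟ᴬ_ {xs} {x} unique x∈ k = begin
  ∑ xs (λ y → 𝟙 (x ≟ᴬ y) * k y)   ≡⟨ ∑-cong xs (λ y → 𝟙-*-≡ (x ≟ᴬ y) (λ e → cong k (sym e))) ⟩
  ∑ xs (λ y → 𝟙 (x ≟ᴬ y) * k x)   ≡⟨ ∑-*ʳ xs _ (k x) ⟩
  ∑ xs (λ y → 𝟙 (x ≟ᴬ y)) * k x   ≡⟨ cong (_* k x) (≤-antisym (∑-𝟙≤1 _≟ᴬ_ unique x)
                                       (≤-trans (≤-reflexive (sym (𝟙-yes (x ≟ᴬ x) refl))) (∑-∈ (λ y → 𝟙 (x ≟ᴬ y)) x∈))) ⟩
  1 * k x                         ≡⟨ *-identityˡ (k x) ⟩
  k x                             ∎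
  where open ≡-Reasoning

0/1-idempotent : ∀ {x} → x ≤ 1 → x * x ≡ x
0/1-idempotent {zero}     _       = refl
0/1-idempotent {suc zero} _       = refl
0/1-idempotent {suc (suc _)} (s≤s ())

𝟙-≤-+-< : ∀ m n → 𝟙 (m ≤? n) + 𝟙 (n <? m) ≡ 1
𝟙-≤-+-< m n with m ≤? n
... | yes m≤n = cong suc (𝟙-no (n <? m) (≤⇒≯ m≤n))
... | no m≰n  = 𝟙-yes (n <? m) (≰⇒> m≰n)

𝟙≡0⇒¬ : ∀ {P : Set} (d : Dec P) → 𝟙 d ≡ 0 → ¬ P
𝟙≡0⇒¬ (no ¬p) _ = ¬p

∑-has-zero : ∀ {A : Set} (xs : List A) (b : A → ℕ) → ∑ xs b < length xs → ∃ λ x → b x ≡ 0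
∑-has-zero (x ∷ xs) b lt with b x in eq
... | zero  = x , eq
... | suc m = ∑-has-zero xs b (≤-trans (s≤s (m≤n+m (∑ xs b) m)) (s≤s⁻¹ lt))

-- Each of the three kinds of cleaning may delete a fraction 1/K of the edges.
module Constants (C K : ℕ) where

  energyConstant : ℕ
  energyConstant = 2 * (C + 1)

  -- `lowness` and `tail` make `low-mass` and `irregular-mass` yield a loss of at most a N / K each;
  -- `stability` is the factor in the hypothesis of `irregular-count` for these values.
  lowness tail stability : ℕ
  lowness = 2 * K
  tail = K * (1 + energyConstant)
  stability = 10 * (tail * tail) * (lowness * lowness)

  -- The q of `count-from-model`, for cells of at least N / (M K) vertices and density threshold 1 /
  -- `lowness` of a / N.
  precision : ℕ → ℕ
  precision M = 2 * (18 * ((M * K) ^ 5 * (lowness ^ 5 * (C * C))))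

  -- One more than the bound on `a` that follows from having few closed walks; see
  -- `few-cycles-absurd`.
  need : ℕ → ℕ
  need M = 1 + 80 * ((M * K) ^ 5 * (lowness ^ 5 * C))

  open Growth energyConstant precision need

  -- A round that yields no stable pair raises `stability` times the energy by a unit, hence this
  -- number of rounds, starting from a single cell.
  threshold : ℕ
  threshold = required (stability * energyConstant + 1) 1

module Vertices (N : ℕ) where

  V : Set
  V = Fin N

  vs : List V
  vs = allFin N

  vs-length : length vs ≡ N
  vs-length = length-tabulate {n = N} id

  pairs : List (V × V)
  pairs = cartesianProduct vs vs

  pairs-complete : ∀ z → z ∈ pairs
  pairs-complete (x , y) = ∈-cartesianProduct⁺ (∈-allFin x) (∈-allFin y)

  pairs-length : length pairs ≡ N * N
  pairs-length = trans (length-cartesianProduct vs vs) (cong₂ _*_ vs-length vs-length)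

  -- A multiple of all cell sizes for vertices as well as for pairs. Having one factor for both
  -- makes weights on V and on V × V comparable.
  L : ℕ
  L = (N * N) !

  L-pos : 1 ≤ L
  L-pos = n≢0⇒n>0 (≢-nonZero⁻¹ L {{(N * N) !≢0}})

  ≤⇒∣L : ∀ c → 1 ≤ c → c ≤ N * N → c ∣ L
  ≤⇒∣L (suc c) _ c≤ = ∣-trans (m∣m*n (c !)) (m≤n⇒m!∣n! c≤)

  vs-multiple : ∀ c → 1 ≤ c → c ≤ length vs → c ∣ L
  vs-multiple c 1≤c c≤ = ≤⇒∣L c 1≤c (≤-trans c≤N (m≤m*n N N {{>-nonZero (≤-trans 1≤c c≤N)}}))
    where
    c≤N : c ≤ N
    c≤N = ≤-trans c≤ (≤-reflexive vs-length)

  pairs-multiple : ∀ c → 1 ≤ c → c ≤ length pairs → c ∣ L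
  pairs-multiple c 1≤c c≤ = ≤⇒∣L c 1≤c (≤-trans c≤ (≤-reflexive pairs-length))

  module Avg₁ = Averaging vs ∈-allFin L vs-multiple
  module Avg₂ = Averaging pairs pairs-complete L pairs-multiple

  Kernel : Set
  Kernel = V → V → ℕ

  Colouring : Set
  Colouring = V → ℕ

  cells : Colouring → Partition V
  cells π = record { _≟ᶜ_ = _≟_ ; colour = π }

  grid : Colouring → Partition (V × V)
  grid π = cells π ⊠ cells π

  density : Colouring → Kernel → V × V → ℕ
  density π f = Avg₂.avg (grid π) (uncurry f)

  energy : Colouring → Kernel → ℕ
  energy π f = Avg₂.energy (grid π) (uncurry f)

  _≼_ : Colouring → Colouring → Set
  π′ ≼ π = ∀ x y → π′ x ≡ π′ y → π x ≡ π y

  grid-refines : ∀ {π′ π} → π′ ≼ π → grid π′ Refines grid π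
  grid-refines ref eq = cong₂ _,_ (ref _ _ (cong proj₁ eq)) (ref _ _ (cong proj₂ eq))

  rectangle : (V → ℕ) → (V → ℕ) → V × V → ℕ
  rectangle S T (x , y) = S x * T y

  split : Colouring → (V → ℕ) → Colouring
  split π S x = 2 * π x + S x

  split-bounded : ∀ {M} π {S} → (∀ x → π x < M) → (∀ x → S x ≤ 1) → ∀ x → split π S x < 2 * M
  split-bounded {M} π {S} π< S≤ x = begin-strict
    2 * π x + S x ≤⟨ +-monoʳ-≤ (2 * π x) (S≤ x) ⟩
    2 * π x + 1   <⟨ n<1+n _ ⟩
    suc (2 * π x + 1) ≡⟨ eq (π x) ⟩
    2 * suc (π x) ≤⟨ *-monoʳ-≤ 2 (π< x) ⟩
    2 * M         ∎
    where
    open ≤-Reasoning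
    eq : ∀ p → suc (2 * p + 1) ≡ 2 * suc p
    eq = solve-∀

  -- One-sided cut-norm closeness of f and its conditional expectation, at relative precision 1/q.
  Cut : ℕ → ℕ → Colouring → Kernel → Set
  Cut a q π f = ∀ S T → (∀ x → S x ≤ 1) → (∀ y → T y ≤ 1) →
    q * ∑ pairs (λ z → density π f z * rectangle S T z)
      ≤ L * (q * ∑ pairs (λ z → uncurry f z * rectangle S T z) + a * N)

  -- The energy increment for the excess `κ` on the rectangle of S and T, which becomes measurable
  -- after splitting by both sets. The violation gives `L * (a * N) ≤ q * κ`, and the number `N * N`
  -- of pairs cancels.
  refined-energy : ∀ a q π f S T → 1 ≤ N → (S≤ : ∀ x → S x ≤ 1) (T≤ : ∀ y → T y ≤ 1) →
    ¬ (q * ∑ pairs (λ z → density π f z * rectangle S T z)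
      ≤ L * (q * ∑ pairs (λ z → uncurry f z * rectangle S T z) + a * N)) →
    q * q * energy π f + L * L * (a * a) ≤ q * q * energy (split (split π S) T) f
  refined-energy a q π f S T 1≤N S≤ T≤ viol =
    *-cancelˡ-≤ (N * N) {{m*n≢0 N N {{>-nonZero 1≤N}} {{>-nonZero 1≤N}}}} (begin
    N * N * (q * q * energy π f + L * L * (a * a))
      ≡⟨ eq₁ N q (energy π f) L a ⟩
    q * q * (N * N * energy π f) + (L * (a * N)) * (L * (a * N))
      ≤⟨ +-monoʳ-≤ (q * q * (N * N * energy π f)) (*-mono-≤ qκ≥ qκ≥) ⟩
    q * q * (N * N * energy π f) + (q * κ) * (q * κ)
      ≡⟨ eq₂ q (N * N * energy π f) κ ⟩
    q * q * (N * N * energy π f + κ * κ)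
      ≤⟨ *-monoʳ-≤ (q * q) (subst (λ n → n * energy π f + κ * κ ≤ n * energy π′ f) pairs-length
           (Avg₂.energy-increment (grid π′) (grid π) (uncurry f) {rectangle S T} (grid-refines ref)
             (λ e → cong₂ _*_ (refS (cong proj₁ e)) (refT (cong proj₂ e)))
             (λ z → *-mono-≤ (S≤ (proj₁ z)) (T≤ (proj₂ z))) κ gap)) ⟩
    q * q * (N * N * energy π′ f)
      ≡⟨ eq₃ N q (energy π′ f) ⟩
    N * N * (q * q * energy π′ f) ∎)
    where
    open ≤-Reasoning
    π′ = split (split π S) T
    X = ∑ pairs (λ z → uncurry f z * rectangle S T z)
    Y = ∑ pairs (λ z → density π f z * rectangle S T z)
    κ = Y ∸ L * X
    eq₁ : ∀ N q e L a → N * N * (q * q * e + L * L * (a * a)) ≡ q * q * (N * N * e) + (L * (a * N)) * (L * (a * N))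
    eq₁ = solve-∀
    eq₂ : ∀ q e k → q * q * e + (q * k) * (q * k) ≡ q * q * (e + k * k)
    eq₂ = solve-∀
    eq₃ : ∀ N q e → q * q * (N * N * e) ≡ N * N * (q * q * e)
    eq₃ = solve-∀
    eq₄ : ∀ L q x b → L * (q * x + b) ≡ q * (L * x) + L * b
    eq₄ = solve-∀
    refT′ : ∀ {x y} → π′ x ≡ π′ y → split π S x ≡ split π S y × T x ≡ T y
    refT′ {x} {y} = double-injective (split π S x) (split π S y) (T≤ x) (T≤ y)
    refT : ∀ {x y} → π′ x ≡ π′ y → T x ≡ T y
    refT = proj₂ ∘ refT′
    refS : ∀ {x y} → π′ x ≡ π′ y → S x ≡ S y
    refS {x} {y} e = proj₂ (double-injective (π x) (π y) (S≤ x) (S≤ y) (proj₁ (refT′ e)))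
    ref : π′ ≼ π
    ref x y e = proj₁ (double-injective (π x) (π y) (S≤ x) (S≤ y) (proj₁ (refT′ e)))
    viol′ : q * (L * X) + L * (a * N) ≤ q * Y
    viol′ = ≤-trans (≤-reflexive (sym (eq₄ L q X (a * N)))) (<⇒≤ (≰⇒> viol))
    -- The truncated subtraction in `κ` is exact: if Y were smaller, the cut inequality would hold
    -- even without its error term.
    LX≤Y : L * X ≤ Y
    LX≤Y with L * X ≤? Y
    ... | yes le = le
    ... | no ¬le = ⊥-elim (viol (≤-trans (*-monoʳ-≤ q (<⇒≤ (≰⇒> ¬le)))
      (≤-trans (m≤m+n _ _) (≤-reflexive (sym (eq₄ L q X (a * N)))))))
    gap : L * X + κ ≤ Y
    gap = ≤-reflexive (m+[n∸m]≡n LX≤Y)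
    qκ≥ : L * (a * N) ≤ q * κ
    qκ≥ = +-cancelˡ-≤ (q * (L * X)) _ _ (≤-trans viol′ (≤-reflexive
      (trans (cong (q *_) (sym (m+[n∸m]≡n LX≤Y))) (*-distribˡ-+ q (L * X) κ))))

  split-≼ : ∀ π {S} → (∀ x → S x ≤ 1) → split π S ≼ π
  split-≼ π S≤ x y e = proj₁ (double-injective (π x) (π y) (S≤ x) (S≤ y) e)

  energy-mono : ∀ {π′ π} f → π′ ≼ π → energy π f ≤ energy π′ f
  energy-mono {π′} {π} f ref = Avg₂.energy-mono (grid π′) (grid π) (uncurry f) (grid-refines ref)

  module Regularity (a : ℕ) (1≤a : 1 ≤ a) (1≤N : 1 ≤ N) (f h : Kernel) (B : ℕ)
    (energy-bound : ∀ M π → (∀ x → π x < M) → M ≤ a →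
                    energy π f + energy π h ≤ B * (L * L * (a * a))) where

    unit : ℕ
    unit = L * L * (a * a)

    1≤unit : 1 ≤ unit
    1≤unit = *-mono-≤ (*-mono-≤ L-pos L-pos) (*-mono-≤ 1≤a 1≤a)

    total : Colouring → ℕ
    total π = energy π f + energy π h

    -- Partitions are passed to continuations into ⊥, so that a violated cut inequality can be
    -- assumed by stability of ≤ and no search over S and T is needed.
    regularise : ∀ q t M π → (∀ x → π x < M) → M * 4 ^ t ≤ a →
      q * q * (B * unit) < q * q * total π + t * unit →
      (∀ π′ → (∀ x → π′ x < M * 4 ^ t) → π′ ≼ π → Cut a q π′ f → Cut a q π′ h → ⊥) → ⊥
    -- The invariant says that one unit for each of the t remaining steps would lift the energy
    -- above its maximum; with no step left it is absurd.
    regularise q zero M π π< M≤ en k = <⇒≱ en (≤-trans (≤-reflexive (+-identityʳ _))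
      (*-monoʳ-≤ (q * q) (energy-bound M π π< (≤-trans (≤-reflexive (sym (*-identityʳ M))) M≤))))
    regularise q (suc t) M π π< M≤ en k =
      k π (λ x → ≤-trans (π< x) (m≤m*n M (4 ^ suc t) {{m^n≢0 4 (suc t)}})) (λ _ _ → id)
        (λ S T S≤ T≤ → decidable-stable (_ ≤? _) λ viol →
          recurse S T S≤ T≤ (inj₁ (refined-energy a q π f S T 1≤N S≤ T≤ viol)))
        (λ S T S≤ T≤ → decidable-stable (_ ≤? _) λ viol →
          recurse S T S≤ T≤ (inj₂ (refined-energy a q π h S T 1≤N S≤ T≤ viol)))
      where
      recurse : ∀ S T → (∀ x → S x ≤ 1) → (∀ x → T x ≤ 1) →
        q * q * energy π f + unit ≤ q * q * energy (split (split π S) T) f ⊎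
        q * q * energy π h + unit ≤ q * q * energy (split (split π S) T) h → ⊥
      recurse S T S≤ T≤ inc = regularise q t (2 * (2 * M)) π′
        (split-bounded (split π S) (split-bounded π π< S≤) T≤)
        (≤-trans (≤-reflexive (eq₁ M (4 ^ t))) M≤)
        (begin-strict
          q * q * (B * unit)                       <⟨ en ⟩
          q * q * total π + suc t * unit           ≡⟨ eq₂ (q * q * total π) t unit ⟩
          q * q * total π + unit + t * unit        ≤⟨ +-monoˡ-≤ (t * unit) (grows inc) ⟩
          q * q * total π′ + t * unit              ∎)
        (λ π″ π″< ref → k π″ (λ x → ≤-trans (π″< x) (≤-reflexive (eq₁ M (4 ^ t)))) (λ x y → ref′ x y ∘ ref x y))
        where
        open ≤-Reasoning
        π′ = split (split π S) T
        ref′ : π′ ≼ π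
        ref′ x y = split-≼ π S≤ x y ∘ split-≼ (split π S) T≤ x y
        eq₁ : ∀ M x → 2 * (2 * M) * x ≡ M * (4 * x)
        eq₁ = solve-∀
        eq₂ : ∀ e t u → e + suc t * u ≡ e + u + t * u
        eq₂ = solve-∀
        eq₃ : ∀ Q e e′ u → Q * (e + e′) + u ≡ Q * e + u + Q * e′
        eq₃ = solve-∀
        eq₄ : ∀ Q e e′ u → Q * (e + e′) + u ≡ Q * e + (Q * e′ + u)
        eq₄ = solve-∀
        grows : q * q * energy π f + unit ≤ q * q * energy π′ f ⊎
                q * q * energy π h + unit ≤ q * q * energy π′ h →
                q * q * total π + unit ≤ q * q * total π′
        grows (inj₁ p) = begin
          q * q * total π + unit
            ≡⟨ eq₃ (q * q) (energy π f) (energy π h) unit ⟩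
          q * q * energy π f + unit + q * q * energy π h
            ≤⟨ +-mono-≤ p (*-monoʳ-≤ (q * q) (energy-mono h ref′)) ⟩
          q * q * energy π′ f + q * q * energy π′ h
            ≡⟨ sym (*-distribˡ-+ (q * q) _ _) ⟩
          q * q * total π′ ∎
        grows (inj₂ p) = begin
          q * q * total π + unit
            ≡⟨ eq₄ (q * q) (energy π f) (energy π h) unit ⟩
          q * q * energy π f + (q * q * energy π h + unit)
            ≤⟨ +-mono-≤ (*-monoʳ-≤ (q * q) (energy-mono f ref′)) p ⟩
          q * q * energy π′ f + q * q * energy π′ h
            ≡⟨ sym (*-distribˡ-+ (q * q) _ _) ⟩
          q * q * total π′ ∎

    module _ (q need : ℕ → ℕ) (p : ℕ) where

      open Growth B q need

      -- The precision of the fine partition depends on the size of the coarse one: the counting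
      -- errors have to be small compared to the coarse cells.
      regular-pair : ∀ r M π → 1 ≤ M → (∀ x → π x < M) → required r M ≤ a →
        p * (B * unit) < p * total π + r * unit →
        (∀ M π π′ → 1 ≤ M → (∀ x → π x < M) → M ≤ a → π′ ≼ π → need M ≤ a → Cut a (q M) π′ f → Cut a (q M) π′ h →
           p * total π′ ≤ p * total π + unit → ⊥) → ⊥
      regular-pair zero M π 1≤M π< req en k = <⇒≱ en (≤-trans (≤-reflexive (+-identityʳ _))
        (*-monoʳ-≤ p (energy-bound M π π< req)))
      regular-pair (suc r) M π 1≤M π< req en k =
        regularise (q M) (steps M) M π π< size≤a
          (begin-strict
            Q * (B * unit)                    <⟨ n<1+n _ ⟩
            1 + Q * (B * unit)                ≤⟨ +-monoˡ-≤ _ 1≤unit ⟩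
            unit + Q * (B * unit)             ≡⟨ eq₁ Q B unit ⟩
            (Q * B + 1) * unit                ≤⟨ m≤n+m _ _ ⟩
            Q * total π + (Q * B + 1) * unit  ∎)
          continue
        where
        open ≤-Reasoning
        Q = q M * q M
        eq₁ : ∀ Q B u → u + Q * (B * u) ≡ (Q * B + 1) * u
        eq₁ = solve-∀
        eq₂ : ∀ e t u → e + suc t * u ≡ e + u + t * u
        eq₂ = solve-∀
        size≤a : nextSize M ≤ a
        size≤a = ≤-trans (m≤n+m (nextSize M) (need M)) (≤-trans (m≤m+n (need M + nextSize M) (required r (nextSize M))) req)
        need≤a : need M ≤ a
        need≤a = ≤-trans (m≤m+n (need M) (nextSize M)) (≤-trans (m≤m+n (need M + nextSize M) (required r (nextSize M))) req)
        rest≤a : required r (nextSize M) ≤ a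
        rest≤a = ≤-trans (m≤n+m (required r (nextSize M)) (need M + nextSize M)) req
        M≤a : M ≤ a
        M≤a = ≤-trans (m≤m*n M (4 ^ steps M) {{m^n≢0 4 (steps M)}}) size≤a
        continue : ∀ π′ → (∀ x → π′ x < nextSize M) → π′ ≼ π → Cut a (q M) π′ f → Cut a (q M) π′ h → ⊥
        -- Either the refinement gains little energy and the pair is stable, or it uses up a round
        -- and the fine partition becomes the next coarse one.
        continue π′ π′< ref cutf cuth = by-cases (p * total π′ ≤? p * total π + unit)
          where
          by-cases : Dec (p * total π′ ≤ p * total π + unit) → ⊥
          by-cases (yes le) = k M π π′ 1≤M π< M≤a ref need≤a cutf cuth le
          by-cases (no ¬le) = regular-pair r (nextSize M) π′
            (≤-trans 1≤M (m≤m*n M (4 ^ steps M) {{m^n≢0 4 (steps M)}})) π′< rest≤a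
            (begin-strict
              p * (B * unit)                       <⟨ en ⟩
              p * total π + suc r * unit           ≡⟨ eq₂ (p * total π) r unit ⟩
              p * total π + unit + r * unit        ≤⟨ +-monoˡ-≤ (r * unit) (<⇒≤ (≰⇒> ¬le)) ⟩
              p * total π′ + r * unit              ∎)
            k

  -- Products of kernels and weighted closed walks

  infixr 7 _⊙_

  _⊙_ : Kernel → Kernel → Kernel
  (f ⊙ g) x z = ∑ vs (λ y → f x y * g y z)

  -- The trace of the matrix product of f and g; the cyclicity used below is that of the trace.
  ⟨_,_⟩ : Kernel → Kernel → ℕ
  ⟨ f , g ⟩ = ∑ vs (λ x → ∑ vs (λ y → f x y * g y x))

  ⊙-assoc : ∀ f g k x z → (f ⊙ (g ⊙ k)) x z ≡ ((f ⊙ g) ⊙ k) x z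
  ⊙-assoc f g k x z = begin
    ∑ vs (λ y → f x y * ∑ vs (λ w → g y w * k w z))
      ≡⟨ ∑-cong vs (λ y → sym (∑-*ˡ vs (f x y) _)) ⟩
    ∑ vs (λ y → ∑ vs (λ w → f x y * (g y w * k w z)))
      ≡⟨ ∑-swap vs vs _ ⟩
    ∑ vs (λ w → ∑ vs (λ y → f x y * (g y w * k w z)))
      ≡⟨ ∑-cong vs (λ w → trans (∑-cong vs (λ y → sym (*-assoc (f x y) _ _))) (∑-*ʳ vs _ (k w z))) ⟩
    ∑ vs (λ w → ∑ vs (λ y → f x y * g y w) * k w z) ∎
    where open ≡-Reasoning

  ⊙-congʳ : ∀ f {g g′ : Kernel} → (∀ x y → g x y ≡ g′ x y) → ∀ x y → (f ⊙ g) x y ≡ (f ⊙ g′) x y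
  ⊙-congʳ f eq x y = ∑-cong vs (λ w → cong (f x w *_) (eq w y))

  pairing-congʳ : ∀ f {g g′ : Kernel} → (∀ x y → g x y ≡ g′ x y) → ⟨ f , g ⟩ ≡ ⟨ f , g′ ⟩
  pairing-congʳ f eq = ∑-cong vs (λ x → ∑-cong vs (λ y → cong (f x y *_) (eq y x)))

  pairing-cyclic : ∀ f g k → ⟨ f , g ⊙ k ⟩ ≡ ⟨ g , k ⊙ f ⟩
  pairing-cyclic f g k = begin
    ∑ vs (λ x → ∑ vs (λ y → f x y * ∑ vs (λ z → g y z * k z x)))
      ≡⟨ ∑-swap vs vs _ ⟩
    ∑ vs (λ y → ∑ vs (λ x → f x y * ∑ vs (λ z → g y z * k z x)))
      ≡⟨ ∑-cong vs (λ y → ∑-cong vs (λ x → sym (∑-*ˡ vs (f x y) _))) ⟩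
    ∑ vs (λ y → ∑ vs (λ x → ∑ vs (λ z → f x y * (g y z * k z x))))
      ≡⟨ ∑-cong vs (λ y → ∑-swap vs vs _) ⟩
    ∑ vs (λ y → ∑ vs (λ z → ∑ vs (λ x → f x y * (g y z * k z x))))
      ≡⟨ ∑-cong vs (λ y → ∑-cong vs (λ z → trans (∑-cong vs (λ x → eq (f x y) (g y z) (k z x))) (∑-*ˡ vs (g y z) _))) ⟩
    ∑ vs (λ y → ∑ vs (λ z → g y z * ∑ vs (λ x → k z x * f x y))) ∎
    where
    open ≡-Reasoning
    eq : ∀ a b c → a * (b * c) ≡ b * (c * a)
    eq = solve-∀

  ⊙-bound : ∀ f g {r m} → (∀ x → ∑ vs (f x) ≤ r) → (∀ x y → g x y ≤ m) → ∀ x y → (f ⊙ g) x y ≤ r * m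
  ⊙-bound f g {r} {m} row g≤ x y = begin
    ∑ vs (λ w → f x w * g w y)  ≤⟨ ∑-mono vs (λ w → *-monoʳ-≤ (f x w) (g≤ w y)) ⟩
    ∑ vs (λ w → f x w * m)      ≡⟨ ∑-*ʳ vs (f x) m ⟩
    ∑ vs (f x) * m              ≤⟨ *-monoˡ-≤ m (row x) ⟩
    r * m                       ∎
    where open ≤-Reasoning

  row-bound : ∀ (f : Kernel) {m} → (∀ x y → f x y ≤ m) → ∀ x → ∑ vs (f x) ≤ N * m
  row-bound f {m} f≤ x = ≤-trans (∑-≤-const vs (f≤ x)) (≤-reflexive (cong (_* m) vs-length))

  cycle : Kernel → Kernel → Kernel → Kernel → Kernel → ℕ
  cycle k₀ k₁ k₂ k₃ k₄ = ⟨ k₀ , k₁ ⊙ k₂ ⊙ k₃ ⊙ k₄ ⟩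

  cycle-rotate : ∀ k₀ k₁ k₂ k₃ k₄ → cycle k₀ k₁ k₂ k₃ k₄ ≡ cycle k₁ k₂ k₃ k₄ k₀
  cycle-rotate k₀ k₁ k₂ k₃ k₄ = trans (pairing-cyclic k₀ k₁ (k₂ ⊙ k₃ ⊙ k₄)) (pairing-congʳ k₁ λ x y →
    trans (sym (⊙-assoc k₂ (k₃ ⊙ k₄) k₀ x y)) (⊙-congʳ k₂ (λ u v → sym (⊙-assoc k₃ k₄ k₀ u v)) x y))

  ∑-pairs : ∀ (g : V × V → ℕ) → ∑ pairs g ≡ ∑ vs (λ x → ∑ vs (λ y → g (x , y)))
  ∑-pairs g = ∑-product vs vs g

  -- By the layer-cake formula u and v are sums of U and W indicators of level sets, so the cut
  -- condition is applied U W times and its error multiplies accordingly.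
  Cut-weighted : ∀ {a q π f} → Cut a q π f → ∀ (u v : V → ℕ) {U W} → (∀ x → u x ≤ U) → (∀ y → v y ≤ W) →
    q * ∑ pairs (λ z → density π f z * rectangle u v z)
      ≤ L * (q * ∑ pairs (λ z → uncurry f z * rectangle u v z) + U * W * (a * N))
  Cut-weighted {a} {q} {π} {f} cut u v {U} {W} u≤ v≤ = begin
    q * ∑ pairs (λ z → density π f z * rectangle u v z)
      ≡⟨ cong (q *_) (expand (density π f)) ⟩
    q * ∑ (downFrom U) (λ s → ∑ (downFrom W) (λ t → X (density π f) s t))
      ≡⟨ pull q (X (density π f)) ⟩
    ∑ (downFrom U) (λ s → ∑ (downFrom W) (λ t → q * X (density π f) s t))
      ≤⟨ ∑-mono (downFrom U) (λ s → ∑-mono (downFrom W) (λ t →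
           cut (λ x → 𝟙 (s <? u x)) (λ y → 𝟙 (t <? v y)) (λ x → 𝟙≤1 (s <? u x)) (λ y → 𝟙≤1 (t <? v y)))) ⟩
    ∑ (downFrom U) (λ s → ∑ (downFrom W) (λ t → L * (q * X (uncurry f) s t + a * N)))
      ≡⟨ sym (pull L (λ s t → q * X (uncurry f) s t + a * N)) ⟩
    L * ∑ (downFrom U) (λ s → ∑ (downFrom W) (λ t → q * X (uncurry f) s t + a * N))
      ≡⟨ cong (L *_) (trans (∑-cong (downFrom U) (λ s → ∑-+ (downFrom W) _ _)) (∑-+ (downFrom U) _ _)) ⟩
    L * (∑ (downFrom U) (λ s → ∑ (downFrom W) (λ t → q * X (uncurry f) s t))
         + ∑ (downFrom U) (λ _ → ∑ (downFrom W) (λ _ → a * N)))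
      ≡⟨ cong (L *_) (cong₂ _+_ (sym (trans (cong (q *_) (expand (uncurry f))) (pull q (X (uncurry f))))) const) ⟩
    L * (q * ∑ pairs (λ z → uncurry f z * rectangle u v z) + U * W * (a * N)) ∎
    where
    open ≤-Reasoning
    level : (V → ℕ) → ℕ → V → ℕ
    level w s x = 𝟙 (s <? w x)
    X : (V × V → ℕ) → ℕ → ℕ → ℕ
    X d s t = ∑ pairs (λ z → d z * rectangle (level u s) (level v t) z)
    pull : ∀ c (Y : ℕ → ℕ → ℕ) → c * ∑ (downFrom U) (λ s → ∑ (downFrom W) (Y s)) ≡
                                 ∑ (downFrom U) (λ s → ∑ (downFrom W) (λ t → c * Y s t))
    pull c Y = trans (sym (∑-*ˡ (downFrom U) c _)) (∑-cong (downFrom U) (λ s → sym (∑-*ˡ (downFrom W) c _)))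
    const : ∑ (downFrom U) (λ _ → ∑ (downFrom W) (λ _ → a * N)) ≡ U * W * (a * N)
    const = trans (∑-const (downFrom U) _) (trans (cong₂ _*_ (length-downFrom U)
      (trans (∑-const (downFrom W) _) (cong (_* (a * N)) (length-downFrom W)))) (sym (*-assoc U W (a * N))))
    cake : ∀ z → rectangle u v z ≡ ∑ (downFrom U) (λ s → ∑ (downFrom W) (λ t → rectangle (level u s) (level v t) z))
    cake (x , y) = sym (trans (∑∑-* (downFrom U) (downFrom W) (λ s → level u s x) (λ t → level v t y))
      (cong₂ _*_ (trans (layer-cake U (u x)) (m≥n⇒m⊓n≡n (u≤ x))) (trans (layer-cake W (v y)) (m≥n⇒m⊓n≡n (v≤ y)))))
    expand : ∀ d → ∑ pairs (λ z → d z * rectangle u v z) ≡ ∑ (downFrom U) (λ s → ∑ (downFrom W) (X d s))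
    expand d = trans
      (∑-cong pairs (λ z → trans (cong (d z *_) (cake z))
        (trans (sym (∑-*ˡ (downFrom U) (d z) _)) (∑-cong (downFrom U) (λ s → sym (∑-*ˡ (downFrom W) (d z) _))))))
      (trans (∑-swap pairs (downFrom U) _) (∑-cong (downFrom U) (λ s → ∑-swap pairs (downFrom W) _)))

  -- Replaces one edge of a closed walk by a subset G of the points where the model is dense.
  replace-edge : ∀ {a q π f} → Cut a q π f → ∀ s (G : Kernel) → (∀ x y → L * a * G x y ≤ s * density π f (x , y)) →
    ∀ v u {U W} → (∀ x y → v x y ≤ W) → (∀ x y → u x y ≤ U) →
    a * q * ⟨ G , v ⊙ u ⟩ ≤ s * (q * ⟨ f , v ⊙ u ⟩ + N * (U * W * (a * N)))
  replace-edge {a} {q} {π} {f} cut s G dense v u {U} {W} v≤ u≤ = begin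
    a * q * ⟨ G , v ⊙ u ⟩
      ≡⟨ cong (a * q *_) (slice G) ⟩
    a * q * ∑ vs (λ z → R G z)
      ≡⟨ sym (∑-*ˡ vs (a * q) _) ⟩
    ∑ vs (λ z → a * q * R G z)
      ≤⟨ ∑-mono vs pointwise ⟩
    ∑ vs (λ z → s * (q * R f z + U * W * (a * N)))
      ≡⟨ ∑-*ˡ vs s _ ⟩
    s * ∑ vs (λ z → q * R f z + U * W * (a * N))
      ≡⟨ cong (s *_) (∑-+ vs _ _) ⟩
    s * (∑ vs (λ z → q * R f z) + ∑ vs (λ _ → U * W * (a * N)))
      ≡⟨ cong (s *_) (cong₂ _+_ (trans (∑-*ˡ vs q _) (cong (q *_) (sym (slice f))))
           (trans (∑-const vs _) (cong (_* (U * W * (a * N))) vs-length))) ⟩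
    s * (q * ⟨ f , v ⊙ u ⟩ + N * (U * W * (a * N))) ∎
    where
    open ≤-Reasoning
    R : Kernel → V → ℕ
    R g z = ∑ pairs (λ e → uncurry g e * rectangle (u z) (λ y → v y z) e)
    eq₁ : ∀ a b c → a * (b * c) ≡ a * (c * b)
    eq₁ = solve-∀
    -- For a fixed vertex z on the remaining path, its weight `v y z * u z x` is a product of a
    -- function of x and one of y, as `Cut-weighted` requires. Summing over z multiplies the error
    -- by N.
    slice : ∀ g → ⟨ g , v ⊙ u ⟩ ≡ ∑ vs (R g)
    slice g = begin-equality
      ∑ vs (λ x → ∑ vs (λ y → g x y * ∑ vs (λ z → v y z * u z x)))
        ≡⟨ ∑-cong vs (λ x → ∑-cong vs (λ y → sym (∑-*ˡ vs (g x y) _))) ⟩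
      ∑ vs (λ x → ∑ vs (λ y → ∑ vs (λ z → g x y * (v y z * u z x))))
        ≡⟨ ∑-cong vs (λ x → ∑-swap vs vs _) ⟩
      ∑ vs (λ x → ∑ vs (λ z → ∑ vs (λ y → g x y * (v y z * u z x))))
        ≡⟨ ∑-swap vs vs _ ⟩
      ∑ vs (λ z → ∑ vs (λ x → ∑ vs (λ y → g x y * (v y z * u z x))))
        ≡⟨ ∑-cong vs (λ z → trans (∑-cong vs (λ x → ∑-cong vs (λ y → eq₁ (g x y) (v y z) (u z x))))
             (sym (∑-pairs _))) ⟩
      ∑ vs (R g) ∎
    eq₂ : ∀ L a q x → L * (a * q * x) ≡ q * (L * a * x)
    eq₂ = solve-∀
    eq₃ : ∀ q s x → q * (s * x) ≡ s * (q * x)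
    eq₃ = solve-∀
    eq₄ : ∀ L s x → s * (L * x) ≡ L * (s * x)
    eq₄ = solve-∀
    pointwise : ∀ z → a * q * R G z ≤ s * (q * R f z + U * W * (a * N))
    pointwise z = *-cancelˡ-≤ L {{>-nonZero L-pos}} (begin
      L * (a * q * R G z)
        ≡⟨ eq₂ L a q (R G z) ⟩
      q * (L * a * R G z)
        ≡⟨ cong (q *_) (sym (∑-*ˡ pairs (L * a) _)) ⟩
      q * ∑ pairs (λ e → L * a * (uncurry G e * r e))
        ≤⟨ *-monoʳ-≤ q (∑-mono pairs (λ e → ≤-trans (≤-reflexive (sym (*-assoc (L * a) (uncurry G e) (r e))))
             (≤-trans (*-monoˡ-≤ (r e) (dense (proj₁ e) (proj₂ e))) (≤-reflexive (*-assoc s (density π f e) (r e)))))) ⟩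
      q * ∑ pairs (λ e → s * (density π f e * r e))
        ≡⟨ cong (q *_) (∑-*ˡ pairs s _) ⟩
      q * (s * ∑ pairs (λ e → density π f e * r e))
        ≡⟨ eq₃ q s _ ⟩
      s * (q * ∑ pairs (λ e → density π f e * r e))
        ≤⟨ *-monoʳ-≤ s (Cut-weighted {a} {q} {π} {f} cut (u z) (λ y → v y z) (u≤ z) (λ y → v≤ y z)) ⟩
      s * (L * (q * R f z + U * W * (a * N)))
        ≡⟨ eq₄ L s _ ⟩
      L * (s * (q * R f z + U * W * (a * N))) ∎)
      where
      r = rectangle (u z) (λ y → v y z)

  ⊙-assoc₄ : ∀ k₁ k₂ k₃ k₄ x y → (k₁ ⊙ k₂ ⊙ k₃ ⊙ k₄) x y ≡ ((k₁ ⊙ k₂ ⊙ k₃) ⊙ k₄) x y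
  ⊙-assoc₄ k₁ k₂ k₃ k₄ x y = trans (⊙-congʳ k₁ (⊙-assoc k₂ k₃ k₄) x y) (⊙-assoc k₁ (k₂ ⊙ k₃) k₄ x y)

  -- The order in which the edges are replaced keeps the remaining weights bounded:
  -- first the pair of two-step paths f ⊙ f ≤ 2, afterwards only row sums of f are needed.
  model-lower-bound : ∀ a q C c π f h → 1 ≤ c → 1 ≤ C → N ≤ C * (a * a) →
    Cut a q π f → Cut a q π h → (∀ x → ∑ vs (f x) ≤ a) → (∀ x y → (f ⊙ f) x y ≤ 2) →
    ∀ (G₀ G₁ G₂ G₃ G₄ : Kernel) → (∀ x y → G₀ x y ≤ 1) → (∀ x y → G₁ x y ≤ 1) → (∀ x y → G₂ x y ≤ 1) → (∀ x y → G₄ x y ≤ 1) →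
    (∀ x y → L * a * G₀ x y ≤ c * N * density π f (x , y)) →
    (∀ x y → L * a * G₁ x y ≤ c * N * density π f (x , y)) →
    (∀ x y → L * a * G₂ x y ≤ c * N * density π f (x , y)) →
    (∀ x y → L * a * G₃ x y ≤ c * N * density π f (x , y)) →
    (∀ x y → L * a * G₄ x y ≤ c * N * density π h (x , y)) →
    a ^ 5 * (q * cycle G₃ G₄ G₀ G₁ G₂) ≤ c ^ 5 * N ^ 5 * (q * cycle h f f f f) + 9 * (c ^ 5 * (C * C) * (a ^ 5 * N ^ 5))
  model-lower-bound a q C c π f h 1≤c 1≤C N≤ cutf cuth row two G₀ G₁ G₂ G₃ G₄ G₀≤ G₁≤ G₂≤ G₄≤ d₀ d₁ d₂ d₃ d₄ =
    ≤-trans c₅ (+-mono-≤ (≤-reflexive (cong (_* (q * cycle h f f f f)) (pow c N)))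
      (chain-error a N c C 1≤c 1≤C N≤))
    where
    s = c * N
    pow : ∀ c N → (c * N) ^ 5 ≡ c ^ 5 * N ^ 5
    pow c N = ^-distribʳ-* c N 5
    fG≤ : ∀ (G : Kernel) {m} → (∀ x y → G x y ≤ m) → ∀ x y → (f ⊙ G) x y ≤ a * m
    fG≤ G = ⊙-bound f G row
    GG≤ : ∀ (G H : Kernel) {m} → (∀ x y → G x y ≤ 1) → (∀ x y → H x y ≤ m) → ∀ x y → (G ⊙ H) x y ≤ N * 1 * m
    GG≤ G H G≤ = ⊙-bound G H (row-bound G G≤)
    i₁ : a * q * cycle G₄ f f f f ≤ s * (q * cycle h f f f f + N * (2 * 2 * (a * N)))
    i₁ = subst₂ (λ x y → a * q * x ≤ s * (q * y + N * (2 * 2 * (a * N))))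
      (sym (pairing-congʳ G₄ (⊙-assoc f f (f ⊙ f)))) (sym (pairing-congʳ h (⊙-assoc f f (f ⊙ f))))
      (replace-edge {a} {q} {π} {h} cuth s G₄ d₄ (f ⊙ f) (f ⊙ f) two two)
    i₂ : a * q * cycle G₀ f f f G₄ ≤ s * (q * cycle G₄ f f f f + N * (1 * (a * 2) * (a * N)))
    i₂ = subst₂ (λ x y → a * q * x ≤ s * (q * y + N * (1 * (a * 2) * (a * N))))
      (sym (pairing-congʳ G₀ (⊙-assoc₄ f f f G₄)))
      (sym (trans (cycle-rotate G₄ f f f f) (pairing-congʳ f (⊙-assoc₄ f f f G₄))))
      (replace-edge {a} {q} {π} {f} cutf s G₀ d₀ (f ⊙ f ⊙ f) G₄ (fG≤ (f ⊙ f) two) G₄≤)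
    i₃ : a * q * cycle G₁ f f G₄ G₀ ≤ s * (q * cycle G₀ f f f G₄ + N * (1 * (a * (a * 1)) * (a * N)))
    i₃ = subst₂ (λ x y → a * q * x ≤ s * (q * y + N * (1 * (a * (a * 1)) * (a * N))))
      (sym (pairing-congʳ G₁ (⊙-assoc₄ f f G₄ G₀)))
      (sym (trans (cycle-rotate G₀ f f f G₄) (pairing-congʳ f (⊙-assoc₄ f f G₄ G₀))))
      (replace-edge {a} {q} {π} {f} cutf s G₁ d₁ (f ⊙ f ⊙ G₄) G₀ (fG≤ (f ⊙ G₄) (fG≤ G₄ G₄≤)) G₀≤)
    i₄ : a * q * cycle G₂ f G₄ G₀ G₁ ≤ s * (q * cycle G₁ f f G₄ G₀ + N * (N * 1 * 1 * (a * 1) * (a * N)))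
    i₄ = subst₂ (λ x y → a * q * x ≤ s * (q * y + N * (N * 1 * 1 * (a * 1) * (a * N))))
      (sym (pairing-congʳ G₂ (⊙-assoc f G₄ (G₀ ⊙ G₁))))
      (sym (trans (cycle-rotate G₁ f f G₄ G₀) (pairing-congʳ f (⊙-assoc f G₄ (G₀ ⊙ G₁)))))
      (replace-edge {a} {q} {π} {f} cutf s G₂ d₂ (f ⊙ G₄) (G₀ ⊙ G₁) (fG≤ G₄ G₄≤) (GG≤ G₀ G₁ G₀≤ G₁≤))
    i₅ : a * q * cycle G₃ G₄ G₀ G₁ G₂ ≤ s * (q * cycle G₂ f G₄ G₀ G₁ + N * (N * 1 * (N * 1 * 1) * 1 * (a * N)))
    i₅ = subst (λ y → a * q * cycle G₃ G₄ G₀ G₁ G₂ ≤ s * (q * y + N * (N * 1 * (N * 1 * 1) * 1 * (a * N))))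
      (sym (cycle-rotate G₂ f G₄ G₀ G₁))
      (replace-edge {a} {q} {π} {f} cutf s G₃ d₃ G₄ (G₀ ⊙ G₁ ⊙ G₂) G₄≤ (GG≤ G₀ (G₁ ⊙ G₂) G₀≤ (GG≤ G₁ G₂ G₁≤ G₂≤)))
    c₅ = chain-step a (a ^ 4) q s (s ^ 4) _
      (chain-step a (a ^ 3) q s (s ^ 3) _
      (chain-step a (a ^ 2) q s (s ^ 2) _
      (chain-step a (a ^ 1) q s (s ^ 1) _
      (chain-step a 1 q s 1 0 (m≤m+n _ 0) i₁) i₂) i₃) i₄) i₅

  -- Walks through almost complete blocks

  full : (V → ℕ) → (V → ℕ) → Kernel
  full P Q x y = P x * Q y

  full-⊙ : ∀ (P Q R : V → ℕ) → (∀ x → Q x ≤ 1) → ∀ {X k} → (∀ x y → X x y ≡ k * (Q x * R y)) →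
           ∀ x z → (full P Q ⊙ X) x z ≡ k * ∑ vs Q * (P x * R z)
  full-⊙ P Q R Q≤ {X} {k} X≡ x z = begin
    ∑ vs (λ y → P x * Q y * X y z)
      ≡⟨ ∑-cong vs (λ y → trans (cong (P x * Q y *_) (X≡ y z))
           (trans (eq₁ (P x) (Q y) k (R z)) (cong (_* (k * (P x * R z))) (0/1-idempotent (Q≤ y))))) ⟩
    ∑ vs (λ y → Q y * (k * (P x * R z)))
      ≡⟨ ∑-*ʳ vs Q _ ⟩
    ∑ vs Q * (k * (P x * R z))
      ≡⟨ eq₂ (∑ vs Q) k (P x * R z) ⟩
    k * ∑ vs Q * (P x * R z) ∎
    where
    open ≡-Reasoning
    eq₁ : ∀ p q k r → p * q * (k * (q * r)) ≡ q * q * (k * (p * r))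
    eq₁ = solve-∀
    eq₂ : ∀ s k x → s * (k * x) ≡ k * s * x
    eq₂ = solve-∀

  cycle-full : ∀ (P₀ P₁ P₂ P₃ P₄ : V → ℕ) → (∀ x → P₀ x ≤ 1) → (∀ x → P₁ x ≤ 1) → (∀ x → P₂ x ≤ 1) →
    (∀ x → P₃ x ≤ 1) → (∀ x → P₄ x ≤ 1) →
    cycle (full P₀ P₁) (full P₁ P₂) (full P₂ P₃) (full P₃ P₄) (full P₄ P₀)
      ≡ ∑ vs P₀ * (∑ vs P₁ * (∑ vs P₂ * (∑ vs P₃ * ∑ vs P₄)))
  cycle-full P₀ P₁ P₂ P₃ P₄ ≤₀ ≤₁ ≤₂ ≤₃ ≤₄ = begin
    cycle (full P₀ P₁) (full P₁ P₂) (full P₂ P₃) (full P₃ P₄) (full P₄ P₀)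
      ≡⟨ pairing-congʳ (full P₀ P₁) (full-⊙ P₁ P₂ P₀ ≤₂ {k = 1 * ∑ vs P₄ * ∑ vs P₃} (full-⊙ P₂ P₃ P₀ ≤₃ {k = 1 * ∑ vs P₄} (full-⊙ P₃ P₄ P₀ ≤₄ {k = 1}
           (λ x y → sym (*-identityˡ (P₄ x * P₀ y)))))) ⟩
    ∑ vs (λ x → ∑ vs (λ y → P₀ x * P₁ y * (K * (P₁ y * P₀ x))))
      ≡⟨ ∑-cong vs (λ x → ∑-cong vs (λ y → trans (eq₁ (P₀ x) (P₁ y) K)
           (cong₂ (λ a b → K * a * b) (0/1-idempotent (≤₀ x)) (0/1-idempotent (≤₁ y))))) ⟩
    ∑ vs (λ x → ∑ vs (λ y → K * P₀ x * P₁ y))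
      ≡⟨ ∑∑-* vs vs (λ x → K * P₀ x) P₁ ⟩
    ∑ vs (λ x → K * P₀ x) * ∑ vs P₁
      ≡⟨ cong (_* ∑ vs P₁) (∑-*ˡ vs K P₀) ⟩
    K * ∑ vs P₀ * ∑ vs P₁
      ≡⟨ eq₂ (∑ vs P₀) (∑ vs P₁) (∑ vs P₂) (∑ vs P₃) (∑ vs P₄) ⟩
    ∑ vs P₀ * (∑ vs P₁ * (∑ vs P₂ * (∑ vs P₃ * ∑ vs P₄))) ∎
    where
    open ≡-Reasoning
    K = 1 * ∑ vs P₄ * ∑ vs P₃ * ∑ vs P₂
    eq₁ : ∀ p q k → p * q * (k * (q * p)) ≡ k * (p * p) * (q * q)
    eq₁ = solve-∀
    eq₂ : ∀ a b c d e → 1 * e * d * c * a * b ≡ a * (b * (c * (d * e)))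
    eq₂ = solve-∀

  -- A tenth may be missing: replacing the five blocks one after the other then loses at most half
  -- of all walks.
  record AlmostFull (P Q : V → ℕ) (G : Kernel) : Set where
    field
      H         : Kernel
      partition : ∀ x y → full P Q x y ≡ G x y + H x y
      few       : 10 * ∑ vs (λ x → ∑ vs (H x)) ≤ ∑ vs P * ∑ vs Q

    G≤full : ∀ x y → G x y ≤ full P Q x y
    G≤full x y = ≤-trans (m≤m+n _ _) (≤-reflexive (sym (partition x y)))

  open AlmostFull

  full-row : ∀ (P Q : V → ℕ) (G : Kernel) → (∀ x → P x ≤ 1) → (∀ x y → G x y ≤ full P Q x y) → ∀ x → ∑ vs (G x) ≤ ∑ vs Q
  full-row P Q G P≤ G≤ x = ∑-mono vs (λ y → ≤-trans (G≤ x y)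
    (≤-trans (*-monoˡ-≤ (Q y) (P≤ x)) (≤-reflexive (*-identityˡ (Q y)))))

  -- A missing entry destroys at most as many walks as there are ways to close it up, which the row
  -- sums bound. When these are the sizes of the other three sets, the loss is the product of all
  -- five sizes.
  replace-full : ∀ {P Q G} → AlmostFull P Q G → ∀ X₁ X₂ X₃ X₄ {r₁ r₂ r₃} →
    (∀ x → ∑ vs (X₁ x) ≤ r₁) → (∀ x → ∑ vs (X₂ x) ≤ r₂) → (∀ x → ∑ vs (X₃ x) ≤ r₃) → (∀ x y → X₄ x y ≤ 1) →
    10 * cycle (full P Q) X₁ X₂ X₃ X₄ ≤ 10 * cycle G X₁ X₂ X₃ X₄ + ∑ vs P * ∑ vs Q * (r₁ * (r₂ * (r₃ * 1)))
  replace-full {P} {Q} {G} af X₁ X₂ X₃ X₄ {r₁} {r₂} {r₃} ≤₁ ≤₂ ≤₃ ≤₄ = begin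
    10 * ∑ vs (λ x → ∑ vs (λ y → P x * Q y * R y x))
      ≡⟨ cong (10 *_) (∑-cong vs (λ x → trans (∑-cong vs (λ y →
           trans (cong (_* R y x) (partition af x y)) (*-distribʳ-+ (R y x) (G x y) (H af x y)))) (∑-+ vs _ _))) ⟩
    10 * ∑ vs (λ x → ∑ vs (λ y → G x y * R y x) + ∑ vs (λ y → H af x y * R y x))
      ≡⟨ trans (cong (10 *_) (∑-+ vs _ _)) (*-distribˡ-+ 10 (⟨ G , R ⟩) (⟨ H af , R ⟩)) ⟩
    10 * ⟨ G , R ⟩ + 10 * ⟨ H af , R ⟩
      ≤⟨ +-monoʳ-≤ (10 * ⟨ G , R ⟩) (*-monoʳ-≤ 10 (∑-mono vs (λ x → ∑-mono vs (λ y → *-monoʳ-≤ (H af x y) (R≤ y x))))) ⟩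
    10 * ⟨ G , R ⟩ + 10 * ∑ vs (λ x → ∑ vs (λ y → H af x y * ρ))
      ≡⟨ cong (λ e → 10 * ⟨ G , R ⟩ + 10 * e) (trans (∑-cong vs (λ x → ∑-*ʳ vs _ ρ)) (∑-*ʳ vs _ ρ)) ⟩
    10 * ⟨ G , R ⟩ + 10 * (∑ vs (λ x → ∑ vs (H af x)) * ρ)
      ≡⟨ cong (10 * ⟨ G , R ⟩ +_) (sym (*-assoc 10 (∑ vs (λ x → ∑ vs (H af x))) ρ)) ⟩
    10 * ⟨ G , R ⟩ + 10 * ∑ vs (λ x → ∑ vs (H af x)) * ρ
      ≤⟨ +-monoʳ-≤ (10 * ⟨ G , R ⟩) (*-monoˡ-≤ ρ (few af)) ⟩
    10 * ⟨ G , R ⟩ + ∑ vs P * ∑ vs Q * ρ ∎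
    where
    open ≤-Reasoning
    R = X₁ ⊙ X₂ ⊙ X₃ ⊙ X₄
    ρ = r₁ * (r₂ * (r₃ * 1))
    R≤ : ∀ x y → R x y ≤ ρ
    R≤ = ⊙-bound X₁ (X₂ ⊙ X₃ ⊙ X₄) ≤₁ (⊙-bound X₂ (X₃ ⊙ X₄) ≤₂ (⊙-bound X₃ X₄ ≤₃ ≤₄))

  cycle-almost-full : ∀ {P₀ P₁ P₂ P₃ P₄ G₀ G₁ G₂ G₃ G₄} → (∀ x → P₀ x ≤ 1) → (∀ x → P₁ x ≤ 1) → (∀ x → P₂ x ≤ 1) →
    (∀ x → P₃ x ≤ 1) → (∀ x → P₄ x ≤ 1) → AlmostFull P₀ P₁ G₀ → AlmostFull P₁ P₂ G₁ → AlmostFull P₂ P₃ G₂ →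
    AlmostFull P₃ P₄ G₃ → AlmostFull P₄ P₀ G₄ →
    ∑ vs P₀ * (∑ vs P₁ * (∑ vs P₂ * (∑ vs P₃ * ∑ vs P₄))) ≤ 2 * cycle G₃ G₄ G₀ G₁ G₂
  cycle-almost-full {P₀} {P₁} {P₂} {P₃} {P₄} {G₀} {G₁} {G₂} {G₃} {G₄} ≤₀ ≤₁ ≤₂ ≤₃ ≤₄ A₀ A₁ A₂ A₃ A₄ =
    *-cancelˡ-≤ 5 (+-cancelʳ-≤ (5 * Π) _ _ (begin
      5 * Π + 5 * Π
        ≡⟨ eq₀ Π ⟩
      10 * Π
        ≡⟨ cong (10 *_) (sym (cycle-full P₀ P₁ P₂ P₃ P₄ ≤₀ ≤₁ ≤₂ ≤₃ ≤₄)) ⟩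
      10 * cycle J₀ J₁ J₂ J₃ J₄
        ≤⟨ replace-full A₀ J₁ J₂ J₃ J₄ (jrow P₁ P₂ ≤₁) (jrow P₂ P₃ ≤₂) (jrow P₃ P₄ ≤₃) (J≤1 {P₄} {P₀} ≤₄ ≤₀) ⟩
      10 * cycle G₀ J₁ J₂ J₃ J₄ + e₀
        ≤⟨ step {z = cycle G₁ J₂ J₃ J₄ G₀} (cycle-rotate G₀ J₁ J₂ J₃ J₄) (replace-full A₁ J₂ J₃ J₄ G₀ (jrow P₂ P₃ ≤₂) (jrow P₃ P₄ ≤₃) (jrow P₄ P₀ ≤₄) (G≤1 A₀ ≤₀ ≤₁)) ⟩
      10 * cycle G₁ J₂ J₃ J₄ G₀ + e₁ + e₀
        ≤⟨ +-monoˡ-≤ e₀ (step {z = cycle G₂ J₃ J₄ G₀ G₁} (cycle-rotate G₁ J₂ J₃ J₄ G₀) (replace-full A₂ J₃ J₄ G₀ G₁ (jrow P₃ P₄ ≤₃) (jrow P₄ P₀ ≤₄) (grow A₀ ≤₀) (G≤1 A₁ ≤₁ ≤₂))) ⟩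
      10 * cycle G₂ J₃ J₄ G₀ G₁ + e₂ + e₁ + e₀
        ≤⟨ +-monoˡ-≤ e₀ (+-monoˡ-≤ e₁ (step {z = cycle G₃ J₄ G₀ G₁ G₂} (cycle-rotate G₂ J₃ J₄ G₀ G₁)
             (replace-full A₃ J₄ G₀ G₁ G₂ (jrow P₄ P₀ ≤₄) (grow A₀ ≤₀) (grow A₁ ≤₁) (G≤1 A₂ ≤₂ ≤₃)))) ⟩
      10 * cycle G₃ J₄ G₀ G₁ G₂ + e₃ + e₂ + e₁ + e₀
        ≤⟨ +-monoˡ-≤ e₀ (+-monoˡ-≤ e₁ (+-monoˡ-≤ e₂ (step {z = cycle G₄ G₀ G₁ G₂ G₃} (cycle-rotate G₃ J₄ G₀ G₁ G₂)
             (replace-full A₄ G₀ G₁ G₂ G₃ (grow A₀ ≤₀) (grow A₁ ≤₁) (grow A₂ ≤₂) (G≤1 A₃ ≤₃ ≤₄))))) ⟩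
      10 * cycle G₄ G₀ G₁ G₂ G₃ + e₄ + e₃ + e₂ + e₁ + e₀
        ≡⟨ cong (λ t → 10 * t + e₄ + e₃ + e₂ + e₁ + e₀) (sym (cycle-rotate G₃ G₄ G₀ G₁ G₂)) ⟩
      10 * T + e₄ + e₃ + e₂ + e₁ + e₀
        ≡⟨ eq₁ T (∑ vs P₀) (∑ vs P₁) (∑ vs P₂) (∑ vs P₃) (∑ vs P₄) ⟩
      5 * (2 * T) + 5 * Π ∎))
    where
    open ≤-Reasoning
    p₀ = ∑ vs P₀
    p₁ = ∑ vs P₁
    p₂ = ∑ vs P₂
    p₃ = ∑ vs P₃
    p₄ = ∑ vs P₄
    Π = p₀ * (p₁ * (p₂ * (p₃ * p₄)))
    T = cycle G₃ G₄ G₀ G₁ G₂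
    J₀ = full P₀ P₁
    J₁ = full P₁ P₂
    J₂ = full P₂ P₃
    J₃ = full P₃ P₄
    J₄ = full P₄ P₀
    e₀ = p₀ * p₁ * (p₂ * (p₃ * (p₄ * 1)))
    e₁ = p₁ * p₂ * (p₃ * (p₄ * (p₀ * 1)))
    e₂ = p₂ * p₃ * (p₄ * (p₀ * (p₁ * 1)))
    e₃ = p₃ * p₄ * (p₀ * (p₁ * (p₂ * 1)))
    e₄ = p₄ * p₀ * (p₁ * (p₂ * (p₃ * 1)))
    eq₀ : ∀ x → 5 * x + 5 * x ≡ 10 * x
    eq₀ = solve-∀
    eq₁ : ∀ t a b c d e → 10 * t + e * a * (b * (c * (d * 1))) + d * e * (a * (b * (c * 1))) + c * d * (e * (a * (b * 1)))
          + b * c * (d * (e * (a * 1))) + a * b * (c * (d * (e * 1))) ≡ 5 * (2 * t) + 5 * (a * (b * (c * (d * e))))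
    eq₁ = solve-∀
    jrow : ∀ (P Q : V → ℕ) → (∀ x → P x ≤ 1) → ∀ x → ∑ vs (full P Q x) ≤ ∑ vs Q
    jrow P Q P≤ = full-row P Q (full P Q) P≤ (λ x y → ≤-refl)
    grow : ∀ {P Q G} → AlmostFull P Q G → (∀ x → P x ≤ 1) → ∀ x → ∑ vs (G x) ≤ ∑ vs Q
    grow {P} {Q} {G} A P≤ = full-row P Q G P≤ (G≤full A)
    J≤1 : ∀ {P Q : V → ℕ} → (∀ x → P x ≤ 1) → (∀ x → Q x ≤ 1) → ∀ x y → full P Q x y ≤ 1
    J≤1 P≤ Q≤ x y = *-mono-≤ (P≤ x) (Q≤ y)
    G≤1 : ∀ {P Q G} → AlmostFull P Q G → (∀ x → P x ≤ 1) → (∀ x → Q x ≤ 1) → ∀ x y → G x y ≤ 1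
    G≤1 A P≤ Q≤ x y = ≤-trans (G≤full A x y) (*-mono-≤ (P≤ x) (Q≤ y))
    step : ∀ {x y z e e′} → x ≡ y → 10 * y ≤ 10 * z + e → 10 * x + e′ ≤ 10 * z + e + e′
    step {e′ = e′} refl le = +-monoˡ-≤ e′ le

  -- Each nonempty colour class contributes exactly `L`, and there are at most M classes.
  weight-total : ∀ M π → (∀ x → π x < M) → ∑ vs (Avg₁.weight (cells π)) ≤ M * L
  weight-total M π π< = begin
    ∑ vs w
      ≤⟨ ∑-mono vs (λ x → ≤-trans (≤-reflexive (sym (trans (cong (_* w x) (𝟙-yes (π x ≟ π x) refl)) (*-identityˡ (w x)))))
           (∑-∈ (λ c → 𝟙 (π x ≟ c) * w x) (∈-downFrom⁺ (π< x)))) ⟩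
    ∑ vs (λ x → ∑ (downFrom M) (λ c → 𝟙 (π x ≟ c) * w x))
      ≡⟨ ∑-swap vs (downFrom M) _ ⟩
    ∑ (downFrom M) (λ c → ∑ vs (λ x → 𝟙 (π x ≟ c) * w x))
      ≤⟨ ∑-≤-const (downFrom M) colour-class ⟩
    length (downFrom M) * L
      ≡⟨ cong (_* L) (length-downFrom M) ⟩
    M * L ∎
    where
    open ≤-Reasoning
    w = Avg₁.weight (cells π)
    colour-class : ∀ c → ∑ vs (λ x → 𝟙 (π x ≟ c) * w x) ≤ L
    colour-class c = by-cases (∑-zero-or-witness vs (λ x → 𝟙 (π x ≟ c) * w x))
      where
      nonempty : ∀ x₀ → π x₀ ≡ c → ∑ vs (λ x → 𝟙 (π x ≟ c) * w x) ≡ L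
      nonempty x₀ refl = begin-equality
        ∑ vs (λ x → 𝟙 (π x ≟ π x₀) * w x)
          ≡⟨ ∑-cong vs (λ x → trans (𝟙-*-≡ (π x ≟ π x₀) (Avg₁.weight-measurable (cells π) {x} {x₀}))
               (trans (*-comm _ (w x₀)) (cong (w x₀ *_) (same-sym (cells π) x x₀)))) ⟩
        ∑ vs (λ x → w x₀ * same (cells π) x₀ x)
          ≡⟨ ∑-*ˡ vs (w x₀) _ ⟩
        w x₀ * Avg₁.size (cells π) x₀
          ≡⟨ Avg₁.weight*size (cells π) x₀ ⟩
        L ∎
      by-cases : ∑ vs (λ x → 𝟙 (π x ≟ c) * w x) ≡ 0 ⊎ (∃ λ x → 1 ≤ 𝟙 (π x ≟ c) * w x) →
                 ∑ vs (λ x → 𝟙 (π x ≟ c) * w x) ≤ L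
      by-cases (inj₁ eq)         = ≤-trans (≤-reflexive eq) z≤n
      by-cases (inj₂ (x₀ , pos)) = ≤-reflexive (nonempty x₀ (𝟙-pos (π x₀ ≟ c) (1≤*⇒1≤ˡ (𝟙 (π x₀ ≟ c)) (w x₀) pos)))

  discrete : Partition V
  discrete = record { _≟ᶜ_ = Fin._≟_ ; colour = id }

  ∑-δ-vs : ∀ x (k : V → ℕ) → ∑ vs (λ y → 𝟙 (x Fin.≟ y) * k y) ≡ k x
  ∑-δ-vs x = ∑-δ Fin._≟_ (allFin⁺ N) (∈-allFin x)

  -- Averaging over the cells of π in the first variable only does not decrease the energy,
  -- and the resulting energy counts pairs of edges with a common endpoint.
  energy-bound : ∀ M π (g : Kernel) a → (∀ x → π x < M) →
    (∀ x x′ → ∑ vs (λ y → g x y * g x′ y) ≤ 1 + 𝟙 (x Fin.≟ x′) * a) →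
    energy π g ≤ L * L * (N + M * a)
  energy-bound M π g a π< codegree = begin
    energy π g
      ≤⟨ Avg₂.energy-mono P (grid π) (uncurry g) (λ e → cong₂ _,_ (cong proj₁ e) (cong π (cong proj₂ e))) ⟩
    Avg₂.energy P (uncurry g)
      ≡⟨ Avg₂.energy-alt P (uncurry g) ⟩
    L * ∑ pairs (λ z → uncurry g z * Avg₂.avg P (uncurry g) z)
      ≡⟨ cong (L *_) (∑-product vs vs _) ⟩
    L * ∑ vs (λ x → ∑ vs (λ y → g x y * Avg₂.avg P (uncurry g) (x , y)))
      ≡⟨ cong (L *_) (∑-cong vs (λ x → ∑-cong vs (λ y → cong (g x y *_) (avg≡ x y)))) ⟩
    L * ∑ vs (λ x → ∑ vs (λ y → g x y * (w x * ∑ vs (λ x′ → s x x′ * g x′ y))))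
      ≡⟨ cong (L *_) (∑-cong vs regroup) ⟩
    L * ∑ vs (λ x → w x * ∑ vs (λ x′ → s x x′ * ∑ vs (λ y → g x y * g x′ y)))
      ≤⟨ *-monoʳ-≤ L (∑-mono vs (λ x → *-monoʳ-≤ (w x) (∑-mono vs (λ x′ → *-monoʳ-≤ (s x x′) (codegree x x′))))) ⟩
    L * ∑ vs (λ x → w x * ∑ vs (λ x′ → s x x′ * (1 + 𝟙 (x Fin.≟ x′) * a)))
      ≡⟨ cong (L *_) (∑-cong vs diagonal) ⟩
    L * ∑ vs (λ x → L + w x * a)
      ≡⟨ cong (L *_) (trans (∑-+ vs _ _) (cong₂ _+_ (trans (∑-const vs L) (cong (_* L) vs-length)) (∑-*ʳ vs w a))) ⟩
    L * (N * L + ∑ vs w * a)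
      ≤⟨ *-monoʳ-≤ L (+-monoʳ-≤ (N * L) (*-monoˡ-≤ a (weight-total M π π<))) ⟩
    L * (N * L + M * L * a)
      ≡⟨ eq₁ L N M a ⟩
    L * L * (N + M * a) ∎
    where
    open ≤-Reasoning
    P = cells π ⊠ discrete
    w = Avg₁.weight (cells π)
    s = same (cells π)
    eq₁ : ∀ L N M a → L * (N * L + M * L * a) ≡ L * L * (N + M * a)
    eq₁ = solve-∀
    collapse : ∀ x y (k : V × V → ℕ) → ∑ pairs (λ z → same P (x , y) z * k z) ≡ ∑ vs (λ x′ → s x x′ * k (x′ , y))
    collapse x y k = trans (∑-product vs vs _) (∑-cong vs (λ x′ → trans
      (∑-cong vs (λ y′ → trans (cong (_* k (x′ , y′)) (same-⊠ (cells π) discrete x y x′ y′))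
                               (*-assoc (s x x′) (𝟙 (y Fin.≟ y′)) (k (x′ , y′)))))
      (trans (∑-*ˡ vs (s x x′) _) (cong (s x x′ *_) (∑-δ-vs y (λ y′ → k (x′ , y′)))))))
    size≡ : ∀ x y → Avg₂.size P (x , y) ≡ Avg₁.size (cells π) x
    size≡ x y = trans (∑-cong pairs (λ z → sym (*-identityʳ _)))
      (trans (collapse x y (λ _ → 1)) (∑-cong vs (λ x′ → *-identityʳ _)))
    avg≡ : ∀ x y → Avg₂.avg P (uncurry g) (x , y) ≡ w x * ∑ vs (λ x′ → s x x′ * g x′ y)
    avg≡ x y = cong₂ _*_
      (Avg₂.weight-unique P (x , y) (w x) (trans (cong (w x *_) (size≡ x y)) (Avg₁.weight*size (cells π) x)))
      (collapse x y (uncurry g))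
    eq₂ : ∀ g w t → g * (w * t) ≡ w * (g * t)
    eq₂ = solve-∀
    eq₃ : ∀ g s t → g * (s * t) ≡ s * (g * t)
    eq₃ = solve-∀
    regroup : ∀ x → ∑ vs (λ y → g x y * (w x * ∑ vs (λ x′ → s x x′ * g x′ y)))
                  ≡ w x * ∑ vs (λ x′ → s x x′ * ∑ vs (λ y → g x y * g x′ y))
    regroup x = begin-equality
      ∑ vs (λ y → g x y * (w x * ∑ vs (λ x′ → s x x′ * g x′ y)))
        ≡⟨ trans (∑-cong vs (λ y → eq₂ (g x y) (w x) _)) (∑-*ˡ vs (w x) _) ⟩
      w x * ∑ vs (λ y → g x y * ∑ vs (λ x′ → s x x′ * g x′ y))
        ≡⟨ cong (w x *_) (∑-cong vs (λ y → trans (sym (∑-*ˡ vs (g x y) _)) (∑-cong vs (λ x′ → eq₃ (g x y) (s x x′) (g x′ y))))) ⟩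
      w x * ∑ vs (λ y → ∑ vs (λ x′ → s x x′ * (g x y * g x′ y)))
        ≡⟨ cong (w x *_) (trans (∑-swap vs vs _) (∑-cong vs (λ x′ → ∑-*ˡ vs (s x x′) _))) ⟩
      w x * ∑ vs (λ x′ → s x x′ * ∑ vs (λ y → g x y * g x′ y)) ∎
    eq₄ : ∀ s d a → s * (1 + d * a) ≡ s + d * (s * a)
    eq₄ = solve-∀
    -- The constant 1 sums to `L` over a cell of any size, so the number of cells matters only for
    -- the diagonal term, through the sum of the weights.
    diagonal : ∀ x → w x * ∑ vs (λ x′ → s x x′ * (1 + 𝟙 (x Fin.≟ x′) * a)) ≡ L + w x * a
    diagonal x = begin-equality
      w x * ∑ vs (λ x′ → s x x′ * (1 + 𝟙 (x Fin.≟ x′) * a))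
        ≡⟨ cong (w x *_) (trans (∑-cong vs (λ x′ → eq₄ (s x x′) (𝟙 (x Fin.≟ x′)) a)) (∑-+ vs _ _)) ⟩
      w x * (Avg₁.size (cells π) x + ∑ vs (λ x′ → 𝟙 (x Fin.≟ x′) * (s x x′ * a)))
        ≡⟨ cong (λ t → w x * (Avg₁.size (cells π) x + t)) (trans (∑-δ-vs x (λ x′ → s x x′ * a))
             (trans (cong (_* a) (𝟙-yes (π x ≟ π x) refl)) (*-identityˡ a))) ⟩
      w x * (Avg₁.size (cells π) x + a)
        ≡⟨ *-distribˡ-+ (w x) (Avg₁.size (cells π) x) a ⟩
      w x * Avg₁.size (cells π) x + w x * a
        ≡⟨ cong (_+ w x * a) (Avg₁.weight*size (cells π) x) ⟩
      L + w x * a ∎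

  -- π is the coarse and π′ the fine colouring; s = c N turns densities into multiples of the
  -- average density a / N.
  module Cleaning (a B c τ M : ℕ) (1≤N : 1 ≤ N) (1≤a : 1 ≤ a) (1≤c : 1 ≤ c) (1≤M : 1 ≤ M)
                  (π π′ : Fin N → ℕ) (π< : ∀ x → π x < M) where

    s La : ℕ
    s = c * N
    La = L * a

    1≤La : 1 ≤ La
    1≤La = *-mono-≤ L-pos 1≤a

    small : ℕ → V → ℕ
    small m x = 𝟙 (Avg₁.size (cells π) x * (M * m) <? N)

    -- A vertex in a small cell has weight at least L M m / N, while all weights together are at
    -- most M L.
    small-count : ∀ m → m * ∑ vs (small m) ≤ N
    small-count m = *-cancelˡ-≤ (L * M) {{m*n≢0 L M {{>-nonZero L-pos}} {{>-nonZero 1≤M}}}} (begin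
      L * M * (m * ∑ vs (small m))
        ≡⟨ eq₁ L M m (∑ vs (small m)) ⟩
      ∑ vs (small m) * (L * (M * m))
        ≡⟨ sym (∑-*ʳ vs (small m) _) ⟩
      ∑ vs (λ x → small m x * (L * (M * m)))
        ≤⟨ ∑-mono vs pointwise ⟩
      ∑ vs (λ x → w x * N)
        ≡⟨ ∑-*ʳ vs w N ⟩
      ∑ vs w * N
        ≤⟨ *-monoˡ-≤ N (weight-total M π π<) ⟩
      M * L * N
        ≡⟨ cong (_* N) (*-comm M L) ⟩
      L * M * N ∎)
      where
      open ≤-Reasoning
      w = Avg₁.weight (cells π)
      eq₁ : ∀ L M m x → L * M * (m * x) ≡ x * (L * (M * m))
      eq₁ = solve-∀
      pointwise : ∀ x → small m x * (L * (M * m)) ≤ w x * N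
      pointwise x = ≤-trans (𝟙-*-≤ (Avg₁.size (cells π) x * (M * m) <? N) (λ lt → begin
        L * (M * m)                                 ≡⟨ cong (_* (M * m)) (sym (Avg₁.weight*size (cells π) x)) ⟩
        w x * Avg₁.size (cells π) x * (M * m)       ≡⟨ *-assoc (w x) _ _ ⟩
        w x * (Avg₁.size (cells π) x * (M * m))     ≤⟨ *-monoʳ-≤ (w x) (<⇒≤ lt) ⟩
        w x * N                                     ∎))
        (𝟙-*≤ (Avg₁.size (cells π) x * (M * m) <? N) (w x * N))

    low : Kernel → V × V → ℕ
    low g z = 𝟙 (s * density π g z <? 2 * La)

    -- `low` is constant on cells, so the mass of g there is that of its average, which is below the
    -- threshold at every pair.
    low-mass : ∀ g → c * ∑ pairs (λ z → uncurry g z * low g z) ≤ 2 * (a * N)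
    low-mass g = *-cancelˡ-≤ (N * L) {{m*n≢0 N L {{>-nonZero 1≤N}} {{>-nonZero L-pos}}}} (begin
      N * L * (c * ∑ pairs (λ z → uncurry g z * low g z))
        ≡⟨ eq₁ N L c _ ⟩
      s * (L * ∑ pairs (λ z → uncurry g z * low g z))
        ≡⟨ cong (s *_) (sym (Avg₂.∑-avg (grid π) (uncurry g) (λ e → cong (λ d → 𝟙 (s * d <? 2 * La))
             (Avg₂.avg-measurable (grid π) (uncurry g) e)))) ⟩
      s * ∑ pairs (λ z → density π g z * low g z)
        ≡⟨ sym (∑-*ˡ pairs s _) ⟩
      ∑ pairs (λ z → s * (density π g z * low g z))
        ≤⟨ ∑-≤-const pairs pointwise ⟩
      length pairs * (2 * La)
        ≡⟨ cong (_* (2 * La)) pairs-length ⟩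
      N * N * (2 * (L * a))
        ≡⟨ eq₂ N L a ⟩
      N * L * (2 * (a * N)) ∎)
      where
      open ≤-Reasoning
      eq₁ : ∀ N L c x → N * L * (c * x) ≡ c * N * (L * x)
      eq₁ = solve-∀
      eq₂ : ∀ N L a → N * N * (2 * (L * a)) ≡ N * L * (2 * (a * N))
      eq₂ = solve-∀
      eq₃ : ∀ s d l → s * (d * l) ≡ l * (s * d)
      eq₃ = solve-∀
      pointwise : ∀ z → s * (density π g z * low g z) ≤ 2 * La
      pointwise z = ≤-trans (≤-reflexive (eq₃ s (density π g z) (low g z)))
        (≤-trans (𝟙-*-≤ (s * density π g z <? 2 * La) <⇒≤) (𝟙-*≤ (s * density π g z <? 2 * La) (2 * La)))

    -- The fine threshold is half of the one in `low`. A sparse pair inside a cell that is not low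
    -- thus has deviation at least La / s.
    sparse dense : Kernel → V × V → ℕ
    sparse g z = 𝟙 (s * density π′ g z <? La)
    dense g z = 𝟙 (La ≤? s * density π′ g z)

    irregular : Kernel → V × V → ℕ
    irregular g z = 𝟙 (2 * La ≤? s * density π g z) *
                    𝟙 (Avg₂.size (grid π) z <? 10 * Avg₂.cellSum (grid π) (sparse g) z)

    irregular-measurable : ∀ g → Measurable (grid π) (irregular g)
    irregular-measurable g e = cong₂ _*_
      (cong (λ d → 𝟙 (2 * La ≤? s * d)) (Avg₂.avg-measurable (grid π) (uncurry g) e))
      (cong₂ (λ m n → 𝟙 (m <? 10 * n)) (Avg₂.size-measurable (grid π) e) (Avg₂.cellSum-measurable (grid π) (sparse g) e))

    deviation : Kernel → V × V → ℕ
    deviation g z = Avg₂.deviation (grid π′) (grid π) (uncurry g) z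

    irregular-cell : ∀ g z → irregular g z * (La * La * Avg₂.size (grid π) z) ≤
                     10 * Avg₂.cellSum (grid π) (λ z′ → s * deviation g z′ * (s * deviation g z′)) z
    irregular-cell g z = by-cases (2 * La ≤? s * density π g z)
                                  (Avg₂.size (grid π) z <? 10 * Avg₂.cellSum (grid π) (sparse g) z)
      where
      open ≤-Reasoning
      D = density π g
      D′ = density π′ g
      sz = Avg₂.size (grid π) z
      cs = Avg₂.cellSum (grid π)
      sq : V × V → ℕ
      sq z′ = s * deviation g z′ * (s * deviation g z′)
      eq₁ : ∀ l x → l * (10 * x) ≡ 10 * (l * x)
      eq₁ = solve-∀
      eq₂ : ∀ l t x → l * (t * x) ≡ t * (x * l)
      eq₂ = solve-∀
      gap : 2 * La ≤ s * D z → ∀ z′ → _~_ (grid π) z z′ → s * D′ z′ < La → La ≤ s * deviation g z′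
      gap high z′ z~z′ lt = +-cancelˡ-≤ La _ _ (begin
        La + La                                ≡⟨ cong (La +_) (sym (+-identityʳ La)) ⟩
        2 * La                                 ≤⟨ high ⟩
        s * D z                                ≡⟨ cong (s *_) (Avg₂.avg-measurable (grid π) (uncurry g) z~z′) ⟩
        s * D z′                               ≤⟨ *-monoʳ-≤ s (m≤n+∣n-m∣ (D z′) (D′ z′)) ⟩
        s * (D′ z′ + ∣ D′ z′ - D z′ ∣)         ≡⟨ *-distribˡ-+ s (D′ z′) _ ⟩
        s * D′ z′ + s * deviation g z′         ≤⟨ +-monoˡ-≤ _ (<⇒≤ lt) ⟩
        La + s * deviation g z′                ∎)
      by-cases : (p : Dec (2 * La ≤ s * D z)) (r : Dec (sz < 10 * cs (sparse g) z)) →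
                 𝟙 p * 𝟙 r * (La * La * sz) ≤ 10 * cs sq z
      by-cases (no _)     r       = z≤n
      by-cases (yes _)    (no _)  = z≤n
      by-cases (yes high) (yes r) = begin
        1 * (La * La * sz)
          ≡⟨ *-identityˡ _ ⟩
        La * La * sz
          ≤⟨ *-monoʳ-≤ (La * La) (<⇒≤ r) ⟩
        La * La * (10 * cs (sparse g) z)
          ≡⟨ eq₁ (La * La) (cs (sparse g) z) ⟩
        10 * (La * La * cs (sparse g) z)
          ≡⟨ cong (10 *_) (sym (∑-*ˡ pairs (La * La) _)) ⟩
        10 * ∑ pairs (λ z′ → La * La * (same (grid π) z z′ * sparse g z′))
          ≤⟨ *-monoʳ-≤ 10 (∑-mono pairs (λ z′ → ≤-trans
               (≤-reflexive (eq₂ (La * La) (same (grid π) z z′) (sparse g z′)))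
               (𝟙-*-≤ (_~?_ (grid π) z z′) (λ z~z′ → ≤-trans
                 (𝟙-*-≤ (s * D′ z′ <? La) (λ lt → *-mono-≤ (gap high z′ z~z′ lt) (gap high z′ z~z′ lt)))
                 (𝟙-*≤ (s * D′ z′ <? La) (sq z′)))))) ⟩
        10 * cs sq z ∎

    module _ (g : Kernel)
             (stable : 10 * (τ * τ) * (c * c) * ∑ pairs (λ z → deviation g z * deviation g z) ≤ L * L * (a * a)) where

      -- Chebyshev's inequality: over a tenth of an irregular cell deviates by at least La / s, so
      -- the mean square deviation of the cell is large, whereas stability bounds the total.
      irregular-count : τ * τ * ∑ pairs (irregular g) ≤ N * N
      irregular-count = *-cancelˡ-≤ (10 * (c * c) * (L * (La * La)))
        {{>-nonZero (*-mono-≤ {1} {10 * (c * c)} (*-mono-≤ {1} {10} (s≤s z≤n) (*-mono-≤ 1≤c 1≤c))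
                              (*-mono-≤ L-pos (*-mono-≤ 1≤La 1≤La)))}} (begin
        10 * (c * c) * (L * (La * La)) * (τ * τ * I)
          ≡⟨ eq₁ c L (La * La) τ I ⟩
        p * (I * (La * La * L))
          ≡⟨ cong (p *_) (sym (∑-*ʳ pairs (irregular g) _)) ⟩
        p * ∑ pairs (λ z → irregular g z * (La * La * L))
          ≤⟨ *-monoʳ-≤ p (∑-mono pairs pointwise) ⟩
        p * ∑ pairs (λ z → 10 * Avg₂.avg (grid π) sq z)
          ≡⟨ cong (p *_) (trans (∑-*ˡ pairs 10 _) (cong (10 *_) (trans (Avg₂.∑-avg-total (grid π) sq)
               (cong (L *_) (trans (∑-cong pairs (λ z → eq₂ s (deviation g z))) (∑-*ˡ pairs (s * s) _)))))) ⟩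
        p * (10 * (L * (s * s * W)))
          ≡⟨ eq₃ p L s W ⟩
        10 * L * (s * s) * (p * W)
          ≤⟨ *-monoʳ-≤ (10 * L * (s * s)) stable ⟩
        10 * L * (s * s) * (L * L * (a * a))
          ≡⟨ eq₄ L c N a ⟩
        10 * (c * c) * (L * (La * La)) * (N * N) ∎)
        where
        open ≤-Reasoning
        I = ∑ pairs (irregular g)
        p = 10 * (τ * τ) * (c * c)
        W = ∑ pairs (λ z → deviation g z * deviation g z)
        sq : V × V → ℕ
        sq z = s * deviation g z * (s * deviation g z)
        eq₁ : ∀ c L l t I → 10 * (c * c) * (L * l) * (t * t * I) ≡ 10 * (t * t) * (c * c) * (I * (l * L))
        eq₁ = solve-∀
        eq₂ : ∀ s d → s * d * (s * d) ≡ s * s * (d * d)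
        eq₂ = solve-∀
        eq₃ : ∀ p L s W → p * (10 * (L * (s * s * W))) ≡ 10 * L * (s * s) * (p * W)
        eq₃ = solve-∀
        eq₄ : ∀ L c N a → 10 * L * (c * N * (c * N)) * (L * L * (a * a)) ≡ 10 * (c * c) * (L * (L * a * (L * a))) * (N * N)
        eq₄ = solve-∀
        eq₅ : ∀ i l w z → i * (l * (w * z)) ≡ w * (i * (l * z))
        eq₅ = solve-∀
        eq₆ : ∀ w x → w * (10 * x) ≡ 10 * (w * x)
        eq₆ = solve-∀
        pointwise : ∀ z → irregular g z * (La * La * L) ≤ 10 * Avg₂.avg (grid π) sq z
        pointwise z = begin
          irregular g z * (La * La * L)
            ≡⟨ cong (λ t → irregular g z * (La * La * t)) (sym (Avg₂.weight*size (grid π) z)) ⟩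
          irregular g z * (La * La * (Avg₂.weight (grid π) z * Avg₂.size (grid π) z))
            ≡⟨ eq₅ (irregular g z) (La * La) (Avg₂.weight (grid π) z) (Avg₂.size (grid π) z) ⟩
          Avg₂.weight (grid π) z * (irregular g z * (La * La * Avg₂.size (grid π) z))
            ≤⟨ *-monoʳ-≤ (Avg₂.weight (grid π) z) (irregular-cell g z) ⟩
          Avg₂.weight (grid π) z * (10 * Avg₂.cellSum (grid π) sq z)
            ≡⟨ eq₆ (Avg₂.weight (grid π) z) _ ⟩
          10 * Avg₂.avg (grid π) sq z ∎

      irregular≤1 : ∀ z → irregular g z ≤ 1
      irregular≤1 z = *-mono-≤ (𝟙≤1 (2 * La ≤? s * density π g z))
                               (𝟙≤1 (Avg₂.size (grid π) z <? 10 * Avg₂.cellSum (grid π) (sparse g) z))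

      -- The energy bound is an L² bound on the density, so few pairs carry little mass.
      irregular-mass : energy π g ≤ B * (L * L * (a * a)) →
                       τ * ∑ pairs (λ z → uncurry g z * irregular g z) ≤ (1 + B) * (a * N)
      irregular-mass bound = *-cancelˡ-≤ (L * La * N)
        {{>-nonZero (*-mono-≤ (*-mono-≤ L-pos 1≤La) 1≤N)}} (begin
        L * La * N * (τ * X)
          ≡⟨ eq₁ L La N τ X ⟩
        τ * La * N * (L * X)
          ≡⟨ cong (τ * La * N *_) (sym (Avg₂.∑-avg (grid π) (uncurry g) (irregular-measurable g))) ⟩
        τ * La * N * ∑ pairs (λ z → D z * irregular g z)
          ≡⟨ sym (∑-*ˡ pairs (τ * La * N) _) ⟩
        ∑ pairs (λ z → τ * La * N * (D z * irregular g z))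
          ≤⟨ ∑-mono pairs pointwise ⟩
        ∑ pairs (λ z → τ * La * (τ * La) * irregular g z + N * N * (D z * D z))
          ≡⟨ trans (∑-+ pairs _ _) (cong₂ _+_ (∑-*ˡ pairs (τ * La * (τ * La)) (irregular g)) (∑-*ˡ pairs (N * N) _)) ⟩
        τ * La * (τ * La) * I + N * N * energy π g
          ≤⟨ +-monoʳ-≤ _ (*-monoʳ-≤ (N * N) bound) ⟩
        τ * La * (τ * La) * I + N * N * (B * (L * L * (a * a)))
          ≡⟨ cong (_+ N * N * (B * (L * L * (a * a)))) (eq₂ τ La I) ⟩
        La * La * (τ * τ * I) + N * N * (B * (L * L * (a * a)))
          ≤⟨ +-monoˡ-≤ _ (*-monoʳ-≤ (La * La) irregular-count) ⟩
        La * La * (N * N) + N * N * (B * (L * L * (a * a)))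
          ≡⟨ eq₃ L a N B ⟩
        L * La * N * ((1 + B) * (a * N)) ∎)
        where
        open ≤-Reasoning
        I = ∑ pairs (irregular g)
        D = density π g
        X = ∑ pairs (λ z → uncurry g z * irregular g z)
        eq₁ : ∀ L l N t X → L * l * N * (t * X) ≡ t * l * N * (L * X)
        eq₁ = solve-∀
        eq₂ : ∀ t l I → t * l * (t * l) * I ≡ l * l * (t * t * I)
        eq₂ = solve-∀
        eq₃ : ∀ L a N B → L * a * (L * a) * (N * N) + N * N * (B * (L * L * (a * a))) ≡ L * (L * a) * N * ((1 + B) * (a * N))
        eq₃ = solve-∀
        eq₄ : ∀ t N d i → t * N * (d * i) ≡ i * (t * (N * d))
        eq₄ = solve-∀
        eq₅ : ∀ i t N d → i * (t * t + N * d * (N * d)) ≡ t * t * i + i * (N * N * (d * d))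
        eq₅ = solve-∀
        -- Used with x = τ La and y = N D in place of Cauchy-Schwarz: the count I then enters only
        -- through τ² I, and no square root arises.
        amgm : ∀ x y → x * y ≤ x * x + y * y
        amgm x y = ≤-trans (m≤n*m (x * y) 2) (2ab≤a²+b² x y)
        pointwise : ∀ z → τ * La * N * (D z * irregular g z) ≤ τ * La * (τ * La) * irregular g z + N * N * (D z * D z)
        pointwise z = begin
          τ * La * N * (D z * irregular g z)
            ≡⟨ eq₄ (τ * La) N (D z) (irregular g z) ⟩
          irregular g z * (τ * La * (N * D z))
            ≤⟨ *-monoʳ-≤ (irregular g z) (amgm (τ * La) (N * D z)) ⟩
          irregular g z * (τ * La * (τ * La) + N * D z * (N * D z))
            ≡⟨ eq₅ (irregular g z) (τ * La) N (D z) ⟩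
          τ * La * (τ * La) * irregular g z + irregular g z * (N * N * (D z * D z))
            ≤⟨ +-monoʳ-≤ _ (≤-trans (*-monoˡ-≤ _ (irregular≤1 z)) (≤-reflexive (*-identityˡ _))) ⟩
          τ * La * (τ * La) * irregular g z + N * N * (D z * D z) ∎

    cell : V → V → ℕ
    cell = same (cells π)

    denseBlock : Kernel → V → V → Kernel
    denseBlock g u v x y = full (cell u) (cell v) x y * dense g (x , y)

    denseBlock-dense : ∀ g u v x y → L * a * denseBlock g u v x y ≤ c * N * density π′ g (x , y)
    denseBlock-dense g u v x y = begin
      La * (cell u x * cell v y * dense g (x , y))
        ≤⟨ *-monoʳ-≤ La (*-monoˡ-≤ (dense g (x , y)) (*-mono-≤ (𝟙≤1 (π u ≟ π x)) (𝟙≤1 (π v ≟ π y)))) ⟩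
      La * (1 * dense g (x , y))
        ≡⟨ trans (cong (La *_) (*-identityˡ _)) (*-comm La _) ⟩
      dense g (x , y) * La
        ≤⟨ 𝟙-*-≤ (La ≤? s * density π′ g (x , y)) (λ le → le) ⟩
      dense g (x , y) * (s * density π′ g (x , y))
        ≤⟨ 𝟙-*≤ (La ≤? s * density π′ g (x , y)) _ ⟩
      s * density π′ g (x , y) ∎
      where open ≤-Reasoning

    denseBlock-almostFull : ∀ g u v → low g (u , v) ≡ 0 → irregular g (u , v) ≡ 0 →
                            AlmostFull (cell u) (cell v) (denseBlock g u v)
    denseBlock-almostFull g u v low≡0 irr≡0 = record
      { H         = λ x y → full (cell u) (cell v) x y * sparse g (x , y)
      ; partition = λ x y → sym (trans (sym (*-distribˡ-+ (full (cell u) (cell v) x y) _ _))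
          (trans (cong (full (cell u) (cell v) x y *_) (𝟙-≤-+-< La (s * density π′ g (x , y)))) (*-identityʳ _)))
      ; few       = begin
          10 * ∑ vs (λ x → ∑ vs (λ y → cell u x * cell v y * sparse g (x , y)))
            ≡⟨ cong (10 *_) (sym (trans (∑-pairs _) (∑-cong vs (λ x → ∑-cong vs (λ y →
                 cong (_* sparse g (x , y)) (same-⊠ (cells π) (cells π) u v x y)))))) ⟩
          10 * Avg₂.cellSum (grid π) (sparse g) (u , v)
            ≤⟨ ≮⇒≥ (𝟙≡0⇒¬ (Avg₂.size (grid π) (u , v) <? 10 * Avg₂.cellSum (grid π) (sparse g) (u , v)) irr′) ⟩
          Avg₂.size (grid π) (u , v)
            ≡⟨ trans (∑-pairs _) (trans (∑-cong vs (λ x → ∑-cong vs (λ y → same-⊠ (cells π) (cells π) u v x y)))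
                 (∑∑-* vs vs (cell u) (cell v))) ⟩
          ∑ vs (cell u) * ∑ vs (cell v) ∎
      }
      where
      open ≤-Reasoning
      bad : ℕ
      bad = 𝟙 (Avg₂.size (grid π) (u , v) <? 10 * Avg₂.cellSum (grid π) (sparse g) (u , v))
      irr′ : bad ≡ 0
      irr′ = trans (sym (*-identityˡ bad)) (trans (cong (_* bad) (sym (𝟙-yes (2 * La ≤? s * density π g (u , v))
        (≮⇒≥ (𝟙≡0⇒¬ (s * density π g (u , v) <? 2 * La) low≡0))))) irr≡0)

  -- The removal argument

  module Removal (a C K : ℕ) (1≤N : 1 ≤ N) (1≤a : 1 ≤ a) (1≤C : 1 ≤ C) (76≤K : 76 ≤ K) (N≤ : N ≤ C * (a * a)) where

    open Constants C K

    record Sparse (g : Kernel) : Set where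
      field
        row      : ∀ x → ∑ vs (g x) ≤ a
        codegree : ∀ x x′ → ∑ vs (λ y → g x y * g x′ y) ≤ 1 + 𝟙 (x Fin.≟ x′) * a

    open Sparse

    sparse-energy : ∀ {g} → Sparse g → ∀ M π → (∀ x → π x < M) → M ≤ a →
                    energy π g ≤ (C + 1) * (L * L * (a * a))
    sparse-energy {g} sp M π π< M≤a = begin
      energy π g                          ≤⟨ energy-bound M π g a π< (codegree sp) ⟩
      L * L * (N + M * a)                 ≤⟨ *-monoʳ-≤ (L * L) (+-mono-≤ N≤ (*-monoˡ-≤ a M≤a)) ⟩
      L * L * (C * (a * a) + a * a)       ≡⟨ eq (L * L) C (a * a) ⟩
      (C + 1) * (L * L * (a * a))         ∎
      where
      open ≤-Reasoning
      eq : ∀ l C b → l * (C * b + b) ≡ (C + 1) * (l * b)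
      eq = solve-∀

    -- The `covers` hypotheses are edge-disjointness in integrated form: in each of the five
    -- positions, a penalty G summed along the walks is at most its total over the edges.
    module _ (f h : Kernel) (sf : Sparse f) (sh : Sparse h) (two : ∀ x z → (f ⊙ f) x z ≤ 2)
             {W : Set} (ws : List W) (plenty : N * a ≤ 5 * length ws)
             (φ₀ φ₁ φ₂ φ₃ φ₄ : W → V)
             (covers₀ : ∀ (G : V × V → ℕ) → ∑ ws (λ w → G (φ₀ w , φ₁ w)) ≤ ∑ pairs (λ z → uncurry f z * G z))
             (covers₁ : ∀ (G : V × V → ℕ) → ∑ ws (λ w → G (φ₁ w , φ₂ w)) ≤ ∑ pairs (λ z → uncurry f z * G z))
             (covers₂ : ∀ (G : V × V → ℕ) → ∑ ws (λ w → G (φ₂ w , φ₃ w)) ≤ ∑ pairs (λ z → uncurry f z * G z))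
             (covers₃ : ∀ (G : V × V → ℕ) → ∑ ws (λ w → G (φ₃ w , φ₄ w)) ≤ ∑ pairs (λ z → uncurry f z * G z))
             (covers₄ : ∀ (G : V × V → ℕ) → ∑ ws (λ w → G (φ₄ w , φ₀ w)) ≤ ∑ pairs (λ z → uncurry h z * G z))
             where

      1≤K : 1 ≤ K
      1≤K = ≤-trans (s≤s z≤n) 76≤K

      1≤lowness : 1 ≤ lowness
      1≤lowness = *-mono-≤ {1} {2} (s≤s z≤n) 1≤K

      energies : ∀ M π → (∀ x → π x < M) → M ≤ a → energy π f + energy π h ≤ energyConstant * (L * L * (a * a))
      energies M π π< M≤a = ≤-trans (+-mono-≤ (sparse-energy sf M π π< M≤a) (sparse-energy sh M π π< M≤a))
        (≤-reflexive (eq C (L * L * (a * a))))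
        where
        eq : ∀ C u → (C + 1) * u + (C + 1) * u ≡ 2 * (C + 1) * u
        eq = solve-∀

      module R = Regularity a 1≤a 1≤N f h energyConstant energies

      module _ (M : ℕ) (π π′ : Colouring) (1≤M : 1 ≤ M) (π< : ∀ x → π x < M) (M≤a : M ≤ a) (ref : π′ ≼ π)
               (cutf : Cut a (precision M) π′ f) (cuth : Cut a (precision M) π′ h)
               (stable : stability * R.total π′ ≤ stability * R.total π + R.unit) where

        open Cleaning a energyConstant lowness tail M 1≤N 1≤a 1≤lowness 1≤M π π′ π<

        spread : Kernel → ℕ
        spread g = ∑ pairs (λ z → deviation g z * deviation g z)

        spread-sum : stability * (spread f + spread h) ≤ R.unit
        spread-sum = +-cancelˡ-≤ (stability * R.total π) _ _ (begin
          stability * R.total π + stability * (spread f + spread h)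
            ≡⟨ eq stability (energy π f) (energy π h) (spread f) (spread h) ⟩
          stability * (energy π f + spread f + (energy π h + spread h))
            ≡⟨ cong (stability *_) (cong₂ _+_ (sym (pyth f)) (sym (pyth h))) ⟩
          stability * R.total π′
            ≤⟨ stable ⟩
          stability * R.total π + R.unit ∎)
          where
          open ≤-Reasoning
          eq : ∀ s a b c d → s * (a + b) + s * (c + d) ≡ s * (a + c + (b + d))
          eq = solve-∀
          pyth : ∀ g → energy π′ g ≡ energy π g + spread g
          pyth g = Avg₂.energy-pythagoras (grid π′) (grid π) (uncurry g) (grid-refines {π′} {π} ref)

        -- The size of only the cell of the source is tested, since every vertex of a closed walk is
        -- the source of one of its edges.
        faulty : Kernel → V × V → ℕ
        faulty g z = small K (proj₁ z) + (low g z + irregular g z)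

        faulty-mass : ∀ g → Sparse g → stability * spread g ≤ R.unit →
                      K * ∑ pairs (λ z → uncurry g z * faulty g z) ≤ 3 * (a * N)
        faulty-mass g sp st = begin
          K * ∑ pairs (λ z → uncurry g z * faulty g z)
            ≡⟨ cong (K *_) split-sum ⟩
          K * (S + (X + Y))
            ≡⟨ eq₀ K S X Y ⟩
          K * S + (K * X + K * Y)
            ≤⟨ +-mono-≤ S≤ (+-mono-≤ X≤ Y≤) ⟩
          a * N + (a * N + a * N)
            ≡⟨ eq₁ (a * N) ⟩
          3 * (a * N) ∎
          where
          open ≤-Reasoning
          S = ∑ pairs (λ z → uncurry g z * small K (proj₁ z))
          X = ∑ pairs (λ z → uncurry g z * low g z)
          Y = ∑ pairs (λ z → uncurry g z * irregular g z)
          eq₀ : ∀ K S X Y → K * (S + (X + Y)) ≡ K * S + (K * X + K * Y)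
          eq₀ = solve-∀
          eq₁ : ∀ x → x + (x + x) ≡ 3 * x
          eq₁ = solve-∀
          eq₂ : ∀ g s l i → g * (s + (l + i)) ≡ g * s + (g * l + g * i)
          eq₂ = solve-∀
          split-sum : ∑ pairs (λ z → uncurry g z * faulty g z) ≡ S + (X + Y)
          split-sum = trans (∑-cong pairs (λ z → eq₂ (uncurry g z) (small K (proj₁ z)) (low g z) (irregular g z)))
            (trans (∑-+ pairs _ _) (cong (S +_) (∑-+ pairs _ _)))
          S≤ : K * S ≤ a * N
          S≤ = begin
            K * S
              ≡⟨ cong (K *_) (trans (∑-pairs _) (∑-cong vs (λ x → ∑-*ʳ vs (g x) (small K x)))) ⟩
            K * ∑ vs (λ x → ∑ vs (g x) * small K x)
              ≤⟨ *-monoʳ-≤ K (∑-mono vs (λ x → *-monoˡ-≤ (small K x) (row sp x))) ⟩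
            K * ∑ vs (λ x → a * small K x)
              ≡⟨ cong (K *_) (∑-*ˡ vs a (small K)) ⟩
            K * (a * ∑ vs (small K))
              ≡⟨ eq₃ K a (∑ vs (small K)) ⟩
            a * (K * ∑ vs (small K))
              ≤⟨ *-monoʳ-≤ a (small-count K) ⟩
            a * N ∎
            where
            eq₃ : ∀ K a x → K * (a * x) ≡ a * (K * x)
            eq₃ = solve-∀
          X≤ : K * X ≤ a * N
          X≤ = *-cancelˡ-≤ 2 (≤-trans (≤-reflexive (sym (*-assoc 2 K X))) (low-mass g))
          Y≤ : K * Y ≤ a * N
          Y≤ = *-cancelˡ-≤ (1 + energyConstant) (≤-trans (≤-reflexive (eq₃ K (1 + energyConstant) Y))
            (irregular-mass g st (≤-trans (sparse-energy sp M π π< M≤a)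
              (*-monoˡ-≤ (L * L * (a * a)) (m≤m+n (C + 1) (C + 1 + 0))))))
            where
            eq₃ : ∀ K E x → E * (K * x) ≡ K * E * x
            eq₃ = solve-∀

        fault : W → ℕ
        fault w = faulty f (φ₀ w , φ₁ w) + (faulty f (φ₁ w , φ₂ w) + (faulty f (φ₂ w , φ₃ w) +
                 (faulty f (φ₃ w , φ₄ w) + faulty h (φ₄ w , φ₀ w))))

        1≤plenty : 1 ≤ length ws
        1≤plenty = n≢0⇒n>0 λ eq → <⇒≱ (*-mono-≤ 1≤N 1≤a) (≤-trans plenty (≤-reflexive (cong (5 *_) eq)))

        -- Union bound: five edges and three kinds of fault cost 15 a N / K in all, and there are at
        -- least a N / 5 walks; hence K must exceed 75.
        fault-total : ∑ ws fault < length ws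
        fault-total = *-cancelˡ-< K _ _ (begin-strict
          K * ∑ ws fault
            ≡⟨ cong (K *_) (trans (∑-+ ws _ _) (cong (Φ₀ +_) (trans (∑-+ ws _ _) (cong (Φ₁ +_)
                 (trans (∑-+ ws _ _) (cong (Φ₂ +_) (∑-+ ws _ _))))))) ⟩
          K * (Φ₀ + (Φ₁ + (Φ₂ + (Φ₃ + Φ₄))))
            ≤⟨ *-monoʳ-≤ K (+-mono-≤ (covers₀ (faulty f)) (+-mono-≤ (covers₁ (faulty f)) (+-mono-≤ (covers₂ (faulty f))
                 (+-mono-≤ (covers₃ (faulty f)) (covers₄ (faulty h)))))) ⟩
          K * (X + (X + (X + (X + Y))))
            ≡⟨ eq₀ K X Y ⟩
          4 * (K * X) + K * Y
            ≤⟨ +-mono-≤ (*-monoʳ-≤ 4 (faulty-mass f sf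
                 (≤-trans (*-monoʳ-≤ stability (m≤m+n (spread f) (spread h))) spread-sum)))
               (faulty-mass h sh (≤-trans (*-monoʳ-≤ stability (m≤n+m (spread h) (spread f))) spread-sum)) ⟩
          4 * (3 * (a * N)) + 3 * (a * N)
            ≡⟨ eq₁ a N ⟩
          15 * (N * a)
            ≤⟨ *-monoʳ-≤ 15 plenty ⟩
          15 * (5 * length ws)
            ≡⟨ sym (*-assoc 15 5 (length ws)) ⟩
          75 * length ws
            <⟨ *-monoˡ-< (length ws) {{>-nonZero 1≤plenty}} 76≤K ⟩
          K * length ws ∎)
          where
          open ≤-Reasoning
          Φ₀ = ∑ ws (λ w → faulty f (φ₀ w , φ₁ w))
          Φ₁ = ∑ ws (λ w → faulty f (φ₁ w , φ₂ w))
          Φ₂ = ∑ ws (λ w → faulty f (φ₂ w , φ₃ w))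
          Φ₃ = ∑ ws (λ w → faulty f (φ₃ w , φ₄ w))
          Φ₄ = ∑ ws (λ w → faulty h (φ₄ w , φ₀ w))
          X = ∑ pairs (λ z → uncurry f z * faulty f z)
          Y = ∑ pairs (λ z → uncurry h z * faulty h z)
          eq₀ : ∀ K X Y → K * (X + (X + (X + (X + Y)))) ≡ 4 * (K * X) + K * Y
          eq₀ = solve-∀
          eq₁ : ∀ a N → 4 * (3 * (a * N)) + 3 * (a * N) ≡ 15 * (N * a)
          eq₁ = solve-∀

        good-walk : ∃ λ w → fault w ≡ 0
        good-walk = ∑-has-zero ws fault fault-total

        -- The cells visited by a faultless walk have at least N / (M K) vertices each and span
        -- almost full dense blocks. Their closed walks are carried over to the graph by
        -- `model-lower-bound`.
        many-cycles : ∀ w → fault w ≡ 0 → a ^ 5 ≤ 4 * ((M * K) ^ 5 * (lowness ^ 5 * cycle h f f f f))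
        many-cycles w z₀ = count-from-model (a ^ 5) (N ^ 5) ((M * K) ^ 5) (lowness ^ 5) (C * C) (cycle h f f f f)
            (cycle G₃ G₄ G₀ G₁ G₂)
            (m^n>0 N {{>-nonZero 1≤N}} 5) (m^n>0 (M * K) {{>-nonZero (*-mono-≤ 1≤M 1≤K)}} 5)
            (m^n>0 lowness {{>-nonZero 1≤lowness}} 5) (*-mono-≤ 1≤C 1≤C)
            (model-lower-bound a (precision M) C lowness π′ f h 1≤lowness 1≤C N≤ cutf cuth (row sf) two G₀ G₁ G₂ G₃ G₄
              (≤1 f v₀ v₁) (≤1 f v₁ v₂) (≤1 f v₂ v₃) (≤1 h v₄ v₀)
              (denseBlock-dense f v₀ v₁) (denseBlock-dense f v₁ v₂) (denseBlock-dense f v₂ v₃)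
              (denseBlock-dense f v₃ v₄) (denseBlock-dense h v₄ v₀))
            blocks
          where
          v₀ = φ₀ w
          v₁ = φ₁ w
          v₂ = φ₂ w
          v₃ = φ₃ w
          v₄ = φ₄ w
          G₀ = denseBlock f v₀ v₁
          G₁ = denseBlock f v₁ v₂
          G₂ = denseBlock f v₂ v₃
          G₃ = denseBlock f v₃ v₄
          G₄ = denseBlock h v₄ v₀
          ≤1 : ∀ g u v x y → denseBlock g u v x y ≤ 1
          ≤1 g u v x y = *-mono-≤ (*-mono-≤ (𝟙≤1 (π u ≟ π x)) (𝟙≤1 (π v ≟ π y))) (𝟙≤1 (L * a ≤? lowness * N * density π′ g (x , y)))
          cell≤1 : ∀ u x → cell u x ≤ 1
          cell≤1 u x = 𝟙≤1 (π u ≟ π x)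
          z₁ = m+n≡0⇒n≡0 (faulty f (v₀ , v₁)) z₀
          z₂ = m+n≡0⇒n≡0 (faulty f (v₁ , v₂)) z₁
          z₃ = m+n≡0⇒n≡0 (faulty f (v₂ , v₃)) z₂
          y₀ : faulty f (v₀ , v₁) ≡ 0
          y₀ = m+n≡0⇒m≡0 (faulty f (v₀ , v₁)) z₀
          y₁ : faulty f (v₁ , v₂) ≡ 0
          y₁ = m+n≡0⇒m≡0 (faulty f (v₁ , v₂)) z₁
          y₂ : faulty f (v₂ , v₃) ≡ 0
          y₂ = m+n≡0⇒m≡0 (faulty f (v₂ , v₃)) z₂
          y₃ : faulty f (v₃ , v₄) ≡ 0
          y₃ = m+n≡0⇒m≡0 (faulty f (v₃ , v₄)) z₃
          y₄ : faulty h (v₄ , v₀) ≡ 0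
          y₄ = m+n≡0⇒n≡0 (faulty f (v₃ , v₄)) z₃
          almost : ∀ g u v → faulty g (u , v) ≡ 0 → AlmostFull (cell u) (cell v) (denseBlock g u v)
          almost g u v eq = denseBlock-almostFull g u v (m+n≡0⇒m≡0 (low g (u , v)) eq′) (m+n≡0⇒n≡0 (low g (u , v)) eq′)
            where eq′ = m+n≡0⇒n≡0 (small K u) eq
          large : ∀ g u v → faulty g (u , v) ≡ 0 → N ≤ ∑ vs (cell u) * (M * K)
          large g u v eq = ≮⇒≥ (𝟙≡0⇒¬ (Avg₁.size (cells π) u * (M * K) <? N) (m+n≡0⇒m≡0 (small K u) eq))
          blocks : N ^ 5 ≤ 2 * ((M * K) ^ 5 * cycle G₃ G₄ G₀ G₁ G₂)
          blocks = begin
            N * (N * (N * (N * (N * 1))))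
              ≤⟨ *-mono-≤ (large f v₀ v₁ y₀) (*-mono-≤ (large f v₁ v₂ y₁) (*-mono-≤ (large f v₂ v₃ y₂)
                   (*-mono-≤ (large f v₃ v₄ y₃) (*-mono-≤ (large h v₄ v₀ y₄) (≤-refl {1}))))) ⟩
            _
              ≡⟨ eq₀ (M * K) (∑ vs (cell v₀)) (∑ vs (cell v₁)) (∑ vs (cell v₂)) (∑ vs (cell v₃)) (∑ vs (cell v₄)) ⟩
            (M * K) ^ 5 * (∑ vs (cell v₀) * (∑ vs (cell v₁) * (∑ vs (cell v₂) * (∑ vs (cell v₃) * ∑ vs (cell v₄)))))
              ≤⟨ *-monoʳ-≤ ((M * K) ^ 5) (cycle-almost-full (cell≤1 v₀) (cell≤1 v₁) (cell≤1 v₂) (cell≤1 v₃) (cell≤1 v₄)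
                   (almost f v₀ v₁ y₀) (almost f v₁ v₂ y₁) (almost f v₂ v₃ y₂) (almost f v₃ v₄ y₃) (almost h v₄ v₀ y₄)) ⟩
            (M * K) ^ 5 * (2 * cycle G₃ G₄ G₀ G₁ G₂)
              ≡⟨ eq₁ ((M * K) ^ 5) (cycle G₃ G₄ G₀ G₁ G₂) ⟩
            2 * ((M * K) ^ 5 * cycle G₃ G₄ G₀ G₁ G₂) ∎
            where
            open ≤-Reasoning
            eq₀ : ∀ m a b c d e → a * m * (b * m * (c * m * (d * m * (e * m * 1)))) ≡ (m * (m * (m * (m * (m * 1))))) * (a * (b * (c * (d * e))))
            eq₀ = solve-∀
            eq₁ : ∀ x t → x * (2 * t) ≡ 2 * (x * t)
            eq₁ = solve-∀

        -- By `N ≤ C * (a * a)` there are O(a⁴) closed walks, against order a⁵ from `many-cycles`;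
        -- the 80 inside `need` is 4 · 20.
        few-cycles-absurd : cycle h f f f f ≤ N * (20 * (a * a)) → need M ≤ a → ⊥
        few-cycles-absurd few need≤ = <⇒≱ need≤ (*-cancelʳ-≤ _ _ (a ^ 4) {{m^n≢0 a 4 {{>-nonZero 1≤a}}}} (begin
          a * a ^ 4
            ≤⟨ many-cycles (proj₁ good-walk) (proj₂ good-walk) ⟩
          4 * ((M * K) ^ 5 * (lowness ^ 5 * cycle h f f f f))
            ≤⟨ *-monoʳ-≤ 4 (*-monoʳ-≤ ((M * K) ^ 5) (*-monoʳ-≤ (lowness ^ 5) (≤-trans few (*-monoˡ-≤ (20 * (a * a)) N≤)))) ⟩
          4 * ((M * K) ^ 5 * (lowness ^ 5 * (C * (a * a) * (20 * (a * a)))))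
            ≡⟨ eq ((M * K) ^ 5) (lowness ^ 5) C a ⟩
          80 * ((M * K) ^ 5 * (lowness ^ 5 * C)) * a ^ 4 ∎))
          where
          open ≤-Reasoning
          eq : ∀ x y C a → 4 * (x * (y * (C * (a * a) * (20 * (a * a))))) ≡ 80 * (x * (y * C)) * (a * (a * (a * (a * 1))))
          eq = solve-∀

      removal : threshold ≤ a → cycle h f f f f ≤ N * (20 * (a * a)) → ⊥
      removal large few = R.regular-pair precision need stability (stability * energyConstant + 1) 1 (λ _ → 0) ≤-refl
        (λ _ → s≤s z≤n) large
        (begin-strict
          stability * (energyConstant * R.unit)
            <⟨ n<1+n _ ⟩
          1 + stability * (energyConstant * R.unit)
            ≤⟨ +-monoˡ-≤ _ R.1≤unit ⟩
          R.unit + stability * (energyConstant * R.unit)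
            ≡⟨ eq stability energyConstant R.unit ⟩
          (stability * energyConstant + 1) * R.unit
            ≤⟨ m≤n+m _ _ ⟩
          stability * R.total (λ _ → 0) + (stability * energyConstant + 1) * R.unit ∎)
        (λ M π π′ 1≤M π< M≤a ref need≤ cutf cuth stable →
          few-cycles-absurd M π π′ 1≤M π< M≤a ref cutf cuth stable few need≤)
        where
        open ≤-Reasoning
        eq : ∀ s e u → u + s * (e * u) ≡ (s * e + 1) * u
        eq = solve-∀

-- Multiplicities and push-forwards

𝟙-*-absorb : ∀ {P Q : Set} (d : Dec P) (e : Dec Q) → (P → Q) → 𝟙 d ≤ 𝟙 d * 𝟙 e
𝟙-*-absorb (yes p) e f = ≤-reflexive (sym (trans (*-identityˡ _) (𝟙-yes e (f p))))
𝟙-*-absorb (no _)  e f = z≤n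

∑-at-most-two : ∀ {A : Set} (_≟ᴬ_ : DecidableEquality A) (xs : List A) (f : A → ℕ) (swap : A → A) → Unique xs →
  (∀ x → f x ≤ 1) → (∀ x y → 1 ≤ f x → 1 ≤ f y → y ≡ x ⊎ y ≡ swap x) → ∑ xs f ≤ 2
∑-at-most-two _≟ᴬ_ xs f swap unique f≤1 hyp with ∑-zero-or-witness xs f
... | inj₁ eq        = ≤-trans (≤-reflexive eq) z≤n
... | inj₂ (x , pos) = begin
  ∑ xs f                                             ≤⟨ ∑-mono xs pointwise ⟩
  ∑ xs (λ y → 𝟙 (x ≟ᴬ y) + 𝟙 (swap x ≟ᴬ y))          ≡⟨ ∑-+ xs _ _ ⟩
  ∑ xs (λ y → 𝟙 (x ≟ᴬ y)) + ∑ xs (λ y → 𝟙 (swap x ≟ᴬ y))  ≤⟨ +-mono-≤ (∑-𝟙≤1 _≟ᴬ_ unique x) (∑-𝟙≤1 _≟ᴬ_ unique (swap x)) ⟩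
  2 ∎
  where
  open ≤-Reasoning
  pointwise : ∀ y → f y ≤ 𝟙 (x ≟ᴬ y) + 𝟙 (swap x ≟ᴬ y)
  pointwise y with f y in eq
  ... | zero  = z≤n
  ... | suc m with hyp x y pos (subst (1 ≤_) (sym eq) (s≤s z≤n))
  ... | inj₁ refl = ≤-trans (≤-trans (≤-reflexive (sym eq)) (f≤1 y)) (≤-trans (≤-reflexive (sym (𝟙-yes (y ≟ᴬ y) refl))) (m≤m+n _ _))
  ... | inj₂ e    = ≤-trans (≤-trans (≤-reflexive (sym eq)) (f≤1 y)) (≤-trans (≤-reflexive (sym (𝟙-yes (swap x ≟ᴬ y) (sym e)))) (m≤n+m _ _))

∑-push-forward : ∀ {W Z : Set} (_≟ᶻ_ : DecidableEquality Z) (ws : List W) (zs : List Z) → (∀ z → z ∈ zs) →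
  (ψ : W → Z) (F : Z → ℕ) → (∀ z → ∑ ws (λ w → 𝟙 (ψ w ≟ᶻ z)) ≤ F z) → ∀ (G : Z → ℕ) →
  ∑ ws (λ w → G (ψ w)) ≤ ∑ zs (λ z → F z * G z)
∑-push-forward _≟ᶻ_ ws zs complete ψ F mult G = begin
  ∑ ws (λ w → G (ψ w))
    ≤⟨ ∑-mono ws (λ w → ≤-trans (≤-reflexive (sym (trans (cong (_* G (ψ w)) (𝟙-yes (ψ w ≟ᶻ ψ w) refl)) (*-identityˡ _))))
         (∑-∈ (λ z → 𝟙 (ψ w ≟ᶻ z) * G z) (complete (ψ w)))) ⟩
  ∑ ws (λ w → ∑ zs (λ z → 𝟙 (ψ w ≟ᶻ z) * G z))
    ≡⟨ ∑-swap ws zs _ ⟩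
  ∑ zs (λ z → ∑ ws (λ w → 𝟙 (ψ w ≟ᶻ z) * G z))
    ≡⟨ ∑-cong zs (λ z → ∑-*ʳ ws _ (G z)) ⟩
  ∑ zs (λ z → ∑ ws (λ w → 𝟙 (ψ w ≟ᶻ z)) * G z)
    ≤⟨ ∑-mono zs (λ z → *-monoˡ-≤ (G z) (mult z)) ⟩
  ∑ zs (λ z → F z * G z) ∎
  where open ≤-Reasoning

-- Sums over quintuples

module Quintuples {A : Set} (_≟ᴬ_ : DecidableEquality A) (xs : List A) (unique : Unique xs) where

  ∑⁵ : (A → A → A → A → A → ℕ) → ℕ
  ∑⁵ g = ∑ xs λ i → ∑ xs λ j → ∑ xs λ k → ∑ xs λ l → ∑ xs λ m → g i j k l m

  swap₁₂ : ∀ g → ∑⁵ g ≡ ∑⁵ (λ j i k l m → g i j k l m)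
  swap₁₂ g = ∑-swap xs xs _

  swap₂₃ : ∀ g → ∑⁵ g ≡ ∑⁵ (λ i k j l m → g i j k l m)
  swap₂₃ g = ∑-cong xs λ i → ∑-swap xs xs _

  swap₃₄ : ∀ g → ∑⁵ g ≡ ∑⁵ (λ i j l k m → g i j k l m)
  swap₃₄ g = ∑-cong xs λ i → ∑-cong xs λ j → ∑-swap xs xs _

  swap₄₅ : ∀ g → ∑⁵ g ≡ ∑⁵ (λ i j k m l → g i j k l m)
  swap₄₅ g = ∑-cong xs λ i → ∑-cong xs λ j → ∑-cong xs λ k → ∑-swap xs xs _

  ∑⁵-mono : ∀ {f g} → (∀ i j k l m → f i j k l m ≤ g i j k l m) → ∑⁵ f ≤ ∑⁵ g
  ∑⁵-mono le = ∑-mono xs λ i → ∑-mono xs λ j → ∑-mono xs λ k → ∑-mono xs λ l → ∑-mono xs λ m → le i j k l m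

  ∑⁵-+ : ∀ f g → ∑⁵ (λ i j k l m → f i j k l m + g i j k l m) ≡ ∑⁵ f + ∑⁵ g
  ∑⁵-+ f g = trans (∑-cong xs λ i → trans (∑-cong xs λ j → trans (∑-cong xs λ k → trans (∑-cong xs λ l → ∑-+ xs _ _)
    (∑-+ xs _ _)) (∑-+ xs _ _)) (∑-+ xs _ _)) (∑-+ xs _ _)

  -- Only p and r are free: q equals p, and then at most two choices remain for s and t.
  diagonal-bound : ∀ (g : A → A → A → A → A → ℕ) → (∀ p q r → ∑ xs (λ s → ∑ xs (λ t → g p q r s t)) ≤ 2) →
    ∑⁵ (λ p q r s t → 𝟙 (p ≟ᴬ q) * g p q r s t) ≤ 2 * (length xs * length xs)
  diagonal-bound g le = begin
    ∑ xs (λ p → ∑ xs (λ q → ∑ xs (λ r → ∑ xs (λ s → ∑ xs (λ t → 𝟙 (p ≟ᴬ q) * g p q r s t)))))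
      ≡⟨ ∑-cong xs (λ p → ∑-cong xs (λ q → ∑-cong xs (λ r →
           trans (∑-cong xs (λ s → ∑-*ˡ xs (𝟙 (p ≟ᴬ q)) _)) (∑-*ˡ xs (𝟙 (p ≟ᴬ q)) _)))) ⟩
    ∑ xs (λ p → ∑ xs (λ q → ∑ xs (λ r → 𝟙 (p ≟ᴬ q) * ∑ xs (λ s → ∑ xs (λ t → g p q r s t)))))
      ≤⟨ ∑-mono xs (λ p → ∑-mono xs (λ q → ∑-≤-const xs (λ r → *-monoʳ-≤ (𝟙 (p ≟ᴬ q)) (le p q r)))) ⟩
    ∑ xs (λ p → ∑ xs (λ q → length xs * (𝟙 (p ≟ᴬ q) * 2)))
      ≡⟨ ∑-cong xs (λ p → trans (∑-cong xs (λ q → eq₁ (length xs) (𝟙 (p ≟ᴬ q)))) (∑-*ʳ xs _ (2 * length xs))) ⟩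
    ∑ xs (λ p → ∑ xs (λ q → 𝟙 (p ≟ᴬ q)) * (2 * length xs))
      ≤⟨ ∑-≤-const xs (λ p → *-monoˡ-≤ (2 * length xs) (∑-𝟙≤1 _≟ᴬ_ unique p)) ⟩
    length xs * (1 * (2 * length xs))
      ≡⟨ eq₂ (length xs) ⟩
    2 * (length xs * length xs) ∎
    where
    open ≤-Reasoning
    eq₁ : ∀ n x → n * (x * 2) ≡ x * (2 * n)
    eq₁ = solve-∀
    eq₂ : ∀ n → n * (1 * (2 * n)) ≡ 2 * (n * n)
    eq₂ = solve-∀

-- The graph of a Sidon set

module SidonKernels (n a : ℕ) (α : Fin a → ℕ) (α≤n : ∀ i → α i ≤ n)
  (sidon : ∀ i j k l → α i + α j ≡ α k + α l → (i ≡ k × j ≡ l) ⊎ (i ≡ l × j ≡ k)) where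

  N : ℕ
  N = 5 * n

  open Vertices N

  as : List (Fin a)
  as = allFin a

  as-length : length as ≡ a
  as-length = length-tabulate {n = a} id

  -- Edges from u to u + β i - γ i. Splitting the step into two natural numbers lets one definition
  -- cover forward and backward edges.
  difference : (β γ : Fin a → ℕ) → Kernel
  difference β γ u v = ∑ as (λ i → 𝟙 (toℕ u + β i ≟ toℕ v + γ i))

  forward backward : Kernel
  forward  = difference α (λ _ → 0)
  backward = difference (λ _ → 0) (λ i → 4 * α i)

  -- For δ = β - γ the equation reads δ i - δ k = δ i′ - δ k′: a nonzero difference determines its
  -- two terms.
  SidonLike : (β γ : Fin a → ℕ) → Set
  SidonLike β γ = ∀ i k i′ k′ → β i + γ k + (β k′ + γ i′) ≡ β k + γ i + (β i′ + γ k′) → i ≡ k ⊎ (i ≡ i′ × k ≡ k′)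

  forward-sidonLike : SidonLike α (λ _ → 0)
  forward-sidonLike i k i′ k′ eq with sidon i k′ k i′ (trans (eq₁ (α i) (α k′)) (trans eq (sym (eq₁ (α k) (α i′)))))
    where
    eq₁ : ∀ x y → x + y ≡ x + 0 + (y + 0)
    eq₁ = solve-∀
  ... | inj₁ (i≡k , _)     = inj₁ i≡k
  ... | inj₂ (i≡i′ , k′≡k) = inj₂ (i≡i′ , sym k′≡k)

  backward-sidonLike : SidonLike (λ _ → 0) (λ i → 4 * α i)
  backward-sidonLike i k i′ k′ eq with sidon k i′ i k′ (*-cancelˡ-≡ _ _ 4 (trans (*-distribˡ-+ 4 (α k) (α i′))
      (trans eq (sym (*-distribˡ-+ 4 (α i) (α k′))))))
  ... | inj₁ (k≡i , _)     = inj₁ (sym k≡i)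
  ... | inj₂ (k≡k′ , i′≡i) = inj₂ (sym i′≡i , k≡k′)

  vs-unique : Unique vs
  vs-unique = allFin⁺ N

  endpoint : ∀ m c → ∑ vs (λ v → 𝟙 (m ≟ toℕ v + c)) ≤ 1
  endpoint m c = ∑-at-most-one _ vs-unique (λ v → 𝟙≤1 (m ≟ toℕ v + c)) λ v w p q →
    toℕ-injective (+-cancelʳ-≡ c _ _ (trans (sym (𝟙-pos (m ≟ toℕ v + c) p)) (𝟙-pos (m ≟ toℕ w + c) q)))

  difference-row : ∀ β γ u → ∑ vs (difference β γ u) ≤ a
  difference-row β γ u = begin
    ∑ vs (λ v → ∑ as (λ i → 𝟙 (toℕ u + β i ≟ toℕ v + γ i)))  ≡⟨ ∑-swap vs as _ ⟩
    ∑ as (λ i → ∑ vs (λ v → 𝟙 (toℕ u + β i ≟ toℕ v + γ i)))  ≤⟨ ∑-≤-const as (λ i → endpoint (toℕ u + β i) (γ i)) ⟩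
    length as * 1                                            ≡⟨ trans (*-identityʳ _) as-length ⟩
    a ∎
    where open ≤-Reasoning

  common-neighbour : ∀ β γ x x′ → ∑ vs (λ y → difference β γ x y * difference β γ x′ y) ≡
    ∑ (cartesianProduct vs (cartesianProduct as as)) (λ t →
      𝟙 (toℕ x + β (proj₁ (proj₂ t)) ≟ toℕ (proj₁ t) + γ (proj₁ (proj₂ t))) *
      𝟙 (toℕ x′ + β (proj₂ (proj₂ t)) ≟ toℕ (proj₁ t) + γ (proj₂ (proj₂ t))))
  common-neighbour β γ x x′ = sym (trans (∑-product vs (cartesianProduct as as) _)
    (∑-cong vs (λ y → trans (∑-product as as _) (∑∑-* as as _ _))))

  -- For x = x′ the graph has no multiple edges, so the row bound applies. For x ≠ x′ a common
  -- neighbour reached by labels i and k satisfies δ i - δ k = x′ - x with δ = β - γ; this fixes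
  -- both labels and hence the neighbour.
  difference-codegree : ∀ β γ → SidonLike β γ → ∀ x x′ →
    ∑ vs (λ y → difference β γ x y * difference β γ x′ y) ≤ 1 + 𝟙 (x Fin.≟ x′) * a
  difference-codegree β γ sl x x′ with x Fin.≟ x′
  ... | yes refl = begin
    ∑ vs (λ y → difference β γ x y * difference β γ x y)
      ≡⟨ ∑-cong vs (λ y → sym (∑-*ˡ as (difference β γ x y) _)) ⟩
    ∑ vs (λ y → ∑ as (λ k → difference β γ x y * E k y))
      ≤⟨ ∑-mono vs (λ y → ∑-mono as (λ k → single y k)) ⟩
    ∑ vs (difference β γ x)
      ≤⟨ difference-row β γ x ⟩
    a
      ≤⟨ ≤-trans (≤-reflexive (sym (*-identityˡ a))) (m≤n+m _ 1) ⟩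
    1 + 1 * a ∎
    where
    open ≤-Reasoning
    E : Fin a → V → ℕ
    E k y = 𝟙 (toℕ x + β k ≟ toℕ y + γ k)
    rearrange : ∀ p q b c b′ c′ → p + b ≡ q + c → p + b′ ≡ q + c′ → b + c′ ≡ b′ + c
    rearrange p q b c b′ c′ e e′ = +-cancelˡ-≡ (p + q) _ _
      (trans (eq₁ p q b c′) (trans (cong₂ _+_ e (sym e′)) (eq₂ q c p b′)))
      where
      eq₁ : ∀ p q b c′ → p + q + (b + c′) ≡ (p + b) + (q + c′)
      eq₁ = solve-∀
      eq₂ : ∀ q c p b′ → (q + c) + (p + b′) ≡ p + q + (b′ + c)
      eq₂ = solve-∀
    only : ∀ y i k → 1 ≤ E i y → 1 ≤ E k y → i ≡ k
    -- Two labels on the same edge have δ i = δ k, so the difference taken in either order is the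
    -- same, and both alternatives of `SidonLike` give i = k.
    only y i k p q with sl i k k i (cong₂ _+_ r r)
      where
      r = rearrange (toℕ x) (toℕ y) (β i) (γ i) (β k) (γ k)
            (𝟙-pos (toℕ x + β i ≟ toℕ y + γ i) p) (𝟙-pos (toℕ x + β k ≟ toℕ y + γ k) q)
    ... | inj₁ e       = e
    ... | inj₂ (e , _) = e
    single : ∀ y k → difference β γ x y * E k y ≤ E k y
    single y k = ≤-trans (*-monoˡ-≤ (E k y) (∑-at-most-one (λ i → E i y) (allFin⁺ a)
      (λ i → 𝟙≤1 (toℕ x + β i ≟ toℕ y + γ i)) (only y))) (≤-reflexive (*-identityˡ _))
  ... | no x≢x′ = ≤-trans (≤-reflexive (common-neighbour β γ x x′))
    (∑-at-most-one _ (cartesianProduct⁺ vs-unique (cartesianProduct⁺ (allFin⁺ a) (allFin⁺ a)))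
      (λ t → *-mono-≤ (𝟙≤1 (d x t (proj₁ (proj₂ t)))) (𝟙≤1 (d x′ t (proj₂ (proj₂ t))))) unique)
    where
    T = V × (Fin a × Fin a)
    d : ∀ u (t : T) i → Dec (toℕ u + β i ≡ toℕ (proj₁ t) + γ i)
    d u t i = toℕ u + β i ≟ toℕ (proj₁ t) + γ i
    cross : ∀ p q y b c b′ c′ → p + b ≡ y + c → q + b′ ≡ y + c′ → p + (b + c′) ≡ q + (b′ + c)
    cross p q y b c b′ c′ e e′ = trans (sym (+-assoc p b c′)) (trans (cong (_+ c′) e)
      (trans (eq₁ y c c′) (trans (cong (_+ c) (sym e′)) (+-assoc q b′ c))))
      where
      eq₁ : ∀ y c c′ → y + c + c′ ≡ y + c′ + c
      eq₁ = solve-∀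
    combine : ∀ p q s t s′ t′ → p + s ≡ q + t → p + s′ ≡ q + t′ → s + t′ ≡ t + s′
    combine p q s t s′ t′ e e′ = +-cancelˡ-≡ (p + q) _ _
      (trans (eq₁ p q s t′) (trans (cong₂ _+_ e (sym e′)) (eq₂ q t p s′)))
      where
      eq₁ : ∀ p q b c′ → p + q + (b + c′) ≡ (p + b) + (q + c′)
      eq₁ = solve-∀
      eq₂ : ∀ q c p b′ → (q + c) + (p + b′) ≡ p + q + (c + b′)
      eq₂ = solve-∀
    unique : ∀ t t′ → 1 ≤ 𝟙 (d x t (proj₁ (proj₂ t))) * 𝟙 (d x′ t (proj₂ (proj₂ t))) →
             1 ≤ 𝟙 (d x t′ (proj₁ (proj₂ t′))) * 𝟙 (d x′ t′ (proj₂ (proj₂ t′))) → t ≡ t′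
    unique t@(y , i , k) t′@(y′ , i′ , k′) pos pos′ = conclude (sl i k i′ k′ (combine (toℕ x) (toℕ x′) _ _ _ _ c c′))
      where
      e₁ = 𝟙-pos (d x t i) (1≤*⇒1≤ˡ (𝟙 (d x t i)) (𝟙 (d x′ t k)) pos)
      e₂ = 𝟙-pos (d x′ t k) (1≤*⇒1≤ʳ (𝟙 (d x t i)) (𝟙 (d x′ t k)) pos)
      e₃ = 𝟙-pos (d x t′ i′) (1≤*⇒1≤ˡ (𝟙 (d x t′ i′)) (𝟙 (d x′ t′ k′)) pos′)
      e₄ = 𝟙-pos (d x′ t′ k′) (1≤*⇒1≤ʳ (𝟙 (d x t′ i′)) (𝟙 (d x′ t′ k′)) pos′)
      c = cross (toℕ x) (toℕ x′) (toℕ y) (β i) (γ i) (β k) (γ k) e₁ e₂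
      c′ = cross (toℕ x) (toℕ x′) (toℕ y′) (β i′) (γ i′) (β k′) (γ k′) e₃ e₄
      conclude : i ≡ k ⊎ (i ≡ i′ × k ≡ k′) → t ≡ t′
      conclude (inj₁ refl) = ⊥-elim (x≢x′ (toℕ-injective (+-cancelʳ-≡ (β i) _ _ (trans e₁ (sym e₂)))))
      conclude (inj₂ (refl , refl)) = cong (λ v → v , i , k) (toℕ-injective (+-cancelʳ-≡ (γ i) _ _ (trans (sym e₁) e₃)))

  -- The Sidon property: a sum of two elements determines them up to order. The expression e is left
  -- abstract because the two summands occur at various places of a longer sum.
  pair-sums : ∀ c d (e : Fin a → Fin a → ℕ) → (∀ i k → e i k ≡ c + (α i + α k)) →
              ∑ as (λ i → ∑ as (λ k → 𝟙 (e i k ≟ d))) ≤ 2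
  pair-sums c d e e≡ = ≤-trans (≤-reflexive (sym (∑-product as as (λ t → 𝟙 (uncurry e t ≟ d)))))
    (∑-at-most-two (≡-dec Fin._≟_ Fin._≟_) _ _ (λ t → proj₂ t , proj₁ t) (cartesianProduct⁺ (allFin⁺ a) (allFin⁺ a))
      (λ t → 𝟙≤1 (uncurry e t ≟ d)) same-or-swapped)
    where
    same-or-swapped : ∀ t t′ → 1 ≤ 𝟙 (uncurry e t ≟ d) → 1 ≤ 𝟙 (uncurry e t′ ≟ d) → t′ ≡ t ⊎ t′ ≡ (proj₂ t , proj₁ t)
    same-or-swapped (i , k) (i′ , k′) p q with sidon i′ k′ i k (+-cancelˡ-≡ c _ _
        (trans (sym (e≡ i′ k′)) (trans (𝟙-pos (e i′ k′ ≟ d) q) (trans (sym (𝟙-pos (e i k ≟ d) p)) (e≡ i k)))))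
    ... | inj₁ (refl , refl) = inj₁ refl
    ... | inj₂ (refl , refl) = inj₂ refl

  -- The form of the right side makes `forward` an instance by definition; products of translations
  -- are again of this kind, with tuples as labels.
  shift : {T : Set} → List T → (T → ℕ) → Kernel
  shift ts b x z = ∑ ts (λ t → 𝟙 (toℕ x + b t ≟ toℕ z + 0))

  -- The start and the first label determine the intermediate vertex. Only an inequality holds,
  -- since that vertex may fall outside the range.
  shift-⊙ : ∀ {T T′ : Set} (ts : List T) b (ts′ : List T′) b′ (X : Kernel) → (∀ y z → X y z ≤ shift ts′ b′ y z) → ∀ x z →
            (shift ts b ⊙ X) x z ≤ shift (cartesianProduct ts ts′) (λ t → b (proj₁ t) + b′ (proj₂ t)) x z
  shift-⊙ ts b ts′ b′ X X≤ x z = begin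
    ∑ vs (λ y → shift ts b x y * X y z)
      ≤⟨ ∑-mono vs (λ y → *-monoʳ-≤ (shift ts b x y) (X≤ y z)) ⟩
    ∑ vs (λ y → shift ts b x y * shift ts′ b′ y z)
      ≡⟨ ∑-cong vs (λ y → sym (∑∑-* ts ts′ _ _)) ⟩
    ∑ vs (λ y → ∑ ts (λ t → ∑ ts′ (λ t′ → p t y * r t′ y)))
      ≡⟨ trans (∑-swap vs ts _) (∑-cong ts (λ t → ∑-swap vs ts′ _)) ⟩
    ∑ ts (λ t → ∑ ts′ (λ t′ → ∑ vs (λ y → p t y * r t′ y)))
      ≤⟨ ∑-mono ts (λ t → ∑-mono ts′ (λ t′ → through t t′)) ⟩
    ∑ ts (λ t → ∑ ts′ (λ t′ → 𝟙 (toℕ x + (b t + b′ t′) ≟ toℕ z + 0)))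
      ≡⟨ sym (∑-product ts ts′ _) ⟩
    shift (cartesianProduct ts ts′) (λ t → b (proj₁ t) + b′ (proj₂ t)) x z ∎
    where
    open ≤-Reasoning
    p : _ → V → ℕ
    p t y = 𝟙 (toℕ x + b t ≟ toℕ y + 0)
    r : _ → V → ℕ
    r t′ y = 𝟙 (toℕ y + b′ t′ ≟ toℕ z + 0)
    through : ∀ t t′ → ∑ vs (λ y → p t y * r t′ y) ≤ 𝟙 (toℕ x + (b t + b′ t′) ≟ toℕ z + 0)
    through t t′ = begin
      ∑ vs (λ y → p t y * r t′ y)
        ≤⟨ ∑-mono vs (λ y → 𝟙-*-≤ (toℕ x + b t ≟ toℕ y + 0) (λ e →
             𝟙-mono (toℕ y + b′ t′ ≟ toℕ z + 0) c (λ e′ → trans (sym (+-assoc (toℕ x) (b t) (b′ t′)))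
               (trans (cong (_+ b′ t′) (trans e (+-identityʳ (toℕ y)))) e′)))) ⟩
      ∑ vs (λ y → p t y * 𝟙 c)
        ≡⟨ ∑-*ʳ vs (p t) (𝟙 c) ⟩
      ∑ vs (p t) * 𝟙 c
        ≤⟨ *-monoˡ-≤ (𝟙 c) (endpoint (toℕ x + b t) 0) ⟩
      1 * 𝟙 c
        ≡⟨ *-identityˡ _ ⟩
      𝟙 c ∎
      where c = toℕ x + (b t + b′ t′) ≟ toℕ z + 0

  forward-two-step : ∀ x z → (forward ⊙ forward) x z ≤ 2
  forward-two-step x z = ≤-trans (shift-⊙ as α as α forward (λ _ _ → ≤-refl) x z)
    (≤-trans (≤-reflexive (∑-product as as _)) (pair-sums (toℕ x) (toℕ z + 0) (λ i k → toℕ x + (α i + α k)) (λ _ _ → refl)))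

  open Quintuples Fin._≟_ as (allFin⁺ a)

  solution : Fin a → Fin a → Fin a → Fin a → Fin a → ℕ
  solution i j k l m = 𝟙 (α j + (α k + (α l + α m)) ≟ 4 * α i)

  -- A closed walk is determined by its start and its labels, and closing up forces the labels to
  -- solve the equation.
  cycle≤solutions : cycle backward forward forward forward forward ≤ N * ∑⁵ solution
  cycle≤solutions = begin
    ⟨ backward , forward ⊙ forward ⊙ forward ⊙ forward ⟩
      ≤⟨ ∑-mono vs (λ x → ∑-mono vs (λ y → *-monoʳ-≤ (backward x y)
           (shift-⊙ as α q³ β³ _ (shift-⊙ as α q² β² _ (shift-⊙ as α as α _ (λ _ _ → ≤-refl))) y x))) ⟩
    ∑ vs (λ x → ∑ vs (λ y → backward x y * shift q⁴ β⁴ y x))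
      ≤⟨ ∑-≤-const vs at-vertex ⟩
    length vs * ∑ as (λ i → ∑ q⁴ (λ t → 𝟙 (β⁴ t ≟ 4 * α i)))
      ≡⟨ cong₂ _*_ vs-length (∑-cong as (λ i → trans (∑-product as q³ _) (∑-cong as (λ j →
           trans (∑-product as q² _) (∑-cong as (λ k → ∑-product as as _)))))) ⟩
    N * ∑⁵ solution ∎
    where
    open ≤-Reasoning
    q² = cartesianProduct as as
    q³ = cartesianProduct as q²
    q⁴ = cartesianProduct as q³
    β² : Fin a × Fin a → ℕ
    β² t = α (proj₁ t) + α (proj₂ t)
    β³ : Fin a × Fin a × Fin a → ℕ
    β³ t = α (proj₁ t) + β² (proj₂ t)
    β⁴ : Fin a × Fin a × Fin a × Fin a → ℕ
    β⁴ t = α (proj₁ t) + β³ (proj₂ t)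
    at-vertex : ∀ x → ∑ vs (λ y → backward x y * shift q⁴ β⁴ y x) ≤ ∑ as (λ i → ∑ q⁴ (λ t → 𝟙 (β⁴ t ≟ 4 * α i)))
    at-vertex x = begin
      ∑ vs (λ y → backward x y * shift q⁴ β⁴ y x)
        ≡⟨ ∑-cong vs (λ y → sym (∑∑-* as q⁴ _ _)) ⟩
      ∑ vs (λ y → ∑ as (λ i → ∑ q⁴ (λ t → p i y * r t y)))
        ≡⟨ trans (∑-swap vs as _) (∑-cong as (λ i → ∑-swap vs q⁴ _)) ⟩
      ∑ as (λ i → ∑ q⁴ (λ t → ∑ vs (λ y → p i y * r t y)))
        ≤⟨ ∑-mono as (λ i → ∑-mono q⁴ (λ t → closed i t)) ⟩
      ∑ as (λ i → ∑ q⁴ (λ t → 𝟙 (β⁴ t ≟ 4 * α i))) ∎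
      where
      p : Fin a → V → ℕ
      p i y = 𝟙 (toℕ x + 0 ≟ toℕ y + 4 * α i)
      r : Fin a × Fin a × Fin a × Fin a → V → ℕ
      r t y = 𝟙 (toℕ y + β⁴ t ≟ toℕ x + 0)
      closed : ∀ i t → ∑ vs (λ y → p i y * r t y) ≤ 𝟙 (β⁴ t ≟ 4 * α i)
      closed i t = begin
        ∑ vs (λ y → p i y * r t y)
          ≤⟨ ∑-mono vs (λ y → 𝟙-*-≤ (toℕ x + 0 ≟ toℕ y + 4 * α i) (λ e →
               𝟙-mono (toℕ y + β⁴ t ≟ toℕ x + 0) (β⁴ t ≟ 4 * α i) (λ e′ → +-cancelˡ-≡ (toℕ y) _ _ (trans e′ e)))) ⟩
        ∑ vs (λ y → p i y * 𝟙 (β⁴ t ≟ 4 * α i))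
          ≡⟨ ∑-*ʳ vs (p i) _ ⟩
        ∑ vs (p i) * 𝟙 (β⁴ t ≟ 4 * α i)
          ≤⟨ *-monoˡ-≤ (𝟙 (β⁴ t ≟ 4 * α i)) (endpoint (toℕ x + 0) (4 * α i)) ⟩
        1 * 𝟙 (β⁴ t ≟ 4 * α i)
          ≡⟨ *-identityˡ _ ⟩
        𝟙 (β⁴ t ≟ 4 * α i) ∎

  module SolutionFree
    (solution-free : ∀ i j k l m → j ≢ k → j ≢ l → j ≢ m → j ≢ i → k ≢ l → k ≢ m → k ≢ i → l ≢ m → l ≢ i → m ≢ i →
                     α j + (α k + (α l + α m)) ≢ 4 * α i) where

    coincidences : Fin a → Fin a → Fin a → Fin a → Fin a → ℕ
    coincidences i j k l m =
      (i == j + (i == k + (i == l + (i == m + (j == k + (j == l + (j == m + (k == l + (k == m + l == m)))))))))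
      where
      infix 7 _==_
      _==_ : Fin a → Fin a → ℕ
      p == q = 𝟙 (p Fin.≟ q)

    solution-degenerate : ∀ i j k l m → solution i j k l m ≤ coincidences i j k l m * solution i j k l m
    solution-degenerate i j k l m with α j + (α k + (α l + α m)) ≟ 4 * α i
    ... | no _   = z≤n
    ... | yes eq = ≤-trans pos (≤-reflexive (sym (*-identityʳ _)))
      where
      ≢₀ : ∀ {x y : Fin a} → 𝟙 (x Fin.≟ y) ≡ 0 → x ≢ y
      ≢₀ {x} {y} = 𝟙≡0⇒¬ (x Fin.≟ y)
      pos : 1 ≤ coincidences i j k l m
      pos = n≢0⇒n>0 λ z₀ →
        let z₁ = m+n≡0⇒n≡0 (𝟙 (i Fin.≟ j)) z₀
            z₂ = m+n≡0⇒n≡0 (𝟙 (i Fin.≟ k)) z₁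
            z₃ = m+n≡0⇒n≡0 (𝟙 (i Fin.≟ l)) z₂
            z₄ = m+n≡0⇒n≡0 (𝟙 (i Fin.≟ m)) z₃
            z₅ = m+n≡0⇒n≡0 (𝟙 (j Fin.≟ k)) z₄
            z₆ = m+n≡0⇒n≡0 (𝟙 (j Fin.≟ l)) z₅
            z₇ = m+n≡0⇒n≡0 (𝟙 (j Fin.≟ m)) z₆
            z₈ = m+n≡0⇒n≡0 (𝟙 (k Fin.≟ l)) z₇
            z₉ = m+n≡0⇒n≡0 (𝟙 (k Fin.≟ m)) z₈
        in solution-free i j k l m
             (≢₀ (m+n≡0⇒m≡0 _ z₄)) (≢₀ (m+n≡0⇒m≡0 _ z₅)) (≢₀ (m+n≡0⇒m≡0 _ z₆)) (≢₀ (m+n≡0⇒m≡0 _ z₀) ∘ sym)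
             (≢₀ (m+n≡0⇒m≡0 _ z₇)) (≢₀ (m+n≡0⇒m≡0 _ z₈)) (≢₀ (m+n≡0⇒m≡0 _ z₁) ∘ sym)
             (≢₀ z₉) (≢₀ (m+n≡0⇒m≡0 _ z₂) ∘ sym) (≢₀ (m+n≡0⇒m≡0 _ z₃) ∘ sym) eq

    private
      lm : ∀ x y u v → x + (y + (u + v)) ≡ x + y + (u + v)
      lm = solve-∀
      km : ∀ x y u v → x + (u + (y + v)) ≡ x + y + (u + v)
      km = solve-∀
      kl : ∀ x y u v → x + (u + (v + y)) ≡ x + y + (u + v)
      kl = solve-∀
      jm : ∀ x y u v → u + (x + (y + v)) ≡ x + y + (u + v)
      jm = solve-∀
      jl : ∀ x y u v → u + (x + (v + y)) ≡ x + y + (u + v)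
      jl = solve-∀
      jk : ∀ x y u v → u + (v + (x + y)) ≡ x + y + (u + v)
      jk = solve-∀

      bound : ℕ
      bound = 2 * (length as * length as)

      via : ∀ {x y z : ℕ} → x ≡ y → y ≤ z → x ≤ z
      via refl le = le

      -- In this and the nine analogous bounds the free entry is chosen so that the two undetermined
      -- ones stand on the left of the equation, where `pair-sums` applies.
      c₁ : ∑⁵ (λ i j k l m → 𝟙 (i Fin.≟ j) * solution i j k l m) ≤ bound
      c₁ = diagonal-bound _ (λ i j k → pair-sums (α j + α k) (4 * α i) _ (λ l m → lm (α j) (α k) (α l) (α m)))

      c₂ : ∑⁵ (λ i j k l m → 𝟙 (i Fin.≟ k) * solution i j k l m) ≤ bound
      c₂ = via (swap₂₃ _) (diagonal-bound _ (λ i k j → pair-sums (α j + α k) (4 * α i) _ (λ l m → lm (α j) (α k) (α l) (α m))))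

      c₃ : ∑⁵ (λ i j k l m → 𝟙 (i Fin.≟ l) * solution i j k l m) ≤ bound
      c₃ = via (swap₃₄ _) (via (swap₂₃ _)
        (diagonal-bound _ (λ i l j → pair-sums (α j + α l) (4 * α i) _ (λ k m → km (α j) (α l) (α k) (α m)))))

      c₄ : ∑⁵ (λ i j k l m → 𝟙 (i Fin.≟ m) * solution i j k l m) ≤ bound
      c₄ = via (swap₄₅ _) (via (swap₃₄ _) (via (swap₂₃ _)
        (diagonal-bound _ (λ i m j → pair-sums (α j + α m) (4 * α i) _ (λ k l → kl (α j) (α m) (α k) (α l))))))

      c₅ : ∑⁵ (λ i j k l m → 𝟙 (j Fin.≟ k) * solution i j k l m) ≤ bound
      c₅ = via (swap₁₂ _) (via (swap₂₃ _)
        (diagonal-bound _ (λ j k i → pair-sums (α j + α k) (4 * α i) _ (λ l m → lm (α j) (α k) (α l) (α m)))))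

      c₆ : ∑⁵ (λ i j k l m → 𝟙 (j Fin.≟ l) * solution i j k l m) ≤ bound
      c₆ = via (swap₃₄ _) (via (swap₁₂ _) (via (swap₂₃ _)
        (diagonal-bound _ (λ j l i → pair-sums (α j + α l) (4 * α i) _ (λ k m → km (α j) (α l) (α k) (α m))))))

      c₇ : ∑⁵ (λ i j k l m → 𝟙 (j Fin.≟ m) * solution i j k l m) ≤ bound
      c₇ = via (swap₄₅ _) (via (swap₃₄ _) (via (swap₁₂ _) (via (swap₂₃ _)
        (diagonal-bound _ (λ j m i → pair-sums (α j + α m) (4 * α i) _ (λ k l → kl (α j) (α m) (α k) (α l)))))))

      c₈ : ∑⁵ (λ i j k l m → 𝟙 (k Fin.≟ l) * solution i j k l m) ≤ bound
      c₈ = via (swap₂₃ _) (via (swap₃₄ _) (via (swap₁₂ _) (via (swap₂₃ _)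
        (diagonal-bound _ (λ k l i → pair-sums (α k + α l) (4 * α i) _ (λ j m → jm (α k) (α l) (α j) (α m)))))))

      c₉ : ∑⁵ (λ i j k l m → 𝟙 (k Fin.≟ m) * solution i j k l m) ≤ bound
      c₉ = via (swap₄₅ _) (via (swap₂₃ _) (via (swap₃₄ _) (via (swap₁₂ _) (via (swap₂₃ _)
        (diagonal-bound _ (λ k m i → pair-sums (α k + α m) (4 * α i) _ (λ j l → jl (α k) (α m) (α j) (α l))))))))

      c₁₀ : ∑⁵ (λ i j k l m → 𝟙 (l Fin.≟ m) * solution i j k l m) ≤ bound
      c₁₀ = via (swap₃₄ _) (via (swap₂₃ _) (via (swap₄₅ _) (via (swap₃₄ _) (via (swap₁₂ _) (via (swap₂₃ _)
        (diagonal-bound _ (λ l m i → pair-sums (α l + α m) (4 * α i) _ (λ j k → jk (α l) (α m) (α j) (α k)))))))))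

    -- In the absence of distinct solutions one of the ten pairs of entries coincides, and each pair
    -- accounts for at most 2 a² solutions.
    few-solutions : ∑⁵ solution ≤ 20 * (a * a)
    few-solutions = begin
      ∑⁵ solution
        ≤⟨ ∑⁵-mono solution-degenerate ⟩
      ∑⁵ (λ i j k l m → coincidences i j k l m * solution i j k l m)
        ≤⟨ peel (λ i j _ _ _ → 𝟙 (i Fin.≟ j)) c₁ (peel (λ i _ k _ _ → 𝟙 (i Fin.≟ k)) c₂ (peel (λ i _ _ l _ → 𝟙 (i Fin.≟ l)) c₃
           (peel (λ i _ _ _ m → 𝟙 (i Fin.≟ m)) c₄ (peel (λ _ j k _ _ → 𝟙 (j Fin.≟ k)) c₅ (peel (λ _ j _ l _ → 𝟙 (j Fin.≟ l)) c₆
           (peel (λ _ j _ _ m → 𝟙 (j Fin.≟ m)) c₇ (peel (λ _ _ k l _ → 𝟙 (k Fin.≟ l)) c₈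
           (peel (λ _ _ k _ m → 𝟙 (k Fin.≟ m)) c₉ c₁₀)))))))) ⟩
      bound + (bound + (bound + (bound + (bound + (bound + (bound + (bound + (bound + bound))))))))
        ≡⟨ eq (length as * length as) ⟩
      20 * (length as * length as)
        ≡⟨ cong (λ t → 20 * (t * t)) as-length ⟩
      20 * (a * a) ∎
      where
      open ≤-Reasoning
      eq : ∀ x → 2 * x + (2 * x + (2 * x + (2 * x + (2 * x + (2 * x + (2 * x + (2 * x + (2 * x + 2 * x)))))))) ≡ 20 * x
      eq = solve-∀
      peel : ∀ (f : Fin a → Fin a → Fin a → Fin a → Fin a → ℕ) {g : Fin a → Fin a → Fin a → Fin a → Fin a → ℕ} {b b′} →
             ∑⁵ (λ i j k l m → f i j k l m * solution i j k l m) ≤ b →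
             ∑⁵ (λ i j k l m → g i j k l m * solution i j k l m) ≤ b′ →
             ∑⁵ (λ i j k l m → (f i j k l m + g i j k l m) * solution i j k l m) ≤ b + b′
      peel f {g} {b} {b′} ≤₁ ≤₂ = begin
        ∑⁵ (λ i j k l m → (f i j k l m + g i j k l m) * solution i j k l m)
          ≤⟨ ∑⁵-mono (λ i j k l m → ≤-reflexive (*-distribʳ-+ (solution i j k l m) (f i j k l m) (g i j k l m))) ⟩
        ∑⁵ (λ i j k l m → f i j k l m * solution i j k l m + g i j k l m * solution i j k l m)
          ≡⟨ ∑⁵-+ (λ i j k l m → f i j k l m * solution i j k l m) (λ i j k l m → g i j k l m * solution i j k l m) ⟩
        ∑⁵ (λ i j k l m → f i j k l m * solution i j k l m) + ∑⁵ (λ i j k l m → g i j k l m * solution i j k l m)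
          ≤⟨ +-mono-≤ ≤₁ ≤₂ ⟩
        b + b′ ∎

    few-cycles : cycle backward forward forward forward forward ≤ N * (20 * (a * a))
    few-cycles = ≤-trans cycle≤solutions (*-monoʳ-≤ N few-solutions)

    -- A trivial solution placed at a start x: it visits x + k α i for k from 0 to 4. Starts are
    -- limited to the first n vertices, so the walk stays below N = 5 n.
    Walk : Set
    Walk = Fin n × Fin a

    walks : List Walk
    walks = cartesianProduct (allFin n) as

    walks-length : length walks ≡ n * a
    walks-length = trans (length-cartesianProduct (allFin n) as) (cong₂ _*_ (length-tabulate {n = n} id) as-length)

    place : ∀ k → k ≤ 4 → (w : Walk) → toℕ (proj₁ w) + k * α (proj₂ w) < N
    place k k≤4 (x , i) = +-mono-≤ (toℕ<n x) (*-mono-≤ k≤4 (α≤n i))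

    position : ∀ k → k ≤ 4 → Walk → V
    position k k≤4 w = fromℕ< (place k k≤4 w)

    toℕ-position : ∀ k k≤4 w → toℕ (position k k≤4 w) ≡ toℕ (proj₁ w) + k * α (proj₂ w)
    toℕ-position k k≤4 w = toℕ-fromℕ< (place k k≤4 w)

    -- For each label the source of the edge fixes the start of the walk. Summed over labels this is
    -- dominated by `difference`, which counts an edge once for each of its labels.
    walks-cover : ∀ β γ k k≤4 l l≤4 → (∀ i → k * α i + β i ≡ l * α i + γ i) → ∀ (G : V × V → ℕ) →
      ∑ walks (λ w → G (position k k≤4 w , position l l≤4 w)) ≤ ∑ pairs (λ z → uncurry (difference β γ) z * G z)
    walks-cover β γ k k≤4 l l≤4 rel = ∑-push-forward _≟ᵥ_ walks pairs pairs-complete ψ (uncurry (difference β γ)) multiplicity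
      where
      _≟ᵥ_ = ≡-dec (Fin._≟_ {N}) (Fin._≟_ {N})
      ψ : Walk → V × V
      ψ w = position k k≤4 w , position l l≤4 w
      edge : ∀ x i u v → ψ (x , i) ≡ (u , v) → toℕ u + β i ≡ toℕ v + γ i
      edge x i u v eq = begin
        toℕ u + β i                       ≡⟨ cong (λ t → toℕ t + β i) (sym (cong proj₁ eq)) ⟩
        toℕ (position k k≤4 (x , i)) + β i ≡⟨ cong (_+ β i) (toℕ-position k k≤4 (x , i)) ⟩
        toℕ x + k * α i + β i             ≡⟨ +-assoc (toℕ x) (k * α i) (β i) ⟩
        toℕ x + (k * α i + β i)           ≡⟨ cong (toℕ x +_) (rel i) ⟩
        toℕ x + (l * α i + γ i)           ≡⟨ sym (+-assoc (toℕ x) (l * α i) (γ i)) ⟩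
        toℕ x + l * α i + γ i             ≡⟨ cong (_+ γ i) (sym (toℕ-position l l≤4 (x , i))) ⟩
        toℕ (position l l≤4 (x , i)) + γ i ≡⟨ cong (λ t → toℕ t + γ i) (cong proj₂ eq) ⟩
        toℕ v + γ i                       ∎
        where open ≡-Reasoning
      start-unique : ∀ i x y → position k k≤4 (x , i) ≡ position k k≤4 (y , i) → x ≡ y
      start-unique i x y eq = toℕ-injective (+-cancelʳ-≡ (k * α i) _ _
        (trans (sym (toℕ-position k k≤4 (x , i))) (trans (cong toℕ eq) (toℕ-position k k≤4 (y , i)))))
      multiplicity : ∀ z → ∑ walks (λ w → 𝟙 (ψ w ≟ᵥ z)) ≤ uncurry (difference β γ) z
      multiplicity (u , v) = begin
        ∑ walks (λ w → 𝟙 (ψ w ≟ᵥ (u , v)))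
          ≡⟨ trans (∑-product (allFin n) as _) (∑-swap (allFin n) as _) ⟩
        ∑ as (λ i → ∑ (allFin n) (λ x → 𝟙 (ψ (x , i) ≟ᵥ (u , v))))
          ≤⟨ ∑-mono as (λ i → ∑-mono (allFin n) (λ x →
               𝟙-*-absorb (ψ (x , i) ≟ᵥ (u , v)) (toℕ u + β i ≟ toℕ v + γ i) (edge x i u v))) ⟩
        ∑ as (λ i → ∑ (allFin n) (λ x → 𝟙 (ψ (x , i) ≟ᵥ (u , v)) * 𝟙 (toℕ u + β i ≟ toℕ v + γ i)))
          ≡⟨ ∑-cong as (λ i → ∑-*ʳ (allFin n) _ _) ⟩
        ∑ as (λ i → ∑ (allFin n) (λ x → 𝟙 (ψ (x , i) ≟ᵥ (u , v))) * 𝟙 (toℕ u + β i ≟ toℕ v + γ i))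
          ≤⟨ ∑-mono as (λ i → ≤-trans (*-monoˡ-≤ _ (one i)) (≤-reflexive (*-identityˡ _))) ⟩
        ∑ as (λ i → 𝟙 (toℕ u + β i ≟ toℕ v + γ i)) ∎
        where
        open ≤-Reasoning
        one : ∀ i → ∑ (allFin n) (λ x → 𝟙 (ψ (x , i) ≟ᵥ (u , v))) ≤ 1
        one i = ∑-at-most-one _ (allFin⁺ n) (λ x → 𝟙≤1 (ψ (x , i) ≟ᵥ (u , v))) λ x y p q →
          start-unique i x y (cong proj₁ (trans (𝟙-pos (ψ (x , i) ≟ᵥ (u , v)) p) (sym (𝟙-pos (ψ (y , i) ≟ᵥ (u , v)) q))))

    dense-absurd : ∀ C → 1 ≤ n → 1 ≤ a → 1 ≤ C → N ≤ C * (a * a) → Constants.threshold C 76 ≤ a → ⊥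
    dense-absurd C 1≤n 1≤a 1≤C N≤ large =
      R.removal forward backward
        (record { row = difference-row α (λ _ → 0) ; codegree = difference-codegree α (λ _ → 0) forward-sidonLike })
        (record { row = difference-row (λ _ → 0) (λ i → 4 * α i)
                ; codegree = difference-codegree (λ _ → 0) (λ i → 4 * α i) backward-sidonLike })
        forward-two-step walks
        (≤-reflexive (trans (*-assoc 5 n a) (cong (5 *_) (sym walks-length))))
        (position 0 0≤4) (position 1 1≤4) (position 2 2≤4) (position 3 3≤4) (position 4 ≤-refl)
        (walks-cover α (λ _ → 0) 0 0≤4 1 1≤4 (λ i → next (α i) 0))
        (walks-cover α (λ _ → 0) 1 1≤4 2 2≤4 (λ i → next (α i) 1))
        (walks-cover α (λ _ → 0) 2 2≤4 3 3≤4 (λ i → next (α i) 2))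
        (walks-cover α (λ _ → 0) 3 3≤4 4 ≤-refl (λ i → next (α i) 3))
        (walks-cover (λ _ → 0) (λ i → 4 * α i) 4 ≤-refl 0 0≤4 (λ i → +-identityʳ (4 * α i)))
        large few-cycles
      where
      module R = Removal a C 76 (≤-trans 1≤n (m≤m+n n _)) 1≤a 1≤C ≤-refl N≤
      0≤4 : 0 ≤ 4
      0≤4 = z≤n
      1≤4 : 1 ≤ 4
      1≤4 = s≤s z≤n
      2≤4 : 2 ≤ 4
      2≤4 = s≤s (s≤s z≤n)
      3≤4 : 3 ≤ 4
      3≤4 = s≤s (s≤s (s≤s z≤n))
      next : ∀ x k → k * x + x ≡ suc k * x + 0
      next x k = trans (+-comm (k * x) x) (sym (+-identityʳ _))

-- The upper bound for good sets

lookup-unique-injective : ∀ {A : Set} {xs : List A} → Unique xs → ∀ i j → lookup xs i ≡ lookup xs j → i ≡ j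
lookup-unique-injective (x∉ ∷ u) Fin.zero    Fin.zero    eq = refl
lookup-unique-injective {xs = x ∷ xs} (x∉ ∷ u) Fin.zero (Fin.suc j) eq = ⊥-elim (All.lookup x∉ (∈-lookup {xs = xs} j) eq)
lookup-unique-injective {xs = x ∷ xs} (x∉ ∷ u) (Fin.suc i) Fin.zero eq = ⊥-elim (All.lookup x∉ (∈-lookup {xs = xs} i) (sym eq))
lookup-unique-injective (x∉ ∷ u) (Fin.suc i) (Fin.suc j) eq = cong Fin.suc (lookup-unique-injective u i j eq)

module _ (K t : ℕ) (1≤K : 1 ≤ K) (large : Constants.threshold (5 * (K * K)) 76 ≤ t) where

  -- If n < (K a)², then 5 n ≤ 5 K² a², so the removal argument runs with C = 5 K²; and (K t)² < n
  -- forces a above the threshold.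
  good-small : ∀ n A → 1 ≤ n → (K * t) * (K * t) < n → Good n A → (K * length A) * (K * length A) ≤ n
  good-small n A 1≤n room (unique , range , sid , free) = decidable-stable (_ ≤? _) λ viol → absurd (≰⇒> viol)
    where
    a = length A
    α : Fin a → ℕ
    α = lookup A
    α∈ : ∀ i → α i ∈ A
    α∈ i = ∈-lookup {xs = A} i
    injective : ∀ {i j} → α i ≡ α j → i ≡ j
    injective = lookup-unique-injective unique _ _
    sidon : ∀ i j k l → α i + α j ≡ α k + α l → (i ≡ k × j ≡ l) ⊎ (i ≡ l × j ≡ k)
    sidon i j k l eq with sid (α∈ i) (α∈ j) (α∈ k) (α∈ l) eq
    ... | inj₁ (p , q) = inj₁ (injective p , injective q)
    ... | inj₂ (p , q) = inj₂ (injective p , injective q)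
    free′ : ∀ i j k l m → j ≢ k → j ≢ l → j ≢ m → j ≢ i → k ≢ l → k ≢ m → k ≢ i → l ≢ m → l ≢ i → m ≢ i →
            α j + (α k + (α l + α m)) ≢ 4 * α i
    free′ i j k l m n₁ n₂ n₃ n₄ n₅ n₆ n₇ n₈ n₉ n₁₀ eq = free (α∈ j) (α∈ k) (α∈ l) (α∈ m) (α∈ i)
      (n₁ ∘ injective , n₂ ∘ injective , n₃ ∘ injective , n₄ ∘ injective , n₅ ∘ injective , n₆ ∘ injective ,
       n₇ ∘ injective , n₈ ∘ injective , n₉ ∘ injective , n₁₀ ∘ injective)
      (trans (eq₁ (α j) (α k) (α l) (α m)) eq)
      where
      eq₁ : ∀ x y z w → x + y + z + w ≡ x + (y + (z + w))
      eq₁ = solve-∀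
    absurd : n < (K * a) * (K * a) → ⊥
    absurd n< = SidonKernels.SolutionFree.dense-absurd n a α (λ i → proj₂ (All.lookup range (α∈ i))) sidon free′ (5 * (K * K))
      1≤n (≤-trans (s≤s z≤n) t<a) (*-mono-≤ {1} {5} (s≤s z≤n) (*-mono-≤ 1≤K 1≤K))
      (≤-trans (*-monoʳ-≤ 5 (<⇒≤ n<)) (≤-reflexive (eq₂ K a))) (≤-trans large (<⇒≤ t<a))
      where
      eq₂ : ∀ K a → 5 * (K * a * (K * a)) ≡ 5 * (K * K) * (a * a)
      eq₂ = solve-∀
      t<a : t < a
      t<a = ≰⇒> λ a≤t → <⇒≱ (<-trans room n<) (*-mono-≤ (*-monoʳ-≤ K a≤t) (*-monoʳ-≤ K a≤t))

good-bounded : ∀ k → Σ ℕ λ N₀ → ∀ n A → N₀ ≤ n → Good n A → (suc k * length A) * (suc k * length A) ≤ n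
good-bounded k = bounded (Constants.threshold (5 * (suc k * suc k)) 76) ≤-refl
  where
  bounded : ∀ t → Constants.threshold (5 * (suc k * suc k)) 76 ≤ t →
            Σ ℕ λ N₀ → ∀ n A → N₀ ≤ n → Good n A → (suc k * length A) * (suc k * length A) ≤ n
  bounded t large = suc ((suc k * t) * (suc k * t)) , λ n A room →
    good-small (suc k) t (s≤s z≤n) large n A (≤-trans (s≤s z≤n) room) room

-- Binomial coefficients and common multiples

C-absorb : ∀ n k → suc k * (suc n choose suc k) ≡ suc n * (n choose k)
C-absorb n zero = trans (+-identityʳ _) (trans (nC1≡n (suc n)) (sym (*-identityʳ (suc n))))
C-absorb zero (suc k) = trans (cong (suc (suc k) *_) (k>n⇒nCk≡0 {1} {suc (suc k)} (s≤s (s≤s z≤n))))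
  (trans (*-zeroʳ (suc (suc k))) (sym (trans (+-identityʳ _) (k>n⇒nCk≡0 {0} {suc k} (s≤s z≤n)))))
C-absorb (suc n) (suc k) = begin
  suc (suc k) * (suc (suc n) choose suc (suc k))
    ≡⟨ cong (suc (suc k) *_) (sym (nCk+nC[k+1]≡[n+1]C[k+1] (suc n) (suc k))) ⟩
  suc (suc k) * (X + Y)
    ≡⟨ eq₁ k X Y ⟩
  X + (suc k * X + suc (suc k) * Y)
    ≡⟨ cong (X +_) (cong₂ _+_ (C-absorb n k) (C-absorb n (suc k))) ⟩
  X + (suc n * (n choose k) + suc n * (n choose suc k))
    ≡⟨ cong (X +_) (trans (sym (*-distribˡ-+ (suc n) (n choose k) (n choose suc k))) (cong (suc n *_) (nCk+nC[k+1]≡[n+1]C[k+1] n k))) ⟩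
  suc (suc n) * X ∎
  where
  open ≡-Reasoning
  X = suc n choose suc k
  Y = suc n choose suc (suc k)
  eq₁ : ∀ k X Y → suc (suc k) * (X + Y) ≡ X + (suc k * X + suc (suc k) * Y)
  eq₁ = solve-∀

C-pos : ∀ n k → k ≤ n → 1 ≤ n choose k
C-pos n       zero    _         = ≤-refl
C-pos (suc n) (suc k) (s≤s k≤n) = ≤-trans (C-pos n k k≤n)
  (≤-trans (m≤m+n _ _) (≤-reflexive (nCk+nC[k+1]≡[n+1]C[k+1] n k)))

2^m≤2mCm : ∀ m → 2 ^ m ≤ (m + m) choose m
2^m≤2mCm zero    = ≤-refl
2^m≤2mCm (suc m) = begin
  2 ^ m + (2 ^ m + 0)
    ≡⟨ cong (2 ^ m +_) (+-identityʳ _) ⟩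
  2 ^ m + 2 ^ m
    ≤⟨ +-mono-≤ (≤-trans (2^m≤2mCm m) lower) (≤-trans (2^m≤2mCm m) upper) ⟩
  (m + suc m) choose m + (m + suc m) choose suc m
    ≡⟨ nCk+nC[k+1]≡[n+1]C[k+1] (m + suc m) m ⟩
  suc (m + suc m) choose suc m ∎
  where
  open ≤-Reasoning
  step : ∀ k → (m + m) choose k ≤ (m + m) choose k + (m + m) choose suc k
  step k = m≤m+n _ _
  upper : (m + m) choose m ≤ (m + suc m) choose suc m
  upper = ≤-trans (step m) (≤-reflexive (trans (nCk+nC[k+1]≡[n+1]C[k+1] (m + m) m) (cong (_choose suc m) (sym (+-suc m m)))))
  lower : (m + m) choose m ≤ (m + suc m) choose m
  lower = subst (λ t → (m + m) choose m ≤ t choose m) (sym (+-suc m m)) (monoˡ (m + m) m)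
    where
    monoˡ : ∀ n k → n choose k ≤ suc n choose k
    monoˡ n zero    = ≤-refl
    monoˡ n (suc k) = ≤-trans (m≤n+m _ _) (≤-reflexive (nCk+nC[k+1]≡[n+1]C[k+1] n k))

-- Leibniz' harmonic triangle: 1/(m C(n,m)) + 1/((m+1) C(n,m+1)) = 1/(m C(n-1,m)),
-- so every common multiple of 1, …, n is a multiple of all m C(n,m).
harmonic : ∀ n m → let A = suc m * (n choose suc m); B = suc m * (suc n choose suc m); D = suc (suc m) * (suc n choose suc (suc m)) in
           D * B ≡ A * B + A * D
harmonic n m = begin
  D * B                                         ≡⟨ cong₂ _*_ (C-absorb n (suc m)) (C-absorb n m) ⟩
  suc n * y * (suc n * x)                       ≡⟨ eq₁ (suc n) x y ⟩
  y * suc n * (suc n * x)                       ≡⟨ cong (y * suc n *_) (sym (C-absorb n m)) ⟩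
  y * suc n * B                                 ≡⟨ cong (λ t → y * suc n * (suc m * t)) (sym (nCk+nC[k+1]≡[n+1]C[k+1] n m)) ⟩
  y * suc n * (suc m * (x + y))                 ≡⟨ eq₂ (suc n) (suc m) x y ⟩
  suc m * y * (suc n * x) + suc m * y * (suc n * y) ≡⟨ cong₂ (λ s t → A * s + A * t) (sym (C-absorb n m)) (sym (C-absorb n (suc m))) ⟩
  A * B + A * D                                 ∎
  where
  open ≡-Reasoning
  x = n choose m
  y = n choose suc m
  A = suc m * (n choose suc m)
  B = suc m * (suc n choose suc m)
  D = suc (suc m) * (suc n choose suc (suc m))
  eq₁ : ∀ n x y → n * y * (n * x) ≡ y * n * (n * x)
  eq₁ = solve-∀
  eq₂ : ∀ n m x y → y * n * (m * (x + y)) ≡ m * y * (n * x) + m * y * (n * y)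
  eq₂ = solve-∀

leibniz : ∀ L X → (∀ k → 1 ≤ k → k ≤ X → k ∣ L) → ∀ m n → suc m ≤ n → n ≤ X → suc m * (n choose suc m) ∣ L
leibniz L X mult zero (suc n) _ n≤X =
  subst (_∣ L) (sym (trans (+-identityʳ _) (nC1≡n (suc n)))) (mult (suc n) (s≤s z≤n) n≤X)
leibniz L X mult (suc m) (suc n) (s≤s m<n) n≤X
  with leibniz L X mult m n m<n (≤-trans (n≤1+n n) n≤X) | leibniz L X mult m (suc n) (≤-trans m<n (n≤1+n n)) n≤X
... | divides u L≡uA | divides v L≡vB =
  ∣m+n∣m⇒∣n (divides u (sym (*-cancelʳ-≡ _ _ (A * B) {{>-nonZero (*-mono-≤ 1≤A 1≤B)}} uD))) (divides v refl)
  where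
  open ≡-Reasoning
  A = suc m * (n choose suc m)
  B = suc m * (suc n choose suc m)
  D = suc (suc m) * (suc n choose suc (suc m))
  1≤A : 1 ≤ A
  1≤A = *-mono-≤ {1} {suc m} (s≤s z≤n) (C-pos n (suc m) m<n)
  1≤B : 1 ≤ B
  1≤B = *-mono-≤ {1} {suc m} (s≤s z≤n) (C-pos (suc n) (suc m) (≤-trans m<n (n≤1+n n)))
  eq₁ : ∀ u D A B → u * D * (A * B) ≡ u * A * (D * B)
  eq₁ = solve-∀
  eq₂ : ∀ L v D A B → L * (A * B) + v * B * (A * D) ≡ (v * D + L) * (A * B)
  eq₂ = solve-∀
  -- Cancelling A B leaves u D = v D + L, so D divides L.
  uD : u * D * (A * B) ≡ (v * D + L) * (A * B)
  uD = begin
    u * D * (A * B)                  ≡⟨ eq₁ u D A B ⟩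
    u * A * (D * B)                  ≡⟨ cong₂ _*_ (sym L≡uA) (harmonic n m) ⟩
    L * (A * B + A * D)              ≡⟨ *-distribˡ-+ L (A * B) (A * D) ⟩
    L * (A * B) + L * (A * D)        ≡⟨ cong (λ t → L * (A * B) + t * (A * D)) L≡vB ⟩
    L * (A * B) + v * B * (A * D)    ≡⟨ eq₂ L v D A B ⟩
    (v * D + L) * (A * B)            ∎

-- Smooth numbers

^-monoʳ-∣ : ∀ q {m n} → m ≤ n → q ^ m ∣ q ^ n
^-monoʳ-∣ q {m} {n} m≤n = divides (q ^ (n ∸ m))
  (trans (cong (q ^_) (sym (m∸n+n≡m m≤n))) (^-distribˡ-+-* q (n ∸ m) m))

n<q^n : ∀ q → 2 ≤ q → ∀ n → n < q ^ n
n<q^n q 2≤q zero    = s≤s z≤n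
n<q^n q 2≤q (suc n) = begin-strict
  suc n          <⟨ s≤s (n<q^n q 2≤q n) ⟩
  1 + q ^ n      ≤⟨ +-monoˡ-≤ (q ^ n) (≤-trans (s≤s z≤n) (n<q^n q 2≤q n)) ⟩
  q ^ n + q ^ n  ≡⟨ cong (q ^ n +_) (sym (+-identityʳ _)) ⟩
  2 * q ^ n      ≤⟨ *-monoˡ-≤ (q ^ n) 2≤q ⟩
  q * q ^ n      ∎
  where open ≤-Reasoning

largest-power : ∀ q X → 2 ≤ q → 1 ≤ X → ∃ λ w → 1 ≤ w × w ≤ X × (∀ v → q ^ v ≤ X → q ^ v ∣ w)
largest-power q X 2≤q 1≤X = let e , le , max = search X in
  q ^ e , ≤-trans (s≤s z≤n) (n<q^n q 2≤q e) , le ,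
  λ v q^v≤X → ^-monoʳ-∣ q (max v (<⇒≤ (<-≤-trans (n<q^n q 2≤q v) q^v≤X)) q^v≤X)
  where
  search : ∀ b → ∃ λ e → q ^ e ≤ X × (∀ v → v ≤ b → q ^ v ≤ X → v ≤ e)
  search zero = 0 , 1≤X , λ v v≤0 _ → v≤0
  search (suc b) with q ^ suc b ≤? X | search b
  ... | yes le | _ = suc b , le , λ v v≤ _ → v≤
  ... | no ¬le | e , le , max = e , le , bounded
    where
    bounded : ∀ v → v ≤ suc b → q ^ v ≤ X → v ≤ e
    bounded v v≤ q^v≤X with m≤n⇒m<n∨m≡n v≤
    ... | inj₁ (s≤s v≤b) = max v v≤b q^v≤X
    ... | inj₂ refl      = ⊥-elim (¬le q^v≤X)

remove-factor : ∀ q → 2 ≤ q → ∀ k → 1 ≤ k → ∃ λ v → ∃ λ k′ → k ≡ q ^ v * k′ × 1 ≤ k′ × ¬ q ∣ k′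
remove-factor q 2≤q = <-rec _ go
  where
  go : ∀ k → (∀ {j} → j < k → 1 ≤ j → ∃ λ v → ∃ λ k′ → j ≡ q ^ v * k′ × 1 ≤ k′ × ¬ q ∣ k′) →
       1 ≤ k → ∃ λ v → ∃ λ k′ → k ≡ q ^ v * k′ × 1 ≤ k′ × ¬ q ∣ k′
  go k rec 1≤k with q ∣? k
  ... | no q∤k = 0 , k , sym (+-identityʳ k) , 1≤k , q∤k
  ... | yes (divides zero    eq) = ⊥-elim (<⇒≱ 1≤k (≤-reflexive eq))
  ... | yes (divides (suc j) eq) with rec {suc j} (<-≤-trans (m<m*n (suc j) q 2≤q) (≤-reflexive (sym eq))) (s≤s z≤n)
  ... | v , k′ , eq′ , 1≤k′ , q∤k′ = suc v , k′ ,
        trans eq (trans (cong (_* q) eq′) (trans (*-comm _ q) (sym (*-assoc q (q ^ v) k′)))) , 1≤k′ , q∤k′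

prime-divisor : ∀ k → 2 ≤ k → ∃ λ p → Prime p × p ∣ k
prime-divisor k 2≤k with factorise k {{>-nonZero (≤-trans (s≤s z≤n) 2≤k)}}
... | record { factors = [] ; isFactorisation = eq } = ⊥-elim (<⇒≱ 2≤k (≤-reflexive eq))
... | record { factors = p ∷ ps ; isFactorisation = eq ; factorsPrime = pp ∷ _ } =
  p , pp , divides (product ps) (trans eq (*-comm p (product ps)))

prime≥2 : ∀ {p} → Prime p → 2 ≤ p
prime≥2 pp = nonTrivial⇒n>1 _ {{prime⇒nonTrivial pp}}

-- L is built from the largest power up to X of each q between 2 and y, so every q contributes a
-- factor at most X. Once the full power of q is removed from k, the primes dividing the rest lie
-- below q.
smooth-multiple : ∀ X → 1 ≤ X → ∀ y → ∃ λ L → 1 ≤ L × L ≤ X ^ y ×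
  (∀ k → 1 ≤ k → k ≤ X → (∀ p → Prime p → p ∣ k → p ≤ y) → k ∣ L)
smooth-multiple X 1≤X zero = 1 , ≤-refl , ≤-refl , base
  where
  base : ∀ k → 1 ≤ k → k ≤ X → (∀ p → Prime p → p ∣ k → p ≤ 0) → k ∣ 1
  base (suc zero)    _ _ _ = ∣-refl
  base (suc (suc k)) _ _ h with prime-divisor (suc (suc k)) (s≤s (s≤s z≤n))
  ... | p , pp , p∣k = ⊥-elim (<⇒≱ (≤-trans (s≤s z≤n) (prime≥2 pp)) (h p pp p∣k))
smooth-multiple X 1≤X (suc y) with smooth-multiple X 1≤X y | 2 ≤? suc y
... | L , 1≤L , L≤ , mult | no ¬2≤ = L , 1≤L , ≤-trans L≤ (m≤n*m (X ^ y) X {{>-nonZero 1≤X}}) ,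
  λ k 1≤k k≤X h → mult k 1≤k k≤X (λ p pp p∣k → ⊥-elim (¬2≤ (≤-trans (prime≥2 pp) (h p pp p∣k))))
... | L , 1≤L , L≤ , mult | yes 2≤ with largest-power (suc y) X 2≤ 1≤X
... | w , 1≤w , w≤X , powers = w * L , *-mono-≤ 1≤w 1≤L , *-mono-≤ w≤X L≤ , step
  where
  step : ∀ k → 1 ≤ k → k ≤ X → (∀ p → Prime p → p ∣ k → p ≤ suc y) → k ∣ w * L
  step k 1≤k k≤X h with remove-factor (suc y) 2≤ k 1≤k
  ... | v , k′ , refl , 1≤k′ , q∤k′ = *-pres-∣ (powers v (≤-trans (m≤m*n (suc y ^ v) k′ {{>-nonZero 1≤k′}}) k≤X))
    (mult k′ 1≤k′ (≤-trans (m≤n*m k′ (suc y ^ v) {{m^n≢0 (suc y) v}}) k≤X) smaller)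
    where
    smaller : ∀ p → Prime p → p ∣ k′ → p ≤ y
    smaller p pp p∣k′ with m≤n⇒m<n∨m≡n (h p pp (∣-trans p∣k′ (n∣m*n (suc y ^ v))))
    ... | inj₁ (s≤s p≤y) = p≤y
    ... | inj₂ refl      = ⊥-elim (q∤k′ p∣k′)

-- Otherwise every k ≤ 2 m has only prime factors up to y and divides some L ≤ (2 m)^y. By `leibniz`
-- m times the central binomial coefficient divides L as well, which gives 2^m ≤ L.
prime-between : ∀ y m → 1 ≤ m → (m + m) ^ y < 2 ^ m → ∃ λ p → Prime p × y < p × p ≤ m + m
prime-between y m 1≤m lt with anyUpTo? (λ p → prime? p ×-dec (y <? p)) (suc (m + m))
... | yes (p , s≤s p≤ , pp , y<p) = p , pp , y<p , p≤
... | no none with smooth-multiple (m + m) (≤-trans 1≤m (m≤m+n m m)) y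
... | L , 1≤L , L≤ , mult = ⊥-elim (<⇒≱ lt (begin
  2 ^ m                ≤⟨ 2^m≤2mCm m ⟩
  (m + m) choose m          ≤⟨ m≤n*m _ m {{>-nonZero 1≤m}} ⟩
  m * ((m + m) choose m)    ≤⟨ ∣⇒≤ {{>-nonZero 1≤L}} (dvd m 1≤m (m≤m+n m m)) ⟩
  L                    ≤⟨ L≤ ⟩
  (m + m) ^ y          ∎))
  where
  open ≤-Reasoning
  all : ∀ k → 1 ≤ k → k ≤ m + m → k ∣ L
  all k 1≤k k≤ = mult k 1≤k k≤ λ p pp p∣k → ≮⇒≥ λ y<p →
    none (p , s≤s (≤-trans (∣⇒≤ {{>-nonZero 1≤k}} p∣k) k≤) , pp , y<p)
  dvd : ∀ j → 1 ≤ j → j ≤ m + m → j * ((m + m) choose j) ∣ L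
  dvd (suc j) _ j≤ = leibniz L (m + m) all j (m + m) j≤ ≤-refl

-- Uniqueness of digits and means of four numbers

digit-unique : ∀ b {x y} X Y → x < b → y < b → x + b * X ≡ y + b * Y → x ≡ y × X ≡ Y
digit-unique b {x} {y} zero zero x<b y<b eq =
  +-cancelʳ-≡ (b * 0) x y eq , refl
digit-unique b {x} {y} zero (suc Y) x<b y<b eq = ⊥-elim (<⇒≱ x<b (begin
  b                  ≤⟨ m≤m+n b (b * Y) ⟩
  b + b * Y          ≡⟨ sym (*-suc b Y) ⟩
  b * suc Y          ≤⟨ m≤n+m _ y ⟩
  y + b * suc Y      ≡⟨ sym eq ⟩
  x + b * 0          ≡⟨ trans (cong (x +_) (*-zeroʳ b)) (+-identityʳ x) ⟩
  x                  ∎))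
  where open ≤-Reasoning
digit-unique b (suc X) zero x<b y<b eq with digit-unique b zero (suc X) y<b x<b (sym eq)
... | _ , ()
digit-unique b {x} {y} (suc X) (suc Y) x<b y<b eq
  with digit-unique b X Y x<b y<b (+-cancelˡ-≡ b _ _ (trans (eq₁ b x X) (trans eq (sym (eq₁ b y Y)))))
  where
  eq₁ : ∀ b x X → b + (x + b * X) ≡ x + b * suc X
  eq₁ = solve-∀
... | x≡y , X≡Y = x≡y , cong suc X≡Y

-- The square of the sum is expanded and every mixed product estimated by `2ab≤a²+b²`, except that
-- the defect for the first two entries is kept.
four-squares-spread : ∀ x₁ x₂ x₃ x₄ x₅ → x₁ + x₂ + x₃ + x₄ ≡ 4 * x₅ →
  16 * (x₅ * x₅) + ∣ x₁ - x₂ ∣ * ∣ x₁ - x₂ ∣ ≤ 4 * (x₁ * x₁ + x₂ * x₂ + x₃ * x₃ + x₄ * x₄)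
four-squares-spread x₁ x₂ x₃ x₄ x₅ eq = begin
  16 * (x₅ * x₅) + δ
    ≡⟨ cong (_+ δ) (trans (eq₁ x₅) (cong₂ _*_ (sym eq) (sym eq))) ⟩
  (x₁ + x₂ + x₃ + x₄) * (x₁ + x₂ + x₃ + x₄) + δ
    ≡⟨ eq₂ x₁ x₂ x₃ x₄ δ ⟩
  S + ((2 * (x₁ * x₂) + δ) + (2 * (x₁ * x₃) + 2 * (x₁ * x₄) + (2 * (x₂ * x₃) + 2 * (x₂ * x₄) + 2 * (x₃ * x₄))))
    ≤⟨ +-monoʳ-≤ S (+-mono-≤ (≤-reflexive (sym (square-split x₁ x₂))) (+-mono-≤ (+-mono-≤ (2ab≤a²+b² x₁ x₃) (2ab≤a²+b² x₁ x₄))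
         (+-mono-≤ (+-mono-≤ (2ab≤a²+b² x₂ x₃) (2ab≤a²+b² x₂ x₄)) (2ab≤a²+b² x₃ x₄)))) ⟩
  S + (x₁ * x₁ + x₂ * x₂ + (x₁ * x₁ + x₃ * x₃ + (x₁ * x₁ + x₄ * x₄) + (x₂ * x₂ + x₃ * x₃ + (x₂ * x₂ + x₄ * x₄) + (x₃ * x₃ + x₄ * x₄))))
    ≡⟨ eq₃ (x₁ * x₁) (x₂ * x₂) (x₃ * x₃) (x₄ * x₄) ⟩
  4 * S ∎
  where
  open ≤-Reasoning
  δ = ∣ x₁ - x₂ ∣ * ∣ x₁ - x₂ ∣
  S = x₁ * x₁ + x₂ * x₂ + x₃ * x₃ + x₄ * x₄
  eq₁ : ∀ x → 16 * (x * x) ≡ (4 * x) * (4 * x)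
  eq₁ = solve-∀
  eq₂ : ∀ a b c d δ → (a + b + c + d) * (a + b + c + d) + δ ≡ (a * a + b * b + c * c + d * d) +
        ((2 * (a * b) + δ) + (2 * (a * c) + 2 * (a * d) + (2 * (b * c) + 2 * (b * d) + 2 * (c * d))))
  eq₂ = solve-∀
  eq₃ : ∀ a b c d → (a + b + c + d) + (a + b + (a + c + (a + d) + (b + c + (b + d) + (c + d)))) ≡ 4 * (a + b + c + d)
  eq₃ = solve-∀

-- Digit vectors on a sphere

module Digits (d : ℕ) where

  -- Four times the digit bound, so that neither the sum of four digits nor four times a digit
  -- carries.
  b : ℕ
  b = 4 * d

  value norm : ∀ {r} → Vec (Fin d) r → ℕ
  value []      = 0
  value (x ∷ v) = toℕ x + b * value v
  norm []      = 0
  norm (x ∷ v) = toℕ x * toℕ x + norm v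

  distance : ∀ {r} → Vec (Fin d) r → Vec (Fin d) r → ℕ
  distance []      []      = 0
  distance (x ∷ v) (y ∷ w) = ∣ toℕ x - toℕ y ∣ * ∣ toℕ x - toℕ y ∣ + distance v w

  distance-zero : ∀ {r} (v w : Vec (Fin d) r) → distance v w ≡ 0 → v ≡ w
  distance-zero []      []      _  = refl
  distance-zero (x ∷ v) (y ∷ w) eq = cong₂ _∷_
    (toℕ-injective (∣m-n∣≡0⇒m≡n (m²≡0 (m+n≡0⇒m≡0 _ eq)))) (distance-zero v w (m+n≡0⇒n≡0 (∣ toℕ x - toℕ y ∣ * ∣ toℕ x - toℕ y ∣) eq))
    where
    m²≡0 : ∀ {m} → m * m ≡ 0 → m ≡ 0
    m²≡0 {zero} _ = refl

  digit<b : ∀ (x : Fin d) → toℕ x < b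
  digit<b x = <-≤-trans (toℕ<n x) (m≤m+n d _)

  value<b^r : ∀ {r} (v : Vec (Fin d) r) → value v < b ^ r
  value<b^r []      = s≤s z≤n
  value<b^r {suc r} (x ∷ v) = begin-strict
    toℕ x + b * value v     <⟨ +-monoˡ-< (b * value v) (digit<b x) ⟩
    b + b * value v         ≡⟨ sym (*-suc b (value v)) ⟩
    b * suc (value v)       ≤⟨ *-monoʳ-≤ b (value<b^r v) ⟩
    b * b ^ r               ∎
    where open ≤-Reasoning

  value-injective : ∀ {r} {v w : Vec (Fin d) r} → value v ≡ value w → v ≡ w
  value-injective {v = []}    {[]}    _  = refl
  value-injective {v = x ∷ v} {y ∷ w} eq with digit-unique b (value v) (value w) (digit<b x) (digit<b y) eq
  ... | x≡y , v≡w = cong₂ _∷_ (toℕ-injective x≡y) (value-injective v≡w)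

  norm-spread : ∀ {r} (v₁ v₂ v₃ v₄ v₅ : Vec (Fin d) r) → value v₁ + value v₂ + value v₃ + value v₄ ≡ 4 * value v₅ →
    16 * norm v₅ + distance v₁ v₂ ≤ 4 * (norm v₁ + norm v₂ + norm v₃ + norm v₄)
  norm-spread [] [] [] [] [] _ = z≤n
  norm-spread (x₁ ∷ v₁) (x₂ ∷ v₂) (x₃ ∷ v₃) (x₄ ∷ v₄) (x₅ ∷ v₅) eq
    with digit-unique b {toℕ x₁ + toℕ x₂ + toℕ x₃ + toℕ x₄} {4 * toℕ x₅}
           (value v₁ + value v₂ + value v₃ + value v₄) (4 * value v₅) sum<b (*-monoʳ-< 4 (toℕ<n x₅))
           (trans (sym (eq₁ b (toℕ x₁) (toℕ x₂) (toℕ x₃) (toℕ x₄) (value v₁) (value v₂) (value v₃) (value v₄)))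
                  (trans eq (eq₂ b (toℕ x₅) (value v₅))))
    where
    sum<b : toℕ x₁ + toℕ x₂ + toℕ x₃ + toℕ x₄ < b
    sum<b = <-≤-trans (+-mono-< (+-mono-< (+-mono-< (toℕ<n x₁) (toℕ<n x₂)) (toℕ<n x₃)) (toℕ<n x₄)) (≤-reflexive (eq₀ d))
      where
      eq₀ : ∀ d → d + d + d + d ≡ 4 * d
      eq₀ = solve-∀
    eq₁ : ∀ b x y z w X Y Z W → (x + b * X) + (y + b * Y) + (z + b * Z) + (w + b * W) ≡ (x + y + z + w) + b * (X + Y + Z + W)
    eq₁ = solve-∀
    eq₂ : ∀ b x X → 4 * (x + b * X) ≡ 4 * x + b * (4 * X)
    eq₂ = solve-∀
  ... | heads , tails = begin
    16 * (sq x₅ + norm v₅) + (δ + distance v₁ v₂)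
      ≡⟨ eq₃ (sq x₅) (norm v₅) δ (distance v₁ v₂) ⟩
    (16 * sq x₅ + δ) + (16 * norm v₅ + distance v₁ v₂)
      ≤⟨ +-mono-≤ (four-squares-spread (toℕ x₁) (toℕ x₂) (toℕ x₃) (toℕ x₄) (toℕ x₅) heads) (norm-spread v₁ v₂ v₃ v₄ v₅ tails) ⟩
    4 * (sq x₁ + sq x₂ + sq x₃ + sq x₄) + 4 * (norm v₁ + norm v₂ + norm v₃ + norm v₄)
      ≡⟨ eq₄ (sq x₁) (sq x₂) (sq x₃) (sq x₄) (norm v₁) (norm v₂) (norm v₃) (norm v₄) ⟩
    4 * (sq x₁ + norm v₁ + (sq x₂ + norm v₂) + (sq x₃ + norm v₃) + (sq x₄ + norm v₄)) ∎
    where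
    open ≤-Reasoning
    sq : Fin d → ℕ
    sq x = toℕ x * toℕ x
    δ = ∣ toℕ x₁ - toℕ x₂ ∣ * ∣ toℕ x₁ - toℕ x₂ ∣
    eq₃ : ∀ s n δ t → 16 * (s + n) + (δ + t) ≡ (16 * s + δ) + (16 * n + t)
    eq₃ = solve-∀
    eq₄ : ∀ a b c d x y z w → 4 * (a + b + c + d) + 4 * (x + y + z + w) ≡ 4 * (a + x + (b + y) + (c + z) + (d + w))
    eq₄ = solve-∀

  -- On a sphere both sides of `norm-spread` have the main term 16 R, which leaves no room for
  -- `distance`. Equality of the first two vectors already rules out a distinct solution.
  sphere-mean-free : ∀ {r} R (v₁ v₂ v₃ v₄ v₅ : Vec (Fin d) r) → norm v₁ ≡ R → norm v₂ ≡ R → norm v₃ ≡ R → norm v₄ ≡ R →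
    norm v₅ ≡ R → value v₁ + value v₂ + value v₃ + value v₄ ≡ 4 * value v₅ → v₁ ≡ v₂
  sphere-mean-free R v₁ v₂ v₃ v₄ v₅ refl e₂ e₃ e₄ e₅ eq = distance-zero v₁ v₂ (n≤0⇒n≡0 (+-cancelˡ-≤ (16 * R) _ _ (begin
    16 * R + distance v₁ v₂                              ≡⟨ cong (λ t → 16 * t + distance v₁ v₂) (sym e₅) ⟩
    16 * norm v₅ + distance v₁ v₂                        ≤⟨ norm-spread v₁ v₂ v₃ v₄ v₅ eq ⟩
    4 * (R + norm v₂ + norm v₃ + norm v₄)                ≡⟨ cong (4 *_) (cong₂ _+_ (cong₂ _+_ (cong (R +_) e₂) e₃) e₄) ⟩
    4 * (R + R + R + R)                                  ≡⟨ eq₁ R ⟩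
    16 * R + 0                                           ∎)))
    where
    open ≤-Reasoning
    eq₁ : ∀ R → 4 * (R + R + R + R) ≡ 16 * R + 0
    eq₁ = solve-∀

  vectors : ∀ r → List (Vec (Fin d) r)
  vectors zero    = [] ∷ []
  vectors (suc r) = map (uncurry _∷_) (cartesianProduct (allFin d) (vectors r))

  vectors-unique : ∀ r → Unique (vectors r)
  vectors-unique zero    = [] ∷ []
  vectors-unique (suc r) = map⁺ (λ { {_ , _} {_ , _} refl → refl }) (cartesianProduct⁺ (allFin⁺ d) (vectors-unique r))

  vectors-length : ∀ r → length (vectors r) ≡ d ^ r
  vectors-length zero    = refl
  vectors-length (suc r) = trans (length-map (uncurry _∷_) (cartesianProduct (allFin d) (vectors r)))
    (trans (length-cartesianProduct (allFin d) (vectors r)) (cong₂ _*_ (length-tabulate {n = d} id) (vectors-length r)))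

  norm≤ : ∀ {r} (v : Vec (Fin d) r) → norm v ≤ r * (d * d)
  norm≤ []      = z≤n
  norm≤ (x ∷ v) = +-mono-≤ (*-mono-≤ (<⇒≤ (toℕ<n x)) (<⇒≤ (toℕ<n x))) (norm≤ v)

  sphere : ∀ r → ℕ → List (Vec (Fin d) r)
  sphere r R = filter (λ v → norm v ≟ R) (vectors r)

length-filter-∑ : ∀ {A : Set} {P : A → Set} (P? : ∀ x → Dec (P x)) xs → length (filter P? xs) ≡ ∑ xs (λ x → 𝟙 (P? x))
length-filter-∑ P? []       = refl
length-filter-∑ P? (x ∷ xs) with P? x
... | yes _ = cong suc (length-filter-∑ P? xs)
... | no _  = length-filter-∑ P? xs

∑-pigeonhole : ∀ {A : Set} (x : A) xs (g : A → ℕ) → ∃ λ y → ∑ (x ∷ xs) g ≤ length (x ∷ xs) * g y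
∑-pigeonhole x []        g = x , ≤-refl
∑-pigeonhole x (x′ ∷ xs) g with ∑-pigeonhole x′ xs g
... | y , le with ≤-total (g x) (g y)
... | inj₁ gx≤gy = y , +-mono-≤ gx≤gy le
... | inj₂ gy≤gx = x , +-monoʳ-≤ (g x) (≤-trans le (*-monoʳ-≤ (length (x′ ∷ xs)) gy≤gx))

-- Pigeonhole principle over the r d² + 1 possible norms.
large-sphere : ∀ d r → ∃ λ R → d ^ r ≤ suc (r * (d * d)) * length (Digits.sphere d r R)
large-sphere d r with ∑-pigeonhole (r * (d * d)) (downFrom (r * (d * d))) (λ R → length (Digits.sphere d r R))
... | R , le = R , (begin
  d ^ r
    ≡⟨ sym (vectors-length r) ⟩
  length (vectors r)
    ≡⟨ sym (trans (∑-const (vectors r) 1) (*-identityʳ _)) ⟩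
  ∑ (vectors r) (λ _ → 1)
    ≤⟨ ∑-mono (vectors r) (λ v → ≤-trans (≤-reflexive (sym (𝟙-yes (norm v ≟ norm v) refl)))
         (∑-∈ {xs = downFrom (suc (r * (d * d)))} (λ R → 𝟙 (norm v ≟ R)) (∈-downFrom⁺ (s≤s (norm≤ v))))) ⟩
  ∑ (vectors r) (λ v → ∑ radii (λ R → 𝟙 (norm v ≟ R)))
    ≡⟨ ∑-swap (vectors r) radii _ ⟩
  ∑ radii (λ R → ∑ (vectors r) (λ v → 𝟙 (norm v ≟ R)))
    ≡⟨ ∑-cong radii (λ R → sym (length-filter-∑ (λ v → norm v ≟ R) (vectors r))) ⟩
  ∑ radii (λ R → length (sphere r R))
    ≤⟨ le ⟩
  length radii * length (sphere r R)
    ≡⟨ cong (_* length (sphere r R)) (length-downFrom (suc (r * (d * d)))) ⟩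
  suc (r * (d * d)) * length (sphere r R) ∎)
  where
  open ≤-Reasoning
  open Digits d
  radii = downFrom (suc (r * (d * d)))

-- The parabola modulo a prime

∣-difference : ∀ p a c U U′ → a + U * p ≡ c + U′ * p → p ∣ ∣ a - c ∣
∣-difference p a c U U′ eq = subst (p ∣_) (shifted a c (U * p) (U′ * p) eq)
  (divides ∣ U′ - U ∣ (sym (*-distribʳ-∣-∣ p U′ U)))
  where
  shifted : ∀ a c x y → a + x ≡ c + y → ∣ y - x ∣ ≡ ∣ a - c ∣
  shifted a c x y e = trans (sym (∣m+n-m+o∣≡∣n-o∣ (a + c) y x)) (trans (cong₂ ∣_-_∣ (eq₁ a c y) (trans (eq₂ a c x) (cong (c +_) e)))
    (trans (cong₂ ∣_-_∣ (+-comm a (c + y)) (+-comm c (c + y))) (∣m+n-m+o∣≡∣n-o∣ (c + y) a c)))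
    where
    eq₁ : ∀ a c y → a + c + y ≡ a + (c + y)
    eq₁ = solve-∀
    eq₂ : ∀ a c x → a + c + x ≡ c + (a + x)
    eq₂ = solve-∀

∣∧<⇒≡0 : ∀ {p m} → p ∣ m → m < p → m ≡ 0
∣∧<⇒≡0 {p} {zero}  _   _   = refl
∣∧<⇒≡0 {p} {suc m} p∣m m<p = ⊥-elim (<⇒≱ m<p (∣⇒≤ p∣m))

module Parabola (p : ℕ) (pp : Prime p) (2<p : 2 < p) where

  instance
    p≢0 : NonZero p
    p≢0 = prime⇒nonZero pp

  residue : ℕ → ℕ
  residue x = (x * x) % p

  -- With t = x₁ - x₃ = x₄ - x₂ the difference of the sums of squares is 2 t (x₃ - x₂). The odd
  -- prime p divides t or x₃ - x₂, and both are smaller than p in absolute value.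
  parabola-ordered : ∀ x₁ x₂ x₃ x₄ → x₃ ≤ x₁ → x₁ < p → x₂ < p → x₃ < p → x₁ + x₂ ≡ x₃ + x₄ →
    residue x₁ + residue x₂ ≡ residue x₃ + residue x₄ → (x₁ ≡ x₃ × x₂ ≡ x₄) ⊎ (x₁ ≡ x₄ × x₂ ≡ x₃)
  parabola-ordered x₁ x₂ x₃ x₄ x₃≤x₁ x₁<p x₂<p x₃<p sum res = conclude (euclidsLemma (2 * t) ∣ x₃ - x₂ ∣ pp p∣)
    where
    t = x₁ ∸ x₃
    x₁≡ : x₁ ≡ x₃ + t
    x₁≡ = sym (m+[n∸m]≡n x₃≤x₁)
    x₄≡ : x₂ + t ≡ x₄
    x₄≡ = +-cancelˡ-≡ x₃ _ _ (trans (eq₀ x₃ x₂ t) (trans (cong (_+ x₂) (sym x₁≡)) sum))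
      where
      eq₀ : ∀ x y t → x + (y + t) ≡ x + t + y
      eq₀ = solve-∀
    q : ℕ → ℕ
    q x = (x * x) / p
    square : ∀ x → x * x ≡ residue x + q x * p
    square x = m≡m%n+[m/n]*n (x * x) p
    squares : x₁ * x₁ + x₂ * x₂ + (q x₃ + q x₄) * p ≡ x₃ * x₃ + x₄ * x₄ + (q x₁ + q x₂) * p
    squares = begin
      x₁ * x₁ + x₂ * x₂ + (q x₃ + q x₄) * p
        ≡⟨ cong (_+ (q x₃ + q x₄) * p) (cong₂ _+_ (square x₁) (square x₂)) ⟩
      residue x₁ + q x₁ * p + (residue x₂ + q x₂ * p) + (q x₃ + q x₄) * p
        ≡⟨ eq₁ (residue x₁) (q x₁) (residue x₂) (q x₂) p ((q x₃ + q x₄) * p) ⟩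
      residue x₁ + residue x₂ + ((q x₁ + q x₂) * p + (q x₃ + q x₄) * p)
        ≡⟨ cong₂ _+_ res (+-comm ((q x₁ + q x₂) * p) _) ⟩
      residue x₃ + residue x₄ + ((q x₃ + q x₄) * p + (q x₁ + q x₂) * p)
        ≡⟨ sym (eq₁ (residue x₃) (q x₃) (residue x₄) (q x₄) p ((q x₁ + q x₂) * p)) ⟩
      residue x₃ + q x₃ * p + (residue x₄ + q x₄ * p) + (q x₁ + q x₂) * p
        ≡⟨ cong (_+ (q x₁ + q x₂) * p) (sym (cong₂ _+_ (square x₃) (square x₄))) ⟩
      x₃ * x₃ + x₄ * x₄ + (q x₁ + q x₂) * p ∎
      where
      open ≡-Reasoning
      eq₁ : ∀ r u s v p w → r + u * p + (s + v * p) + w ≡ r + s + ((u + v) * p + w)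
      eq₁ = solve-∀
    expanded : 2 * t * x₃ + (q x₃ + q x₄) * p ≡ 2 * t * x₂ + (q x₁ + q x₂) * p
    expanded = +-cancelˡ-≡ (x₃ * x₃ + x₂ * x₂ + t * t) _ _ (begin
      x₃ * x₃ + x₂ * x₂ + t * t + (2 * t * x₃ + (q x₃ + q x₄) * p)
        ≡⟨ eq₁ x₃ x₂ t ((q x₃ + q x₄) * p) ⟩
      (x₃ + t) * (x₃ + t) + x₂ * x₂ + (q x₃ + q x₄) * p
        ≡⟨ cong (λ z → z * z + x₂ * x₂ + (q x₃ + q x₄) * p) (sym x₁≡) ⟩
      x₁ * x₁ + x₂ * x₂ + (q x₃ + q x₄) * p
        ≡⟨ squares ⟩
      x₃ * x₃ + x₄ * x₄ + (q x₁ + q x₂) * p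
        ≡⟨ cong (λ z → x₃ * x₃ + z * z + (q x₁ + q x₂) * p) (sym x₄≡) ⟩
      x₃ * x₃ + (x₂ + t) * (x₂ + t) + (q x₁ + q x₂) * p
        ≡⟨ eq₂ x₃ x₂ t ((q x₁ + q x₂) * p) ⟩
      x₃ * x₃ + x₂ * x₂ + t * t + (2 * t * x₂ + (q x₁ + q x₂) * p) ∎)
      where
      open ≡-Reasoning
      eq₁ : ∀ x y t w → x * x + y * y + t * t + (2 * t * x + w) ≡ (x + t) * (x + t) + y * y + w
      eq₁ = solve-∀
      eq₂ : ∀ x y t w → x * x + (y + t) * (y + t) + w ≡ x * x + y * y + t * t + (2 * t * y + w)
      eq₂ = solve-∀
    p∣ : p ∣ 2 * t * ∣ x₃ - x₂ ∣
    p∣ = subst (p ∣_) (sym (*-distribˡ-∣-∣ (2 * t) x₃ x₂))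
      (∣-difference p (2 * t * x₃) (2 * t * x₂) (q x₃ + q x₄) (q x₁ + q x₂) expanded)
    conclude : p ∣ 2 * t ⊎ p ∣ ∣ x₃ - x₂ ∣ → (x₁ ≡ x₃ × x₂ ≡ x₄) ⊎ (x₁ ≡ x₄ × x₂ ≡ x₃)
    conclude (inj₂ p∣diff) = inj₂ (trans x₁≡ (trans (cong (_+ t) x₃≡x₂) x₄≡) , sym x₃≡x₂)
      where
      x₃≡x₂ : x₃ ≡ x₂
      x₃≡x₂ = ∣m-n∣≡0⇒m≡n (∣∧<⇒≡0 p∣diff (≤-<-trans (∣m-n∣≤m⊔n x₃ x₂) (⊔-pres-<m x₃<p x₂<p)))
    conclude (inj₁ p∣2t) with euclidsLemma 2 t pp p∣2t
    ... | inj₁ p∣2 = ⊥-elim (<⇒≱ 2<p (∣⇒≤ p∣2))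
    ... | inj₂ p∣t = inj₁ (trans x₁≡ (trans (cong (x₃ +_) t≡0) (+-identityʳ x₃)) ,
                           trans (sym (+-identityʳ x₂)) (trans (cong (x₂ +_) (sym t≡0)) x₄≡))
      where
      t≡0 : t ≡ 0
      t≡0 = ∣∧<⇒≡0 p∣t (≤-<-trans (m∸n≤m x₁ x₃) x₁<p)

  parabola-sidon : ∀ x₁ x₂ x₃ x₄ → x₁ < p → x₂ < p → x₃ < p → x₄ < p → x₁ + x₂ ≡ x₃ + x₄ →
    residue x₁ + residue x₂ ≡ residue x₃ + residue x₄ → (x₁ ≡ x₃ × x₂ ≡ x₄) ⊎ (x₁ ≡ x₄ × x₂ ≡ x₃)
  parabola-sidon x₁ x₂ x₃ x₄ <₁ <₂ <₃ <₄ sum res = Sum.[ (λ x₃≤x₁ → parabola-ordered x₁ x₂ x₃ x₄ x₃≤x₁ <₁ <₂ <₃ sum res) ,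
    (λ x₁≤x₃ → Sum.map (λ (e , e′) → sym e , sym e′) (λ (e , e′) → sym e′ , sym e)
      (parabola-ordered x₃ x₄ x₁ x₂ x₁≤x₃ <₃ <₄ <₁ (sym sum) (sym res))) ]′ (≤-total x₃ x₁)

  -- Erdős–Turán: the graph of x ↦ x² mod p in base 4p, so that sums of four elements produce no carry.
  point : ℕ → ℕ
  point x = suc (residue x + 4 * p * x)

  residue<p : ∀ x → residue x < p
  residue<p x = m%n<n (x * x) p

  point-injective : ∀ {x y} → point x ≡ point y → x ≡ y
  point-injective {x} {y} eq = proj₂ (digit-unique (4 * p) x y (<-≤-trans (residue<p x) (m≤m+n p _))
    (<-≤-trans (residue<p y) (m≤m+n p _)) (suc-injective eq))

  point-sidon : ∀ x₁ x₂ x₃ x₄ → x₁ < p → x₂ < p → x₃ < p → x₄ < p → point x₁ + point x₂ ≡ point x₃ + point x₄ →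
    (x₁ ≡ x₃ × x₂ ≡ x₄) ⊎ (x₁ ≡ x₄ × x₂ ≡ x₃)
  point-sidon x₁ x₂ x₃ x₄ <₁ <₂ <₃ <₄ eq = parabola-sidon x₁ x₂ x₃ x₄ <₁ <₂ <₃ <₄ (proj₂ coordinates) (proj₁ coordinates)
    where
    small : ∀ x y → residue x + residue y < 4 * p
    small x y = <-≤-trans (+-mono-< (residue<p x) (residue<p y)) (≤-trans (m≤m+n (p + p) (p + p)) (≤-reflexive (eq₀ p)))
      where
      eq₀ : ∀ p → p + p + (p + p) ≡ 4 * p
      eq₀ = solve-∀
    eq₁ : ∀ r s p x y → 2 + (r + s + 4 * p * (x + y)) ≡ suc (r + 4 * p * x) + suc (s + 4 * p * y)
    eq₁ = solve-∀
    coordinates : residue x₁ + residue x₂ ≡ residue x₃ + residue x₄ × x₁ + x₂ ≡ x₃ + x₄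
    coordinates = digit-unique (4 * p) (x₁ + x₂) (x₃ + x₄) (small x₁ x₂) (small x₃ x₄)
      (+-cancelˡ-≡ 2 _ _ (trans (eq₁ (residue x₁) (residue x₂) p x₁ x₂) (trans eq (sym (eq₁ (residue x₃) (residue x₄) p x₃ x₄)))))

  point-mean : ∀ x₁ x₂ x₃ x₄ x₅ → point x₁ + point x₂ + point x₃ + point x₄ ≡ 4 * point x₅ → x₁ + x₂ + x₃ + x₄ ≡ 4 * x₅
  point-mean x₁ x₂ x₃ x₄ x₅ eq = proj₂ (digit-unique (4 * p) (x₁ + x₂ + x₃ + x₄) (4 * x₅) small (*-monoʳ-< 4 (residue<p x₅))
    (+-cancelˡ-≡ 4 _ _ (trans (eq₁ (residue x₁) (residue x₂) (residue x₃) (residue x₄) p x₁ x₂ x₃ x₄)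
      (trans eq (eq₂ (residue x₅) p x₅)))))
    where
    small : residue x₁ + residue x₂ + residue x₃ + residue x₄ < 4 * p
    small = <-≤-trans (+-mono-< (+-mono-< (+-mono-< (residue<p x₁) (residue<p x₂)) (residue<p x₃)) (residue<p x₄)) (≤-reflexive (eq₀ p))
      where
      eq₀ : ∀ p → p + p + p + p ≡ 4 * p
      eq₀ = solve-∀
    eq₁ : ∀ r s t u p x y z w → 4 + (r + s + t + u + 4 * p * (x + y + z + w)) ≡
          suc (r + 4 * p * x) + suc (s + 4 * p * y) + suc (t + 4 * p * z) + suc (u + 4 * p * w)
    eq₁ = solve-∀
    eq₂ : ∀ r p x → 4 * suc (r + 4 * p * x) ≡ 4 + (4 * r + 4 * p * (4 * x))
    eq₂ = solve-∀

  point≤ : ∀ {x y} → x < y → point x ≤ 4 * p * y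
  point≤ {x} {y} x<y = begin
    suc (residue x) + 4 * p * x    ≤⟨ +-monoˡ-≤ (4 * p * x) (≤-trans (residue<p x) (m≤m+n p _)) ⟩
    4 * p + 4 * p * x              ≡⟨ sym (*-suc (4 * p) x) ⟩
    4 * p * suc x                  ≤⟨ *-monoʳ-≤ (4 * p) x<y ⟩
    4 * p * y                      ∎
    where open ≤-Reasoning

good-set : ∀ d r p n → Prime p → 2 < p → (4 * d) ^ r ≤ p → 4 * p * (4 * d) ^ r ≤ n →
           ∃ λ A → Good n A × d ^ r ≤ suc (r * (d * d)) * length A
good-set d r p n pp 2<p b^r≤p ≤n with large-sphere d r
... | R , large = A , (unique , range , sidon , free) ,
  ≤-trans large (≤-reflexive (cong (suc (r * (d * d)) *_) (sym (length-map encode (sphere r R)))))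
  where
  open Digits d
  open Parabola p pp 2<p
  encode : Vec (Fin d) r → ℕ
  encode v = point (value v)
  A : List ℕ
  A = map encode (sphere r R)
  unique : Unique A
  unique = map⁺ (value-injective ∘ point-injective) (filter⁺ (λ v → norm v ≟ R) (vectors-unique r))
  range : InRange n A
  range = AllProperties.map⁺ (All.universal (λ v → s≤s z≤n , ≤-trans (point≤ (value<b^r v)) ≤n) (sphere r R))
  value<p : ∀ v → value v < p
  value<p v = <-≤-trans (value<b^r v) b^r≤p
  preimage : ∀ {x} → x ∈ A → ∃ λ v → norm v ≡ R × x ≡ encode v
  preimage x∈ with ∈-map⁻ encode x∈
  ... | v , v∈ , x≡ = v , proj₂ (∈-filter⁻ (λ v → norm v ≟ R) {xs = vectors r} v∈) , x≡
  encode-sidon : ∀ v₁ v₂ v₃ v₄ → encode v₁ + encode v₂ ≡ encode v₃ + encode v₄ →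
    (encode v₁ ≡ encode v₃ × encode v₂ ≡ encode v₄) ⊎ (encode v₁ ≡ encode v₄ × encode v₂ ≡ encode v₃)
  encode-sidon v₁ v₂ v₃ v₄ eq = Sum.map (λ (e , e′) → cong point e , cong point e′) (λ (e , e′) → cong point e , cong point e′)
    (point-sidon (value v₁) (value v₂) (value v₃) (value v₄) (value<p v₁) (value<p v₂) (value<p v₃) (value<p v₄) eq)
  sidon : Sidon A
  sidon x₁∈ x₂∈ x₃∈ x₄∈ eq with preimage x₁∈ | preimage x₂∈ | preimage x₃∈ | preimage x₄∈
  ... | v₁ , _ , refl | v₂ , _ , refl | v₃ , _ , refl | v₄ , _ , refl = encode-sidon v₁ v₂ v₃ v₄ eq
  free : NoDistinctSolution A
  free x₁∈ x₂∈ x₃∈ x₄∈ x₅∈ (x₁≢x₂ , _) eq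
    with preimage x₁∈ | preimage x₂∈ | preimage x₃∈ | preimage x₄∈ | preimage x₅∈
  ... | v₁ , e₁ , refl | v₂ , e₂ , refl | v₃ , e₃ , refl | v₄ , e₄ , refl | v₅ , e₅ , refl =
    x₁≢x₂ (cong encode (sphere-mean-free R v₁ v₂ v₃ v₄ v₅ e₁ e₂ e₃ e₄ e₅
      (point-mean (value v₁) (value v₂) (value v₃) (value v₄) (value v₅) eq)))

-- Choice of the parameters

n²≤2^n : ∀ m → (m + 4) * (m + 4) ≤ 2 ^ (m + 4)
n²≤2^n zero    = ≤-refl
n²≤2^n (suc m) = begin
  (suc m + 4) * (suc m + 4)              ≤⟨ m≤m+n _ (m * m + 6 * m + 7) ⟩
  (suc m + 4) * (suc m + 4) + (m * m + 6 * m + 7)  ≡⟨ eq m ⟩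
  2 * ((m + 4) * (m + 4))                ≤⟨ *-monoʳ-≤ 2 (n²≤2^n m) ⟩
  2 * 2 ^ (m + 4)                        ∎
  where
  open ≤-Reasoning
  eq : ∀ m → (suc m + 4) * (suc m + 4) + (m * m + 6 * m + 7) ≡ 2 * ((m + 4) * (m + 4))
  eq = solve-∀

linear≤2^ : ∀ c r → c ≤ r → 4 ≤ r → c * r ≤ 2 ^ r
linear≤2^ c r c≤r 4≤r = ≤-trans (*-monoˡ-≤ r c≤r)
  (subst (λ t → t * t ≤ 2 ^ t) (m∸n+n≡m 4≤r) (n²≤2^n (r ∸ 4)))

bracket : ∀ (g : ℕ → ℕ) n f r → g r ≤ n → n < g (f + r) → ∃ λ s → r ≤ s × g s ≤ n × n < g (suc s)
bracket g n zero    r ge lt = ⊥-elim (<⇒≱ lt ge)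
bracket g n (suc f) r ge lt with n <? g (suc r)
... | yes lt′ = r , ≤-refl , ge , lt′
... | no ¬lt′ with bracket g n f (suc r) (≮⇒≥ ¬lt′) (subst (λ t → n < g t) (sym (+-suc f r)) lt)
... | s , r<s , ge′ , lt″ = s , ≤-trans (n≤1+n r) r<s , ge′ , lt″

module Parameters (k : ℕ) where

  β : ℕ
  β = 2 * k + 4

  d : ℕ
  d = 2 ^ (2 * k + 2)

  base : 4 * d ≡ 2 ^ β
  base = trans (sym (^-distribˡ-+-* 2 2 (2 * k + 2))) (cong (2 ^_) (eq k))
    where
    eq : ∀ k → 2 + (2 * k + 2) ≡ 2 * k + 4
    eq = solve-∀

  -- The value of 4 p y for the largest admissible prime p = 2^(β r + r) and y = (4 d)^r = 2^(β r).
  room : ℕ → ℕ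
  room r = 2 ^ ((2 * β + 1) * r + 2)

  -- The three summands ensure in turn that the number of radii is at most 2^r, that a prime exists
  -- in the required range, and that the comparison in `exponents` holds.
  r₀ : ℕ
  r₀ = suc (d * d) + (suc (2 * (β + 1)) + (4 * k + 11))

  large-good-set : ∀ r n → r₀ ≤ r → room r ≤ n → ∃ λ A → Good n A × 2 ^ ((2 * k + 1) * r) ≤ length A
  large-good-set zero    n ()
  large-good-set r@(suc r′) n r₀≤r ≤n = A , good , *-cancelʳ-≤ _ _ (2 ^ r) {{m^n≢0 2 r}} (begin
      2 ^ ((2 * k + 1) * r) * 2 ^ r      ≡⟨ sym (^-distribˡ-+-* 2 ((2 * k + 1) * r) r) ⟩
      2 ^ ((2 * k + 1) * r + r)          ≡⟨ cong (2 ^_) (eq₁ k r) ⟩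
      2 ^ ((2 * k + 2) * r)              ≡⟨ sym (^-*-assoc 2 (2 * k + 2) r) ⟩
      d ^ r                              ≤⟨ large ⟩
      suc (r * (d * d)) * length A       ≤⟨ *-monoˡ-≤ (length A) radii≤ ⟩
      2 ^ r * length A                   ≡⟨ *-comm (2 ^ r) (length A) ⟩
      length A * 2 ^ r                   ∎)
    where
    open ≤-Reasoning
    eq₁ : ∀ k r → (2 * k + 1) * r + r ≡ (2 * k + 2) * r
    eq₁ = solve-∀
    4≤r : 4 ≤ r
    4≤r = ≤-trans (≤-trans (≤-trans (m≤m+n 4 7) (m≤n+m 11 (4 * k))) (≤-trans (m≤n+m _ (suc (2 * (β + 1)))) (m≤n+m _ (suc (d * d))))) r₀≤r
    d²<r : suc (d * d) ≤ r
    d²<r = ≤-trans (m≤m+n _ _) r₀≤r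
    β<r : suc (2 * (β + 1)) ≤ r
    β<r = ≤-trans (≤-trans (m≤m+n _ (4 * k + 11)) (m≤n+m _ (suc (d * d)))) r₀≤r
    radii≤ : suc (r * (d * d)) ≤ 2 ^ r
    radii≤ = begin
      suc (r * (d * d))        ≤⟨ +-monoˡ-≤ (r * (d * d)) {1} {r} (s≤s z≤n) ⟩
      r + r * (d * d)          ≡⟨ trans (sym (*-suc r (d * d))) (*-comm r (suc (d * d))) ⟩
      suc (d * d) * r          ≤⟨ linear≤2^ (suc (d * d)) r d²<r 4≤r ⟩
      2 ^ r                    ∎
    -- With r = r′ + 1 the number 2 m equals 2^r y. Allowing this factor above y reduces the
    -- hypothesis of `prime-between` to β r + r < 2^r′.
    y m : ℕ
    y = (4 * d) ^ r
    m = 2 ^ (β * r + r′)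
    y≡ : y ≡ 2 ^ (β * r)
    y≡ = trans (cong (_^ r) base) (^-*-assoc 2 β r)
    m+m≡ : m + m ≡ 2 ^ (β * r + r)
    m+m≡ = trans (cong (m +_) (sym (+-identityʳ m))) (cong (2 ^_) (sym (+-suc (β * r) r′)))
    exponent : β * r + r < 2 ^ r′
    exponent = *-cancelˡ-< 2 _ _ (begin-strict
      2 * (β * r + r)            ≡⟨ eq₂ β r ⟩
      2 * (β + 1) * r            <⟨ *-monoˡ-< r (n<1+n (2 * (β + 1))) ⟩
      suc (2 * (β + 1)) * r      ≤⟨ linear≤2^ (suc (2 * (β + 1))) r β<r 4≤r ⟩
      2 ^ r                      ∎)
      where
      eq₂ : ∀ β r → 2 * (β * r + r) ≡ 2 * (β + 1) * r
      eq₂ = solve-∀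
    sparse-smooth : (m + m) ^ y < 2 ^ m
    sparse-smooth = begin-strict
      (m + m) ^ y                         ≡⟨ cong₂ _^_ m+m≡ y≡ ⟩
      (2 ^ (β * r + r)) ^ (2 ^ (β * r))   ≡⟨ ^-*-assoc 2 (β * r + r) (2 ^ (β * r)) ⟩
      2 ^ ((β * r + r) * 2 ^ (β * r))     <⟨ ^-monoʳ-< 2 (s≤s (s≤s z≤n)) (begin-strict
        (β * r + r) * 2 ^ (β * r)           <⟨ *-monoˡ-< (2 ^ (β * r)) {{m^n≢0 2 (β * r)}} exponent ⟩
        2 ^ r′ * 2 ^ (β * r)                ≡⟨ trans (*-comm (2 ^ r′) _) (sym (^-distribˡ-+-* 2 (β * r) r′)) ⟩
        m                                   ∎) ⟩
      2 ^ m                               ∎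
    suitable : ∃ λ p → Prime p × y < p × p ≤ m + m
    suitable = prime-between y m (m^n>0 2 (β * r + r′)) sparse-smooth
    p = proj₁ suitable
    y<p = proj₁ (proj₂ (proj₂ suitable))
    p≤ = proj₂ (proj₂ (proj₂ suitable))
    2≤y : 2 ≤ y
    2≤y = ≤-trans (^-monoʳ-≤ 2 {1} {β * r} (*-mono-≤ {1} {β} (≤-trans (s≤s z≤n) (m≤n+m 4 (2 * k))) (s≤s z≤n)))
                  (≤-reflexive (sym y≡))
    fits : 4 * p * y ≤ n
    fits = begin
      4 * p * y                                  ≤⟨ *-monoˡ-≤ y (*-monoʳ-≤ 4 p≤) ⟩
      4 * (m + m) * y                            ≡⟨ cong₂ (λ u v → 4 * u * v) m+m≡ y≡ ⟩
      2 ^ 2 * 2 ^ (β * r + r) * 2 ^ (β * r)      ≡⟨ cong (_* 2 ^ (β * r)) (sym (^-distribˡ-+-* 2 2 (β * r + r))) ⟩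
      2 ^ (2 + (β * r + r)) * 2 ^ (β * r)        ≡⟨ sym (^-distribˡ-+-* 2 (2 + (β * r + r)) (β * r)) ⟩
      2 ^ (2 + (β * r + r) + β * r)              ≡⟨ cong (2 ^_) (eq₂ β r) ⟩
      room r                                     ≤⟨ ≤n ⟩
      n                                          ∎
      where
      eq₂ : ∀ β r → 2 + (β * r + r) + β * r ≡ (2 * β + 1) * r + 2
      eq₂ = solve-∀
    set = good-set d r p n (proj₁ (proj₂ suitable)) (≤-trans (s≤s 2≤y) y<p) (<⇒≤ y<p) fits
    A = proj₁ set
    good = proj₁ (proj₂ set)
    large = proj₂ (proj₂ set)

  -- The coefficients of r are 4k² + 9k and 4k² + 10k + 4; the surplus k + 4 absorbs the constant
  -- (4k + 11) k as soon as r ≥ 4k + 11.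
  exponents : ∀ r → 4 * k + 11 ≤ r → ((2 * β + 1) * suc r + 2) * k ≤ (2 * k + 1) * r * (2 * (k + 2))
  exponents r le = begin
    ((2 * β + 1) * suc r + 2) * k                  ≡⟨ eq₁ k r ⟩
    (4 * k + 9) * k * r + (4 * k + 11) * k         ≤⟨ +-monoʳ-≤ ((4 * k + 9) * k * r) (*-mono-≤ le (m≤m+n k 4)) ⟩
    (4 * k + 9) * k * r + r * (k + 4)              ≡⟨ eq₂ k r ⟩
    (2 * k + 1) * r * (2 * (k + 2))                ∎
    where
    open ≤-Reasoning
    eq₁ : ∀ k r → ((2 * (2 * k + 4) + 1) * suc r + 2) * k ≡ (4 * k + 9) * k * r + (4 * k + 11) * k
    eq₁ = solve-∀
    eq₂ : ∀ k r → (4 * k + 9) * k * r + r * (k + 4) ≡ (2 * k + 1) * r * (2 * (k + 2))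
    eq₂ = solve-∀

  large-good-sets : Σ ℕ λ N → ∀ n → N ≤ n → ∃ λ A → Good n A × n ^ k ≤ length A ^ (2 * (k + 2))
  large-good-sets = room r₀ , beyond-room
    where
    open ≤-Reasoning
    beyond-room : ∀ n → room r₀ ≤ n → ∃ λ A → Good n A × n ^ k ≤ length A ^ (2 * (k + 2))
    beyond-room n room≤n with bracket room n n r₀ room≤n (begin-strict
        n                                    <⟨ n<q^n 2 ≤-refl n ⟩
        2 ^ n                                ≤⟨ ^-monoʳ-≤ 2 (≤-trans (m≤m+n n r₀) (≤-trans
                                                  (m≤n*m (n + r₀) (2 * β + 1) {{>-nonZero (m≤n+m 1 (2 * β))}}) (m≤m+n _ 2))) ⟩
        room (n + r₀)                        ∎)
    ... | r , r₀≤r , ≤n , n< with large-good-set r n r₀≤r ≤n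
    ... | A , good , large = A , good , (begin
      n ^ k                                            ≤⟨ ^-monoˡ-≤ k (<⇒≤ n<) ⟩
      room (suc r) ^ k                                 ≡⟨ ^-*-assoc 2 ((2 * β + 1) * suc r + 2) k ⟩
      2 ^ (((2 * β + 1) * suc r + 2) * k)              ≤⟨ ^-monoʳ-≤ 2 (exponents r (≤-trans (≤-trans (m≤n+m _ (suc (2 * (β + 1)))) (m≤n+m _ (suc (d * d)))) r₀≤r)) ⟩
      2 ^ ((2 * k + 1) * r * (2 * (k + 2)))            ≡⟨ sym (^-*-assoc 2 ((2 * k + 1) * r) (2 * (k + 2))) ⟩
      (2 ^ ((2 * k + 1) * r)) ^ (2 * (k + 2))          ≤⟨ ^-monoˡ-≤ (2 * (k + 2)) large ⟩
      length A ^ (2 * (k + 2))                         ∎)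

-- Asymptotics without real numbers: k + 1 plays the role of 1/ε in o(√n), and k / (2 (k + 2)) = 1/2
-- - 1/(k + 2) is an exponent tending to 1/2.
theorem1p14 : (F : ℕ → ℕ) → (∀ n → IsF n (F n)) →
    ((k : ℕ) → Σ ℕ (λ N → ∀ n → N ≤ n → (suc k * F n) * (suc k * F n) ≤ n))
    × ((k : ℕ) → Σ ℕ (λ N → ∀ n → N ≤ n → n ^ k ≤ F n ^ (2 * (k + 2))))
theorem1p14 F isF = (λ k → map₂ (upper k) (good-bounded k)) , (λ k → map₂ (lower k) (Parameters.large-good-sets k))
  where
  upper : ∀ k {N} → (∀ n A → N ≤ n → Good n A → (suc k * length A) * (suc k * length A) ≤ n) →
          ∀ n → N ≤ n → (suc k * F n) * (suc k * F n) ≤ n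
  upper k bounded n N≤n with isF n
  ... | (A , good , eq) , _ = subst (λ m → (suc k * m) * (suc k * m) ≤ n) eq (bounded n A N≤n good)
  lower : ∀ k {N} → (∀ n → N ≤ n → ∃ λ A → Good n A × n ^ k ≤ length A ^ (2 * (k + 2))) →
          ∀ n → N ≤ n → n ^ k ≤ F n ^ (2 * (k + 2))
  lower k large n N≤n with large n N≤n
  ... | A , good , le = ≤-trans le (^-monoˡ-≤ (2 * (k + 2)) (proj₂ (isF n) A good))
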